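{- There is an absolute constant $C>0$ such that for every integer $r\ge 3$, $$1-\frac1r-C\,\frac{\ln r}{r^2\ln\ln r}\;\le\;\frac{a(\mathrm{PSG}_r)}{r!}\;\le\;1-\frac1r-\frac{\varphi(r)}{r!}.$$ Hence, with such a constant, the threshold for growing paths in $r$-uniform tournaments is in the range $$\left[\left(1-\frac1r-C\,\frac{\ln r}{r^2\ln\ln r}\right)r!,\ \left(1-\frac1r-\frac{\varphi(r)-1}{r!}\right)r!\right].$$
   Context: An $r$-digraph $G$ consists of a finite vertex set $V(G)$ and an edge set $E(G)$ whose elements are ordered lists of $r$ distinct vertices. An $(r,k)$-tournament ($0\le k\le r!$) is an $r$-digraph $G$ such that for every $r$-element set $S\subseteq V(G)$, exactly $k$ of the $r!$ orderings of $S$ are edges of $G$. The tight path $P^{(r)}_s$ is the $r$-digraph with $s$ distinct vertices $v_1,\ldots,v_s$ whose edges are exactly the lists of $r$ consecutive vertices $(v_i,\ldots,v_{i+r-1})$, $1\le i\le s-r+1$ (no edges if $s<r$). An $r$-digraph $G$ contains $P^{(r)}_s$ if there is an injection of its vertices into $V(G)$ mapping edges to edges. $f(n,r,k)$ is the maximum integer $s$ such that every $n$-vertex $(r,k)$-tournament contains a copy of $P^{(r)}_s$. The threshold for growing paths (in $r$-uniform tournaments) is the minimum $k$ such that $f(n,r,k)\to\infty$ as $n\to\infty$. Two lists $(a_1,\ldots,a_s)$ and $(b_1,\ldots,b_s)$, each with distinct entries, pattern-match if for all $i<j$ we have $a_i<a_j$ if and only if $b_i<b_j$. The pattern-shift graph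 $\mathrm{PSG}_r$ is the digraph (loops allowed) whose vertices are the permutations of $[r]=\{1,\ldots,r\}$ written as lists, with an edge from $a$ to $b$ (possibly $a=b$) if and only if the list of the last $r-1$ entries of $a$ and the list of the first $r-1$ entries of $b$ pattern-match. For a digraph $G$, $a(G)$ is the maximum size of a set of vertices inducing an acyclic subgraph, i.e. one with no directed cycle (loops count as cycles of length 1, and directed 2-cycles count as cycles). $\varphi$ is the Euler totient function, $\varphi(r)=|\{d\in[r]:\gcd(d,r)=1\}|$. -}

module Defs where

open import Data.Bool using (Bool; T)
open import Data.Empty using (⊥-elim)
open import Data.Fin as Fin using (Fin)
open import Data.Fin.Properties using (any?; all?)
open import Data.Fin.Subset as Subset using (Subset)
open import Data.Integer using (+_)
import Data.Integer as ℤ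
import Data.Integer.Properties as ℤₚ
open import Data.List as List using (List; length; filter; upTo)
import Data.List.Membership.Propositional as ListMem
open import Data.List.Relation.Unary.Linked using (Linked)
import Data.List.Relation.Unary.All as ListAll
import Data.List.Relation.Unary.Unique.Propositional as ListUnique
open import Data.Nat as ℕ using (ℕ; zero; suc; z≤n; s≤s; _!)
import Data.Nat.Properties as ℕₚ
open import Data.Nat.GCD using (gcd)
open import Data.Product using (Σ; ∃-syntax; _×_; _,_; proj₁; proj₂)
open import Data.Rational using (ℚ; mkℚ; 0ℚ; 1ℚ; ½; _+_; _*_; _-_; -_; _/_; _≤_; _<_; ∣_∣; 1/_; _⊓_; *≤*; positive; nonNegative; ≢-nonZero)
open import Data.Rational.Properties
open import Data.Rational.Solver
import Data.Rational.Unnormalised as ℚᵘ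
import Data.Rational.Unnormalised.Properties as ℚᵘₚ
open import Data.Sum using (inj₁; inj₂)
open import Data.Vec as Vec using (Vec; lookup; tail; init)
open import Data.Vec.Relation.Unary.All as VecAll using ()
open import Data.Vec.Relation.Unary.Unique.Propositional as VecUnique using ()
open import Data.Vec.Relation.Unary.Unique.Propositional.Properties using (map⁺)
open import Function using (_⇔_; Injective)
open import Relation.Binary.PropositionalEquality using (_≡_; refl; sym; trans; cong; cong₂; subst)
open import Relation.Nullary using (¬_; yes; no; does)
open import Relation.Nullary.Decidable using (toWitness)
open +-*-Solver using (solve; _:+_; _:*_; _:-_; :-_; _:=_; con)

fromℕ : ℕ → ℚ
fromℕ n = + n / 1

≤-gap : ∀ {p q d} → 0ℚ ≤ d → q ≡ p + d → p ≤ q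
≤-gap {p} {q} {d} 0≤d q≡p+d =
  subst (_≤ q) (+-identityʳ p) (subst (p + 0ℚ ≤_) (sym q≡p+d) (+-monoʳ-≤ p 0≤d))

p≤q⇒0≤q-p : ∀ {p q} → p ≤ q → 0ℚ ≤ q - p
p≤q⇒0≤q-p {p} {q} p≤q = subst (_≤ q - p) (+-inverseʳ p) (+-monoˡ-≤ (- p) p≤q)

0≤p+q : ∀ {p q} → 0ℚ ≤ p → 0ℚ ≤ q → 0ℚ ≤ p + q
0≤p+q 0≤p 0≤q = +-mono-≤ 0≤p 0≤q

*-monoˡ : ∀ {p q r} → 0ℚ ≤ r → p ≤ q → r * p ≤ r * q
*-monoˡ {r = r} 0≤r = *-monoˡ-≤-nonNeg r {{nonNegative 0≤r}}

*-monoʳ : ∀ {p q r} → 0ℚ ≤ r → p ≤ q → p * r ≤ q * r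
*-monoʳ {r = r} 0≤r = *-monoʳ-≤-nonNeg r {{nonNegative 0≤r}}

0≤p*q : ∀ {p q} → 0ℚ ≤ p → 0ℚ ≤ q → 0ℚ ≤ p * q
0≤p*q {p} {q} 0≤p 0≤q = subst (_≤ p * q) (*-zeroʳ p) (*-monoˡ 0≤p 0≤q)

0<p*q : ∀ {p q} → 0ℚ < p → 0ℚ < q → 0ℚ < p * q
0<p*q {p} {q} 0<p 0<q = subst (_< p * q) (*-zeroʳ p) (*-monoʳ-<-pos p {{positive 0<p}} 0<q)

*-mono : ∀ {p q r s} → 0ℚ ≤ q → 0ℚ ≤ r → p ≤ q → r ≤ s → p * r ≤ q * s
*-mono 0≤q 0≤r p≤q r≤s = ≤-trans (*-monoʳ 0≤r p≤q) (*-monoˡ 0≤q r≤s)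

0≤p*p : ∀ p → 0ℚ ≤ p * p
0≤p*p p with ≤-total 0ℚ p
... | inj₁ 0≤p = 0≤p*q 0≤p 0≤p
... | inj₂ p≤0 = subst (0ℚ ≤_) (solve 1 (λ p → :- p :* :- p := p :* p) refl p) (0≤p*q 0≤-p 0≤-p)
  where
  0≤-p : 0ℚ ≤ - p
  0≤-p = neg-antimono-≤ p≤0

0≤½ : 0ℚ ≤ ½
0≤½ = toWitness {a? = 0ℚ ≤? ½} _

0<1 : 0ℚ < 1ℚ
0<1 = toWitness {a? = 0ℚ <? 1ℚ} _

0≤1 : 0ℚ ≤ 1ℚ
0≤1 = <⇒≤ 0<1

0<½*p : ∀ {p} → 0ℚ < p → 0ℚ < ½ * p
0<½*p 0<p = 0<p*q (toWitness {a? = 0ℚ <? ½} _) 0<p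

½p+½p≡p : ∀ p → ½ * p + ½ * p ≡ p
½p+½p≡p = solve 1 (λ p → con ½ :* p :+ con ½ :* p := p) refl

p≤∣p∣ : ∀ p → p ≤ ∣ p ∣
p≤∣p∣ p with ≤-total 0ℚ p
... | inj₁ 0≤p = ≤-reflexive (sym (0≤p⇒∣p∣≡p 0≤p))
... | inj₂ p≤0 = ≤-trans p≤0 (0≤∣p∣ p)

∣∣≤ : ∀ {p q} → p ≤ q → - p ≤ q → ∣ p ∣ ≤ q
∣∣≤ {p} {q} p≤q -p≤q with ∣p∣≡p∨∣p∣≡-p p
... | inj₁ ∣p∣≡p  = subst (_≤ q) (sym ∣p∣≡p) p≤q
... | inj₂ ∣p∣≡-p = subst (_≤ q) (sym ∣p∣≡-p) -p≤q

∣p-q∣≡∣q-p∣ : ∀ p q → ∣ p - q ∣ ≡ ∣ q - p ∣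
∣p-q∣≡∣q-p∣ p q =
  trans (sym (∣-p∣≡∣p∣ (p - q)))
        (cong ∣_∣ (solve 2 (λ p q → :- (p :- q) := q :- p) refl p q))

∣∣-+ : ∀ {p q r s t} → p ≡ q + r → ∣ q ∣ ≤ s → ∣ r ∣ ≤ t → ∣ p ∣ ≤ s + t
∣∣-+ {q = q} {r} refl ∣q∣≤s ∣r∣≤t = ≤-trans (∣p+q∣≤∣p∣+∣q∣ q r) (+-mono-≤ ∣q∣≤s ∣r∣≤t)

∣∣-* : ∀ {p q s t} → 0ℚ ≤ s → ∣ p ∣ ≤ s → ∣ q ∣ ≤ t → ∣ p * q ∣ ≤ s * t
∣∣-* {p} {q} {s} {t} 0≤s ∣p∣≤s ∣q∣≤t =
  subst (_≤ s * t) (sym (∣p*q∣≡∣p∣*∣q∣ p q)) (*-mono 0≤s (0≤∣p∣ q) ∣p∣≤s ∣q∣≤t)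

-- Total inverse, with the value 0 at 0.
inv : ℚ → ℚ
inv p with p ≟ 0ℚ
... | yes _  = 0ℚ
... | no p≢0 = (1/ p) {{≢-nonZero p≢0}}

p*inv-p≡1 : ∀ {p} → 0ℚ < p → p * inv p ≡ 1ℚ
p*inv-p≡1 {p} 0<p with p ≟ 0ℚ
... | yes p≡0 = ⊥-elim (<⇒≢ 0<p (sym p≡0))
... | no p≢0  = *-inverseʳ p {{≢-nonZero p≢0}}

0<inv : ∀ {p} → 0ℚ < p → 0ℚ < inv p
0<inv {p} 0<p with 0ℚ <? inv p
... | yes 0<i = 0<i
... | no  0≮i = ⊥-elim (<⇒≢ (<-≤-trans 0<1 1≤0) refl)
  where
  1≤0 : 1ℚ ≤ 0ℚ
  1≤0 = subst (_≤ 0ℚ) (p*inv-p≡1 0<p) (subst (p * inv p ≤_) (*-zeroʳ p) (*-monoˡ (<⇒≤ 0<p) (≮⇒≥ 0≮i)))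

inv-difference : ∀ {p q} → 0ℚ < p → 0ℚ < q → inv p - inv q ≡ (q - p) * (inv p * inv q)
inv-difference {p} {q} 0<p 0<q = sym (trans
  (solve 4 (λ p q i j → (q :- p) :* (i :* j) := i :* (q :* j) :- p :* i :* j) refl p q (inv p) (inv q))
  (trans
    (cong₂ (λ u v → inv p * u - v * inv q) (p*inv-p≡1 0<q) (p*inv-p≡1 0<p))
    (solve 2 (λ i j → i :* con 1ℚ :- con 1ℚ :* j := i :- j) refl (inv p) (inv q))))

inv-antimono : ∀ {p q} → 0ℚ < p → p ≤ q → inv q ≤ inv p
inv-antimono {p} {q} 0<p p≤q =
  ≤-gap (0≤p*q (p≤q⇒0≤q-p p≤q) (0≤p*q (<⇒≤ (0<inv 0<p)) (<⇒≤ (0<inv 0<q))))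
    (trans (solve 2 (λ i j → i := j :+ (i :- j)) refl (inv p) (inv q))
           (cong (_+_ (inv q)) (inv-difference 0<p 0<q)))
  where
  0<q : 0ℚ < q
  0<q = <-≤-trans 0<p p≤q

inv-lipschitz : ∀ {δ p q} → 0ℚ < δ → δ ≤ p → δ ≤ q →
                ∣ inv p - inv q ∣ ≤ ∣ p - q ∣ * (inv δ * inv δ)
inv-lipschitz {δ} {p} {q} 0<δ δ≤p δ≤q =
  subst (_≤ ∣ p - q ∣ * (inv δ * inv δ)) (cong ∣_∣ (sym (inv-difference 0<p 0<q)))
    (∣∣-* (0≤∣p∣ (p - q)) (≤-reflexive (∣p-q∣≡∣q-p∣ q p))
      (∣∣-* (<⇒≤ (0<inv 0<δ))
        (≤-trans (≤-reflexive (0≤p⇒∣p∣≡p (<⇒≤ (0<inv 0<p)))) (inv-antimono 0<δ δ≤p))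
        (≤-trans (≤-reflexive (0≤p⇒∣p∣≡p (<⇒≤ (0<inv 0<q)))) (inv-antimono 0<δ δ≤q))))
  where
  0<p : 0ℚ < p
  0<p = <-≤-trans 0<δ δ≤p
  0<q : 0ℚ < q
  0<q = <-≤-trans 0<δ δ≤q

fromℕ-suc : ∀ n → fromℕ (suc n) ≡ 1ℚ + fromℕ n
fromℕ-suc n = toℚᵘ-injective (ℚᵘₚ.≃-sym
  (ℚᵘₚ.≃-trans (toℚᵘ-homo-+ 1ℚ (fromℕ n))
  (ℚᵘₚ.≃-trans (ℚᵘₚ.+-congʳ ℚᵘ.1ℚᵘ (toℚᵘ-fromℚᵘ (ℚᵘ.mkℚᵘ (+ n) 0)))
  (ℚᵘₚ.≃-trans (ℚᵘ.*≡* (cong (ℤ._* (+ 1)) (cong (ℤ._+_ (+ 1)) (ℤₚ.*-identityʳ (+ n)))))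
    (ℚᵘₚ.≃-sym (toℚᵘ-fromℚᵘ (ℚᵘ.mkℚᵘ (+ suc n) 0)))))))

fromℕ-mono : ∀ {m n} → m ℕ.≤ n → fromℕ m ≤ fromℕ n
fromℕ-mono {n = zero}  z≤n = ≤-refl
fromℕ-mono {n = suc n} z≤n =
  subst (0ℚ ≤_) (sym (fromℕ-suc n)) (0≤p+q 0≤1 (fromℕ-mono {n = n} z≤n))
fromℕ-mono {suc m} {suc n} (s≤s m≤n) =
  subst (_≤ fromℕ (suc n)) (sym (fromℕ-suc m))
    (subst (1ℚ + fromℕ m ≤_) (sym (fromℕ-suc n)) (+-monoʳ-≤ 1ℚ (fromℕ-mono m≤n)))

archimedean : ∀ p → ∃[ n ] p ≤ fromℕ n
archimedean (mkℚ (+ n) d-1 c) = n , toℚᵘ-cancel-≤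
  (ℚᵘₚ.≤-respʳ-≃ (ℚᵘₚ.≃-sym (toℚᵘ-fromℚᵘ (ℚᵘ.mkℚᵘ (+ n) 0)))
    (ℚᵘ.*≤* (ℤₚ.*-monoˡ-≤-nonNeg (+ n) (ℤ.+≤+ (s≤s z≤n)))))
archimedean (mkℚ ℤ.-[1+ n ] d-1 c) = 0 , *≤* ℤ.-≤+

½^ : ℕ → ℚ
½^ zero    = 1ℚ
½^ (suc n) = ½ * ½^ n

0≤½^ : ∀ n → 0ℚ ≤ ½^ n
0≤½^ zero    = 0≤1
0≤½^ (suc n) = 0≤p*q 0≤½ (0≤½^ n)

fromℕ*½^≤1 : ∀ n → fromℕ (suc n) * ½^ n ≤ 1ℚ
fromℕ*½^≤1 zero    = ≤-refl
fromℕ*½^≤1 (suc n) = ≤-trans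
  (≤-gap (0≤p*q (0≤p*q 0≤½ (0≤½^ n)) (p≤q⇒0≤q-p (fromℕ-mono {1} {suc n} (s≤s z≤n))))
    (trans
      (solve 2 (λ k h → k :* h := (con 1ℚ :+ k) :* (con ½ :* h) :+ con ½ :* h :* (k :- con 1ℚ)) refl
        (fromℕ (suc n)) (½^ n))
      (cong (λ k → k * ½^ (suc n) + ½ * ½^ n * (fromℕ (suc n) - 1ℚ)) (sym (fromℕ-suc (suc n))))))
  (fromℕ*½^≤1 n)

shrink : ∀ {K ε} → 0ℚ ≤ K → 0ℚ < ε → ∃[ η ] (0ℚ < η × K * η ≤ ε)
shrink {K} {ε} 0≤K 0<ε = ε * inv K+1 , 0<p*q 0<ε (0<inv 0<K+1) ,
  ≤-gap (0≤p*q (<⇒≤ 0<ε) (<⇒≤ (0<inv 0<K+1)))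
    (trans (sym (*-identityʳ ε))
    (trans (cong (_*_ ε) (sym (p*inv-p≡1 0<K+1)))
      (solve 3 (λ K ε i → ε :* ((K :+ con 1ℚ) :* i) := K :* (ε :* i) :+ ε :* i) refl K ε (inv K+1))))
  where
  K+1 : ℚ
  K+1 = K + 1ℚ
  0<K+1 : 0ℚ < K+1
  0<K+1 = +-mono-≤-< 0≤K 0<1

½^-vanishes : ∀ {K ε} → 0ℚ ≤ K → 0ℚ < ε → ∃[ N ] (∀ {n} → N ℕ.≤ n → K * ½^ n ≤ ε)
½^-vanishes {K} {ε} 0≤K 0<ε = N , bound
  where
  N : ℕ
  N = proj₁ (archimedean (K * inv ε))
  K≡ : K ≡ K * inv ε * ε
  K≡ = sym (trans (solve 3 (λ K i e → K :* i :* e := K :* (e :* i)) refl K (inv ε) ε)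
                  (trans (cong (_*_ K) (p*inv-p≡1 0<ε)) (*-identityʳ K)))
  bound : ∀ {n} → N ℕ.≤ n → K * ½^ n ≤ ε
  bound {n} N≤n = ≤-trans
    (*-monoʳ (0≤½^ n)
      (≤-trans (≤-reflexive K≡)
        (*-monoʳ (<⇒≤ 0<ε)
          (≤-trans (proj₂ (archimedean (K * inv ε))) (fromℕ-mono (ℕₚ.m≤n⇒m≤1+n N≤n))))))
    (≤-trans
      (≤-reflexive (solve 3 (λ k e h → k :* e :* h := e :* (k :* h)) refl (fromℕ (suc n)) ε (½^ n)))
      (≤-trans (*-monoˡ (<⇒≤ 0<ε) (fromℕ*½^≤1 n)) (≤-reflexive (*-identityʳ ε))))

-- Riemann sums of ∫ dt/t over [a , b], on 2ⁿ equal pieces with the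
-- integrand evaluated at the right end of each piece

midpoint : ℚ → ℚ → ℚ
midpoint a b = ½ * (a + b)

riemannSum : ℕ → ℚ → ℚ → ℚ
riemannSum zero    a b = (b - a) * inv b
riemannSum (suc n) a b = riemannSum n a (midpoint a b) + riemannSum n (midpoint a b) b

≤-midpoint : ∀ {δ a b} → δ ≤ a → δ ≤ b → δ ≤ midpoint a b
≤-midpoint {δ} {a} {b} δ≤a δ≤b =
  ≤-trans (≤-reflexive (solve 1 (λ d → d := con ½ :* (d :+ d)) refl δ))
          (*-monoˡ 0≤½ (+-mono-≤ δ≤a δ≤b))

0<midpoint : ∀ {a b} → 0ℚ < a → 0ℚ < b → 0ℚ < midpoint a b
0<midpoint 0<a 0<b = 0<½*p (+-mono-< 0<a 0<b)

module _ {δ : ℚ} (0<δ : 0ℚ < δ) where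

  private
    D : ℚ
    D = inv δ

    0≤D : 0ℚ ≤ D
    0≤D = <⇒≤ (0<inv 0<δ)

    0≤inv : ∀ {p} → δ ≤ p → 0ℚ ≤ inv p
    0≤inv δ≤p = <⇒≤ (0<inv (<-≤-trans 0<δ δ≤p))

  refinementGap : ℕ → ℚ → ℚ → ℚ
  refinementGap n a b = ½ * ½ * ((b - a) * (b - a)) * (D * D) * ½^ n

  private
    gap₀ : ∀ {a b} → δ ≤ a → δ ≤ b → let m = midpoint a b in
      riemannSum 1 a b ≡ riemannSum 0 a b + ½ * ½ * ((b - a) * (b - a)) * (inv m * inv b)
    gap₀ {a} {b} δ≤a δ≤b = trans
      (solve 4 (λ a b μ β →
          (con ½ :* (a :+ b) :- a) :* μ :+ (b :- con ½ :* (a :+ b)) :* β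
        := (b :- a) :* β :+ (con ½ :* (a :+ b) :- a) :* (μ :- β))
        refl a b (inv (midpoint a b)) (inv b))
      (cong (_+_ ((b - a) * inv b)) (trans
        (cong (_*_ (midpoint a b - a))
          (inv-difference (<-≤-trans 0<δ (≤-midpoint δ≤a δ≤b)) (<-≤-trans 0<δ δ≤b)))
        (solve 4 (λ a b μ β →
            (con ½ :* (a :+ b) :- a) :* ((b :- con ½ :* (a :+ b)) :* (μ :* β))
          := con ½ :* con ½ :* ((b :- a) :* (b :- a)) :* (μ :* β))
          refl a b (inv (midpoint a b)) (inv b))))

    0≤¼sq : ∀ a b → 0ℚ ≤ ½ * ½ * ((b - a) * (b - a))
    0≤¼sq a b = 0≤p*q (0≤p*q 0≤½ 0≤½) (0≤p*p (b - a))

  riemannSum-refine : ∀ n {a b} → δ ≤ a → δ ≤ b → riemannSum n a b ≤ riemannSum (suc n) a b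
  riemannSum-refine zero {a} {b} δ≤a δ≤b = ≤-gap
    (0≤p*q (0≤¼sq a b) (0≤p*q (0≤inv (≤-midpoint δ≤a δ≤b)) (0≤inv δ≤b)))
    (gap₀ δ≤a δ≤b)
  riemannSum-refine (suc n) δ≤a δ≤b =
    +-mono-≤ (riemannSum-refine n δ≤a (≤-midpoint δ≤a δ≤b))
             (riemannSum-refine n (≤-midpoint δ≤a δ≤b) δ≤b)

  riemannSum-refine-bound : ∀ n {a b} → δ ≤ a → δ ≤ b →
    riemannSum (suc n) a b ≤ riemannSum n a b + refinementGap n a b
  riemannSum-refine-bound zero {a} {b} δ≤a δ≤b = ≤-trans
    (≤-reflexive (gap₀ δ≤a δ≤b))
    (+-monoʳ-≤ (riemannSum 0 a b) (≤-trans
      (*-monoˡ (0≤¼sq a b)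
        (*-mono 0≤D (0≤inv δ≤b) (inv-antimono 0<δ (≤-midpoint δ≤a δ≤b)) (inv-antimono 0<δ δ≤b)))
      (≤-reflexive (sym (*-identityʳ (½ * ½ * ((b - a) * (b - a)) * (D * D)))))))
  riemannSum-refine-bound (suc n) {a} {b} δ≤a δ≤b = ≤-trans
    (+-mono-≤ (riemannSum-refine-bound n δ≤a (≤-midpoint δ≤a δ≤b))
              (riemannSum-refine-bound n (≤-midpoint δ≤a δ≤b) δ≤b))
    (≤-reflexive (solve 6
      (λ a b D h s t → let m = con ½ :* (a :+ b) ; ¼ = con ½ :* con ½ in
           (s :+ ¼ :* ((m :- a) :* (m :- a)) :* (D :* D) :* h)
        :+ (t :+ ¼ :* ((b :- m) :* (b :- m)) :* (D :* D) :* h)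
        := (s :+ t) :+ ¼ :* ((b :- a) :* (b :- a)) :* (D :* D) :* (con ½ :* h))
      refl a b D (½^ n) (riemannSum n a (midpoint a b)) (riemannSum n (midpoint a b) b)))

  riemannSum-mono : ∀ k {n a b} → δ ≤ a → δ ≤ b → riemannSum n a b ≤ riemannSum (k ℕ.+ n) a b
  riemannSum-mono zero    δ≤a δ≤b = ≤-refl
  riemannSum-mono (suc k) {n} δ≤a δ≤b =
    ≤-trans (riemannSum-mono k δ≤a δ≤b) (riemannSum-refine (k ℕ.+ n) δ≤a δ≤b)

  riemannSum-antimono : ∀ k {n a b} → δ ≤ a → δ ≤ b →
    let G = λ i → refinementGap i a b + refinementGap i a b in
    riemannSum (k ℕ.+ n) a b + G (k ℕ.+ n) ≤ riemannSum n a b + G n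
  riemannSum-antimono zero    δ≤a δ≤b = ≤-refl
  riemannSum-antimono (suc k) {n} {a} {b} δ≤a δ≤b = ≤-trans
    (+-monoˡ-≤ _ (riemannSum-refine-bound (k ℕ.+ n) δ≤a δ≤b))
    (≤-trans
      (≤-reflexive (solve 3
        (λ s c h → s :+ c :* h :+ (c :* (con ½ :* h) :+ c :* (con ½ :* h)) := s :+ (c :* h :+ c :* h))
        refl (riemannSum (k ℕ.+ n) a b) (½ * ½ * ((b - a) * (b - a)) * (D * D)) (½^ (k ℕ.+ n))))
      (riemannSum-antimono k δ≤a δ≤b))

  0≤refinementGap : ∀ n a b → 0ℚ ≤ refinementGap n a b
  0≤refinementGap n a b = 0≤p*q (0≤p*q (0≤¼sq a b) (0≤p*q 0≤D 0≤D)) (0≤½^ n)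

  riemannSum-cauchy : ∀ {N m n a b} → N ℕ.≤ m → N ℕ.≤ n → δ ≤ a → δ ≤ b →
    ∣ riemannSum m a b - riemannSum n a b ∣ ≤ refinementGap N a b + refinementGap N a b
  riemannSum-cauchy {N} {m} {n} {a} {b} N≤m N≤n δ≤a δ≤b = ∣∣≤
    (difference (lower N≤n) (upper N≤m))
    (≤-trans (≤-reflexive (solve 2 (λ p q → :- (p :- q) := q :- p) refl (riemannSum m a b) (riemannSum n a b)))
             (difference (lower N≤m) (upper N≤n)))
    where
    G : ℕ → ℚ
    G i = refinementGap i a b + refinementGap i a b
    difference : ∀ {p q r t} → r ≤ q → p ≤ r + t → p - q ≤ t
    difference {p} {q} {r} {t} r≤q p≤r+t =
      ≤-trans (+-mono-≤ p≤r+t (neg-antimono-≤ r≤q))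
              (≤-reflexive (solve 2 (λ r t → r :+ t :- r := t) refl r t))
    lower : ∀ {i} → N ℕ.≤ i → riemannSum N a b ≤ riemannSum i a b
    lower {i} N≤i = subst (λ j → riemannSum N a b ≤ riemannSum j a b) (ℕₚ.m∸n+n≡m N≤i)
      (riemannSum-mono (i ℕ.∸ N) δ≤a δ≤b)
    upper : ∀ {i} → N ℕ.≤ i → riemannSum i a b ≤ riemannSum N a b + G N
    upper {i} N≤i = ≤-trans
      (≤-gap (0≤p+q (0≤refinementGap i a b) (0≤refinementGap i a b)) refl)
      (subst (λ j → riemannSum j a b + G j ≤ riemannSum N a b + G N) (ℕₚ.m∸n+n≡m N≤i)
        (riemannSum-antimono (i ℕ.∸ N) δ≤a δ≤b))

  riemannSum-lipschitz : ∀ n {a b a′ b′ W V E} → δ ≤ a → δ ≤ b → δ ≤ a′ → δ ≤ b′ →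
    0ℚ ≤ V → ∣ (b - a) - (b′ - a′) ∣ ≤ W → ∣ b′ - a′ ∣ ≤ V → ∣ a - a′ ∣ ≤ E → ∣ b - b′ ∣ ≤ E →
    ∣ riemannSum n a b - riemannSum n a′ b′ ∣ ≤ W * D + V * (E * (D * D))
  riemannSum-lipschitz zero {a} {b} {a′} {b′} {W} {V} {E} _ δ≤b _ δ≤b′ 0≤V w v _ e =
    ∣∣-+ (solve 4 (λ w w′ β β′ → w :* β :- w′ :* β′ := (w :- w′) :* β :+ w′ :* (β :- β′)) refl
           (b - a) (b′ - a′) (inv b) (inv b′))
      (∣∣-* (≤-trans (0≤∣p∣ _) w) w
        (≤-trans (≤-reflexive (0≤p⇒∣p∣≡p (0≤inv δ≤b))) (inv-antimono 0<δ δ≤b)))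
      (∣∣-* 0≤V v (≤-trans (inv-lipschitz 0<δ δ≤b δ≤b′) (*-monoʳ (0≤p*q 0≤D 0≤D) e)))
  riemannSum-lipschitz (suc n) {a} {b} {a′} {b′} {W} {V} {E} δ≤a δ≤b δ≤a′ δ≤b′ 0≤V w v e₁ e₂ =
    ≤-trans
      (∣∣-+ (solve 4 (λ p q r s → p :+ q :- (r :+ s) := (p :- r) :+ (q :- s)) refl
              (riemannSum n a m) (riemannSum n m b) (riemannSum n a′ m′) (riemannSum n m′ b′))
        (riemannSum-lipschitz n {W = ½ * W} {V = ½ * V} {E = E} δ≤a δ≤m δ≤a′ δ≤m′ (0≤p*q 0≤½ 0≤V)
          (halve w (solve 4 (λ a b a′ b′ →
               con ½ :* (a :+ b) :- a :- (con ½ :* (a′ :+ b′) :- a′)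
            := con ½ :* (b :- a :- (b′ :- a′))) refl a b a′ b′))
          (halve v (solve 2 (λ a b → con ½ :* (a :+ b) :- a := con ½ :* (b :- a)) refl a′ b′))
          e₁ e)
        (riemannSum-lipschitz n {W = ½ * W} {V = ½ * V} {E = E} δ≤m δ≤b δ≤m′ δ≤b′ (0≤p*q 0≤½ 0≤V)
          (halve w (solve 4 (λ a b a′ b′ →
               b :- con ½ :* (a :+ b) :- (b′ :- con ½ :* (a′ :+ b′))
            := con ½ :* (b :- a :- (b′ :- a′))) refl a b a′ b′))
          (halve v (solve 2 (λ a b → b :- con ½ :* (a :+ b) := con ½ :* (b :- a)) refl a′ b′))
          e e₂))
      (≤-reflexive (solve 4 (λ W V E D →
          (con ½ :* W :* D :+ con ½ :* V :* (E :* (D :* D)))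
          :+ (con ½ :* W :* D :+ con ½ :* V :* (E :* (D :* D)))
        := W :* D :+ V :* (E :* (D :* D))) refl W V E D))
    where
    m m′ : ℚ
    m  = midpoint a b
    m′ = midpoint a′ b′
    δ≤m : δ ≤ m
    δ≤m = ≤-midpoint δ≤a δ≤b
    δ≤m′ : δ ≤ m′
    δ≤m′ = ≤-midpoint δ≤a′ δ≤b′
    halve : ∀ {p q r} → ∣ q ∣ ≤ r → p ≡ ½ * q → ∣ p ∣ ≤ ½ * r
    halve q≤r refl = ∣∣-* 0≤½ ≤-refl q≤r
    e : ∣ m - m′ ∣ ≤ E
    e = ≤-trans
      (∣∣-+ (solve 4 (λ a b a′ b′ → con ½ :* (a :+ b) :- con ½ :* (a′ :+ b′)
                                   := con ½ :* (a :- a′) :+ con ½ :* (b :- b′)) refl a b a′ b′)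
            (halve e₁ refl) (halve e₂ refl))
      (≤-reflexive (½p+½p≡p E))

-- A Riemann sum depends only on the ratio b / a, and increases with it.
riemannSum-ratio : ∀ n {a b a′ b′} → 0ℚ < a → 0ℚ < b → 0ℚ < a′ → 0ℚ < b′ →
  b * a′ ≤ b′ * a → riemannSum n a b ≤ riemannSum n a′ b′
riemannSum-ratio zero {a} {b} {a′} {b′} 0<a 0<b 0<a′ 0<b′ r = ≤-gap
  (0≤p*q (0≤p*q (<⇒≤ (0<inv 0<b)) (<⇒≤ (0<inv 0<b′))) (p≤q⇒0≤q-p r))
  (trans
    (solve 3 (λ a′ b′ β′ → (b′ :- a′) :* β′ := b′ :* β′ :- a′ :* β′ :* con 1ℚ) refl a′ b′ (inv b′))
  (trans (cong₂ (λ u v → u - a′ * inv b′ * v) (trans (p*inv-p≡1 0<b′) (sym b*β≡1)) (sym b*β≡1))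
  (trans
    (solve 6 (λ a b a′ b′ β β′ →
        b :* β :- a′ :* β′ :* (b :* β)
      := (b :- a :* (b′ :* β′)) :* β :+ β :* β′ :* (b′ :* a :- b :* a′)) refl a b a′ b′ (inv b) (inv b′))
    (cong (λ u → (b - u) * inv b + inv b * inv b′ * (b′ * a - b * a′))
      (trans (cong (_*_ a) (p*inv-p≡1 0<b′)) (*-identityʳ a))))))
  where
  b*β≡1 : b * inv b ≡ 1ℚ
  b*β≡1 = p*inv-p≡1 0<b
riemannSum-ratio (suc n) {a} {b} {a′} {b′} 0<a 0<b 0<a′ 0<b′ r = +-mono-≤
  (riemannSum-ratio n 0<a 0<m 0<a′ 0<m′ (≤-gap (0≤p*q 0≤½ (p≤q⇒0≤q-p r))
    (solve 4 (λ a b a′ b′ → con ½ :* (a′ :+ b′) :* a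
                         := con ½ :* (a :+ b) :* a′ :+ con ½ :* (b′ :* a :- b :* a′)) refl a b a′ b′)))
  (riemannSum-ratio n 0<m 0<b 0<m′ 0<b′ (≤-gap (0≤p*q 0≤½ (p≤q⇒0≤q-p r))
    (solve 4 (λ a b a′ b′ → b′ :* (con ½ :* (a :+ b))
                         := b :* (con ½ :* (a′ :+ b′)) :+ con ½ :* (b′ :* a :- b :* a′)) refl a b a′ b′)))
  where
  0<m : 0ℚ < midpoint a b
  0<m = 0<midpoint 0<a 0<b
  0<m′ : 0ℚ < midpoint a′ b′
  0<m′ = 0<midpoint 0<a′ 0<b′

IsCauchy : (ℕ → ℚ) → Set
IsCauchy s = ∀ {ε} → 0ℚ < ε →
  ∃[ N ] (∀ {m n} → N ℕ.≤ m → N ℕ.≤ n → ∣ s m - s n ∣ ≤ ε)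

record ℝ : Set where
  constructor mkℝ
  field
    seq    : ℕ → ℚ
    cauchy : IsCauchy seq

open ℝ public

infix 4 _≤ᴿ_ _<ᴿ_

_≤ᴿ_ : ℝ → ℝ → Set
x ≤ᴿ y = ∀ {ε} → 0ℚ < ε → ∃[ N ] (∀ {n} → N ℕ.≤ n → seq x n ≤ seq y n + ε)

record _<ᴿ_ (x y : ℝ) : Set where
  constructor mk<ᴿ
  field
    {gap}   : ℚ
    0<gap   : 0ℚ < gap
    start   : ℕ
    gap-≤   : ∀ {n} → start ℕ.≤ n → seq x n + gap ≤ seq y n

fromℚ : ℚ → ℝ
fromℚ p = mkℝ (λ _ → p) λ {ε} 0<ε → 0 , λ _ _ →
  subst (_≤ ε) (cong ∣_∣ (sym (+-inverseʳ p))) (<⇒≤ 0<ε)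

0ᴿ 1ᴿ : ℝ
0ᴿ = fromℚ 0ℚ
1ᴿ = fromℚ 1ℚ

infixl 6 _+ᴿ_ _-ᴿ_
infixl 7 _*ᴿ_ _÷ᴿ_
infix  8 -ᴿ_

opaque
  +-cauchy : ∀ x y → IsCauchy (λ n → seq x n + seq y n)
  +-cauchy x y {ε} 0<ε =
    let (M , P) = cauchy x (0<½*p 0<ε) ; (N , Q) = cauchy y (0<½*p 0<ε) in
    M ℕ.⊔ N , λ {m} {n} ≤m ≤n → ≤-trans
      (∣∣-+ (solve 4 (λ a b c d → a :+ b :- (c :+ d) := (a :- c) :+ (b :- d)) refl
              (seq x m) (seq y m) (seq x n) (seq y n))
        (P (ℕₚ.m⊔n≤o⇒m≤o M N ≤m) (ℕₚ.m⊔n≤o⇒m≤o M N ≤n))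
        (Q (ℕₚ.m⊔n≤o⇒n≤o M N ≤m) (ℕₚ.m⊔n≤o⇒n≤o M N ≤n)))
      (≤-reflexive (½p+½p≡p ε))

_+ᴿ_ : ℝ → ℝ → ℝ
x +ᴿ y = mkℝ (λ n → seq x n + seq y n) (+-cauchy x y)

opaque
  neg-cauchy : ∀ x → IsCauchy (λ n → - seq x n)
  neg-cauchy x {ε} 0<ε =
    let (N , P) = cauchy x 0<ε in
    N , λ {m} {n} ≤m ≤n → subst (_≤ ε)
      (cong ∣_∣ (solve 2 (λ a b → b :- a := :- a :- :- b) refl (seq x m) (seq x n)))
      (P ≤n ≤m)

-ᴿ_ : ℝ → ℝ
-ᴿ x = mkℝ (λ n → - seq x n) (neg-cauchy x)

_-ᴿ_ : ℝ → ℝ → ℝ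
x -ᴿ y = x +ᴿ (-ᴿ y)

eventuallyBounded : ∀ x → ∃[ B ] (0ℚ ≤ B × ∃[ N ] (∀ {n} → N ℕ.≤ n → ∣ seq x n ∣ ≤ B))
eventuallyBounded x =
  let (N , P) = cauchy x 0<1 in
  ∣ seq x N ∣ + 1ℚ , 0≤p+q (0≤∣p∣ (seq x N)) 0≤1 , N , λ {n} ≤n →
    ∣∣-+ {q = seq x N} (solve 2 (λ a b → a := b :+ (a :- b)) refl (seq x n) (seq x N)) ≤-refl (P ≤n ℕₚ.≤-refl)

opaque
  *-cauchy : ∀ x y → IsCauchy (λ n → seq x n * seq y n)
  *-cauchy x y {ε} 0<ε =
    let (A , 0≤A , K , a) = eventuallyBounded x
        (B , 0≤B , L , b) = eventuallyBounded y
        (η , 0<η , small) = shrink (0≤p+q 0≤A 0≤B) 0<ε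
        (M , P) = cauchy x 0<η
        (N , Q) = cauchy y 0<η
        J = (K ℕ.⊔ L) ℕ.⊔ (M ℕ.⊔ N)
        ≤K = λ {i} (J≤i : J ℕ.≤ i) → ℕₚ.m⊔n≤o⇒m≤o K L (ℕₚ.m⊔n≤o⇒m≤o (K ℕ.⊔ L) (M ℕ.⊔ N) J≤i)
        ≤L = λ {i} (J≤i : J ℕ.≤ i) → ℕₚ.m⊔n≤o⇒n≤o K L (ℕₚ.m⊔n≤o⇒m≤o (K ℕ.⊔ L) (M ℕ.⊔ N) J≤i)
        ≤M = λ {i} (J≤i : J ℕ.≤ i) → ℕₚ.m⊔n≤o⇒m≤o M N (ℕₚ.m⊔n≤o⇒n≤o (K ℕ.⊔ L) (M ℕ.⊔ N) J≤i)
        ≤N = λ {i} (J≤i : J ℕ.≤ i) → ℕₚ.m⊔n≤o⇒n≤o M N (ℕₚ.m⊔n≤o⇒n≤o (K ℕ.⊔ L) (M ℕ.⊔ N) J≤i)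
    in J , λ {m} {n} ≤m ≤n → ≤-trans
      (∣∣-+ (solve 4 (λ a b c d → a :* b :- c :* d := a :* (b :- d) :+ (a :- c) :* d) refl
              (seq x m) (seq y m) (seq x n) (seq y n))
        (∣∣-* 0≤A (a (≤K ≤m)) (Q (≤N ≤m) (≤N ≤n)))
        (∣∣-* (<⇒≤ 0<η) (P (≤M ≤m) (≤M ≤n)) (b (≤L ≤n))))
      (≤-trans (≤-reflexive (solve 3 (λ A B η → A :* η :+ η :* B := (A :+ B) :* η) refl A B η)) small)

_*ᴿ_ : ℝ → ℝ → ℝ
x *ᴿ y = mkℝ (λ n → seq x n * seq y n) (*-cauchy x y)

private
  positive-≤ : ∀ {x : ℝ} (0<x : 0ᴿ <ᴿ x) {n} → _<ᴿ_.start 0<x ℕ.≤ n → _<ᴿ_.gap 0<x ≤ seq x n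
  positive-≤ (mk<ᴿ {ε} _ _ P) ≤n = subst (_≤ _) (+-identityˡ ε) (P ≤n)

opaque
  recip-cauchy : ∀ x → 0ᴿ <ᴿ x → IsCauchy (λ n → inv (seq x n))
  recip-cauchy x 0<x@(mk<ᴿ {δ} 0<δ N₀ _) {ε} 0<ε =
    let (η , 0<η , small) = shrink (0≤p*q (0≤D 0<δ) (0≤D 0<δ)) 0<ε
        (N , P) = cauchy x 0<η
    in N₀ ℕ.⊔ N , λ {m} {n} ≤m ≤n → ≤-trans
      (inv-lipschitz 0<δ
        (positive-≤ 0<x (ℕₚ.m⊔n≤o⇒m≤o N₀ N ≤m)) (positive-≤ 0<x (ℕₚ.m⊔n≤o⇒m≤o N₀ N ≤n)))
      (≤-trans
        (*-monoʳ (0≤p*q (0≤D 0<δ) (0≤D 0<δ))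
          (P (ℕₚ.m⊔n≤o⇒n≤o N₀ N ≤m) (ℕₚ.m⊔n≤o⇒n≤o N₀ N ≤n)))
        (≤-trans (≤-reflexive (*-comm η (inv δ * inv δ))) small))
    where
    0≤D : ∀ {p} → 0ℚ < p → 0ℚ ≤ inv p
    0≤D 0<p = <⇒≤ (0<inv 0<p)

recip : (x : ℝ) → 0ᴿ <ᴿ x → ℝ
recip x 0<x = mkℝ (λ n → inv (seq x n)) (recip-cauchy x 0<x)

_÷ᴿ_ : (x : ℝ) → Σ ℝ (0ᴿ <ᴿ_) → ℝ
x ÷ᴿ (y , 0<y) = x *ᴿ recip y 0<y

opaque
  ln-cauchy : ∀ x → 0ᴿ <ᴿ x → IsCauchy (λ n → riemannSum n 1ℚ (seq x n))
  ln-cauchy x 0<x@(mk<ᴿ {ε₀} 0<ε₀ N₀ _) {ε} 0<ε =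
    let (η , 0<η , small) = shrink 0≤L (0<½*p 0<ε)
        (M , P) = cauchy x 0<η
        (N , Q) = ½^-vanishes 0≤K (0<½*p 0<ε)
        J = (N₀ ℕ.⊔ N₁) ℕ.⊔ (M ℕ.⊔ N)
        ≥N₀ = λ {i} (J≤i : J ℕ.≤ i) → ℕₚ.m⊔n≤o⇒m≤o N₀ N₁ (ℕₚ.m⊔n≤o⇒m≤o (N₀ ℕ.⊔ N₁) (M ℕ.⊔ N) J≤i)
        ≥N₁ = λ {i} (J≤i : J ℕ.≤ i) → ℕₚ.m⊔n≤o⇒n≤o N₀ N₁ (ℕₚ.m⊔n≤o⇒m≤o (N₀ ℕ.⊔ N₁) (M ℕ.⊔ N) J≤i)
        ≥M  = λ {i} (J≤i : J ℕ.≤ i) → ℕₚ.m⊔n≤o⇒m≤o M N (ℕₚ.m⊔n≤o⇒n≤o (N₀ ℕ.⊔ N₁) (M ℕ.⊔ N) J≤i)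
        ≥N  = λ {i} (J≤i : J ℕ.≤ i) → ℕₚ.m⊔n≤o⇒n≤o M N (ℕₚ.m⊔n≤o⇒n≤o (N₀ ℕ.⊔ N₁) (M ℕ.⊔ N) J≤i)
    in J , λ {m} {n} ≤m ≤n → ≤-trans
      (∣∣-+ (solve 3 (λ p q r → p :- r := (p :- q) :+ (q :- r)) refl
              (riemannSum m 1ℚ (seq x m)) (riemannSum m 1ℚ (seq x n)) (riemannSum n 1ℚ (seq x n)))
        (≤-trans
          (riemannSum-lipschitz 0<δ m {W = η} {V} {η} δ≤1 (δ≤ (≥N₀ ≤m)) δ≤1 (δ≤ (≥N₀ ≤n)) 0≤V
            (subst (λ t → ∣ t ∣ ≤ η)
              (solve 2 (λ p q → p :- q := p :- con 1ℚ :- (q :- con 1ℚ)) refl (seq x m) (seq x n))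
              (P (≥M ≤m) (≥M ≤n)))
            (width (≥N₁ ≤n)) (<⇒≤ 0<η) (P (≥M ≤m) (≥M ≤n)))
          (≤-trans
            (≤-reflexive (solve 3 (λ η D V → η :* D :+ V :* (η :* (D :* D)) := (D :+ V :* (D :* D)) :* η)
              refl η D V))
            small))
        (≤-trans
          (riemannSum-cauchy 0<δ (≥N ≤m) (≥N ≤n) δ≤1 (δ≤ (≥N₀ ≤n)))
          (≤-trans (+-mono-≤ (gap N (≥N₁ ≤n)) (gap N (≥N₁ ≤n)))
          (≤-trans
            (≤-reflexive (solve 2 (λ k h → k :* h :+ k :* h := (k :+ k) :* h) refl K₀ (½^ N)))
            (Q ℕₚ.≤-refl)))))
      (≤-reflexive (½p+½p≡p ε))
    where
    δ D V K₀ : ℚ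
    δ = ε₀ ⊓ 1ℚ
    D = inv δ
    0<δ : 0ℚ < δ
    0<δ with ≤-total ε₀ 1ℚ
    ... | inj₁ ε₀≤1 = subst (0ℚ <_) (sym (p≤q⇒p⊓q≡p ε₀≤1)) 0<ε₀
    ... | inj₂ 1≤ε₀ = subst (0ℚ <_) (sym (p≥q⇒p⊓q≡q 1≤ε₀)) 0<1
    δ≤1 : δ ≤ 1ℚ
    δ≤1 = p⊓q≤q ε₀ 1ℚ
    δ≤ : ∀ {n} → N₀ ℕ.≤ n → δ ≤ seq x n
    δ≤ ≤n = ≤-trans (p⊓q≤p ε₀ 1ℚ) (positive-≤ 0<x ≤n)
    B : ℚ
    B = proj₁ (eventuallyBounded x)
    N₁ : ℕ
    N₁ = proj₁ (proj₂ (proj₂ (eventuallyBounded x)))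
    V = B + 1ℚ
    0≤V : 0ℚ ≤ V
    0≤V = 0≤p+q (proj₁ (proj₂ (eventuallyBounded x))) 0≤1
    width : ∀ {n} → N₁ ℕ.≤ n → ∣ seq x n - 1ℚ ∣ ≤ V
    width ≤n = ∣∣-+ refl (proj₂ (proj₂ (proj₂ (eventuallyBounded x))) ≤n) ≤-refl
    0≤D : 0ℚ ≤ D
    0≤D = <⇒≤ (0<inv 0<δ)
    K₀ = ½ * ½ * (V * V) * (D * D)
    0≤K : 0ℚ ≤ K₀ + K₀
    0≤K = 0≤p+q 0≤K₀ 0≤K₀
      where
      0≤K₀ : 0ℚ ≤ K₀
      0≤K₀ = 0≤p*q (0≤p*q (0≤p*q 0≤½ 0≤½) (0≤p*p V)) (0≤p*p D)
    0≤L : 0ℚ ≤ D + V * (D * D)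
    0≤L = 0≤p+q 0≤D (0≤p*q 0≤V (0≤p*p D))
    gap : ∀ i {n} → N₁ ℕ.≤ n → refinementGap 0<δ i 1ℚ (seq x n) ≤ K₀ * ½^ i
    gap i {n} ≤n = *-monoʳ (0≤½^ i) (*-monoʳ (0≤p*p D)
      (*-monoˡ (0≤p*q 0≤½ 0≤½) (≤-trans (p≤∣p∣ _) (∣∣-* 0≤V (width ≤n) (width ≤n)))))

-- The natural logarithm, as ∫ dt/t over [1 , x].
ln : (x : ℝ) → 0ᴿ <ᴿ x → ℝ
ln x 0<x = mkℝ (λ n → riemannSum n 1ℚ (seq x n)) (ln-cauchy x 0<x)

opaque
  0<*ᴿ : ∀ {x y} → 0ᴿ <ᴿ x → 0ᴿ <ᴿ y → 0ᴿ <ᴿ x *ᴿ y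
  0<*ᴿ {x} {y} 0<x@(mk<ᴿ {δ} 0<δ M _) 0<y@(mk<ᴿ {ε} 0<ε N _) =
    mk<ᴿ (0<p*q 0<δ 0<ε) (M ℕ.⊔ N) λ {n} ≤n →
      subst (_≤ seq x n * seq y n) (sym (+-identityˡ (δ * ε)))
        (*-mono
          (≤-trans (<⇒≤ 0<δ) (positive-≤ 0<x (ℕₚ.m⊔n≤o⇒m≤o M N ≤n)))
          (<⇒≤ 0<ε)
          (positive-≤ 0<x (ℕₚ.m⊔n≤o⇒m≤o M N ≤n))
          (positive-≤ 0<y (ℕₚ.m⊔n≤o⇒n≤o M N ≤n)))

  1<⇒0< : ∀ {x} → 1ᴿ <ᴿ x → 0ᴿ <ᴿ x
  1<⇒0< (mk<ᴿ {ε} 0<ε N P) = mk<ᴿ 0<ε N λ ≤n → ≤-trans (+-monoˡ-≤ ε 0≤1) (P ≤n)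

  0<ln : ∀ {x} (1<x : 1ᴿ <ᴿ x) → 0ᴿ <ᴿ ln x (1<⇒0< 1<x)
  0<ln {x} (mk<ᴿ {ε} 0<ε N P) = mk<ᴿ (0<p*q 0<ε (0<inv 0<1+ε)) N λ {n} ≤n →
    ≤-trans
      (≤-reflexive (trans (+-identityˡ _)
        (cong (_* inv (1ℚ + ε)) (solve 1 (λ ε → ε := con 1ℚ :+ ε :- con 1ℚ) refl ε))))
    (≤-trans
      (subst (λ i → riemannSum 0 1ℚ (1ℚ + ε) ≤ riemannSum i 1ℚ (1ℚ + ε)) (ℕₚ.+-identityʳ n)
        (riemannSum-mono 0<1 n {0} ≤-refl (≤-gap (<⇒≤ 0<ε) refl)))
      (riemannSum-ratio n 0<1 0<1+ε 0<1 (<-≤-trans 0<1+ε (P ≤n)) (*-monoʳ 0≤1 (P ≤n))))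
    where
    0<1+ε : 0ℚ < 1ℚ + ε
    0<1+ε = +-mono-≤-< 0≤1 0<ε

ℕ→ℝ : ℕ → ℝ
ℕ→ℝ n = fromℚ (fromℕ n)

module _ {r : ℕ} (3≤r : 3 ℕ.≤ r) where

  1<r : 1ᴿ <ᴿ ℕ→ℝ r
  1<r = mk<ᴿ 0<1 0 λ _ → fromℕ-mono {2} (ℕₚ.<⇒≤ 3≤r)

  lnℕ : ℝ
  lnℕ = ln (ℕ→ℝ r) (1<⇒0< 1<r)

  opaque
    -- Eight pieces already give ln 3 ≥ 1/5 + 1/6 + ⋯ + 1/12 > 1.
    1<lnℕ : 1ᴿ <ᴿ lnℕ
    1<lnℕ = mk<ᴿ (toWitness {a? = 0ℚ <? 1/100} _) 3 λ {n} 3≤n → ≤-trans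
      (toWitness {a? = 1ℚ + 1/100 ≤? riemannSum 3 1ℚ (fromℕ 3)} _)
      (≤-trans
        (subst (λ i → riemannSum 3 1ℚ (fromℕ 3) ≤ riemannSum i 1ℚ (fromℕ 3)) (ℕₚ.m∸n+n≡m 3≤n)
          (riemannSum-mono 0<1 (n ℕ.∸ 3) {3} ≤-refl (fromℕ-mono {1} {3} (s≤s z≤n))))
        (riemannSum-ratio n 0<1 (toWitness {a? = 0ℚ <? fromℕ 3} _) 0<1
          (<-≤-trans (toWitness {a? = 0ℚ <? fromℕ 3} _) (fromℕ-mono 3≤r))
          (*-monoʳ 0≤1 (fromℕ-mono 3≤r))))
      where
      1/100 : ℚ
      1/100 = + 1 / 100

  lnlnℕ : ℝ
  lnlnℕ = ln lnℕ (1<⇒0< 1<lnℕ)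

  opaque
    0<lnlnℕ : 0ᴿ <ᴿ lnlnℕ
    0<lnlnℕ = 0<ln 1<lnℕ

-- P HasSize k: exactly k elements satisfy P, as witnessed by a repetition-free enumeration.
_HasSize_ : {A : Set} → (A → Set) → ℕ → Set
_HasSize_ {A} P k = ∃[ xs ] (Unique xs × (∀ x → x ∈ xs ⇔ P x) × length xs ≡ k)
  where
  open ListUnique using (Unique)
  open ListMem using (_∈_)

IsMaximum IsMinimum : (ℕ → Set) → ℕ → Set
IsMaximum P m = P m × (∀ {n} → P n → n ℕ.≤ m)
IsMinimum P m = P m × (∀ {n} → P n → m ℕ.≤ n)

totient : ℕ → ℕ
totient n = length (filter (λ d → gcd d n ℕ.≟ 1) (List.map suc (upTo n)))

record Arrangement (A : Set) (r : ℕ) : Set where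
  constructor mkArrangement
  field
    entries   : Vec A r
    .distinct : VecUnique.Unique entries

open Arrangement public

mapArrangement : ∀ {A B : Set} {r} (f : A → B) → Injective _≡_ _≡_ f → Arrangement A r → Arrangement B r
mapArrangement f inj (mkArrangement xs d) = mkArrangement (Vec.map f xs) (map⁺ inj d)

-- The r-digraphs on n vertices, given by the indicator of the edge set.
Hyperdigraph : ℕ → ℕ → Set
Hyperdigraph r n = Arrangement (Fin n) r → Bool

IsEdge : ∀ {r n} → Hyperdigraph r n → Arrangement (Fin n) r → Set
IsEdge G a = T (G a)

IsOrderingOf : ∀ {r n} → Arrangement (Fin n) r → Subset n → Set
IsOrderingOf a S = VecAll.All (Subset._∈ S) (entries a)

IsTournament : ∀ {r n} → ℕ → Hyperdigraph r n → Set
IsTournament {r} {n} k G = ∀ (S : Subset n) → Subset.∣ S ∣ ≡ r →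
  (λ a → IsOrderingOf a S × IsEdge G a) HasSize k

tightPath : ∀ r s → Hyperdigraph r s
tightPath r s a =
  does (any? {n = s} λ i → all? λ j → Fin.toℕ (lookup (entries a) j) ℕ.≟ Fin.toℕ i ℕ.+ Fin.toℕ j)

_Contains_ : ∀ {r m n} → Hyperdigraph r n → Hyperdigraph r m → Set
_Contains_ {m = m} {n} G H =
  Σ (Fin m → Fin n) λ f → Σ (Injective _≡_ _≡_ f) λ inj →
    ∀ a → IsEdge H a → IsEdge G (mapArrangement f inj a)

-- f(n,r,k) = s
IsPathNumber : (n r k s : ℕ) → Set
IsPathNumber n r k = IsMaximum λ s →
  ∀ (G : Hyperdigraph r n) → IsTournament k G → G Contains tightPath r s

-- f(n,r,k) → ∞ as n → ∞
PathsGrow : (r k : ℕ) → Set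
PathsGrow r k = ∀ M → ∃[ N ] (∀ n → N ℕ.≤ n → ∃[ s ] (IsPathNumber n r k s × M ℕ.≤ s))

IsThreshold : (r t : ℕ) → Set
IsThreshold r = IsMinimum λ k → k ℕ.≤ r ! × PathsGrow r k

record Digraph : Set₁ where
  field
    Vertex : Set
    _⟶_    : Vertex → Vertex → Set

module _ (G : Digraph) where
  open Digraph G
  open ListMem using (_∈_)
  open ListUnique using (Unique)

  -- The directed cycle v ⟶ v₁ ⟶ ⋯ ⟶ vₗ ⟶ v with vs = v₁ , … , vₗ.
  IsCycle : Vertex → List Vertex → Set
  IsCycle v vs = Unique (v List.∷ vs) × Linked _⟶_ ((v List.∷ vs) List.++ List.[ v ])

  InducesAcyclic : List Vertex → Set
  InducesAcyclic S = ∀ v vs → ListAll.All (_∈ S) (v List.∷ vs) → ¬ IsCycle v vs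

  -- a(G) = m
  IsAcyclicNumber : ℕ → Set
  IsAcyclicNumber = IsMaximum λ m → ∃[ S ] (Unique S × InducesAcyclic S × length S ≡ m)

PatternMatch : ∀ {m n s} → Vec (Fin m) s → Vec (Fin n) s → Set
PatternMatch u v = ∀ i j → i Fin.< j →
  (lookup u i Fin.< lookup u j) ⇔ (lookup v i Fin.< lookup v j)

PSG : ∀ r .{{_ : ℕ.NonZero r}} → Digraph
PSG r@(suc _) = record
  { Vertex = Arrangement (Fin r) r
  ; _⟶_    = λ a b → PatternMatch (tail (entries a)) (init (entries b))
  }

infix 7 _÷!_
_÷!_ : ℤ.ℤ → ℕ → ℚ
i ÷! n = (i / n !) {{n ℕₚ.!≢0}}

module _ (r : ℕ) .{{_ : ℕ.NonZero r}} where

  lowerBound : ℝ → 3 ℕ.≤ r → ℝ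
  lowerBound C 3≤r =
    1ᴿ -ᴿ fromℚ (+ 1 / r) -ᴿ C *ᴿ (lnℕ 3≤r ÷ᴿ (r²lnlnr , 0<r²lnlnr))
    where
    r²lnlnr : ℝ
    r²lnlnr = ℕ→ℝ r *ᴿ ℕ→ℝ r *ᴿ lnlnℕ 3≤r
    0<r : 0ᴿ <ᴿ ℕ→ℝ r
    0<r = 1<⇒0< (1<r 3≤r)
    0<r²lnlnr : 0ᴿ <ᴿ r²lnlnr
    0<r²lnlnr = 0<*ᴿ (0<*ᴿ 0<r 0<r) (0<lnlnℕ 3≤r)

  acyclicUpperBound : ℚ
  acyclicUpperBound = 1ℚ - + 1 / r - + totient r ÷! r

  thresholdUpperBound : ℚ
  thresholdUpperBound = (1ℚ - + 1 / r - (+ totient r ℤ.- + 1) ÷! r) * fromℕ (r !)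

{-# OPTIONS --safe #-}

-- A set of permutations is acyclic exactly when it has no nonempty subset, a core, in which
-- every member has a successor.
--
-- Upper bound.  The rotations of a permutation form a cycle, so each of the (r − 1)! rotation
-- orbits meets the complement of an acyclic set; the φ(r) orbits of i ↦ d i mod r, with d
-- coprime to r, split into two cycles and meet it twice.
--
-- Lower bound.  Give the places where a suitable rare local pattern occurs, the markers, a key
-- read off from the pattern near them.  Omit the permutations that start with a marker whose
-- key is not exceeded later, and those without a marker: along a cycle of the others the keys
-- would increase forever.  If the markers do not overlap around the circle and their keys
-- differ, a rotation orbit has just one permutation of the first kind.  All other events have
-- probability O(1 / r²), which is below ln r / (r² ln ln r).
--
-- Threshold.  It is a(PSG_r) + 1.  By Ramsey's theorem a tournament with k > a(PSG_r) contains
-- a large set on which adjacency depends only on the pattern; the k patterns that occur contain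
-- a cycle, and walks around it are realised by long tight paths.  Conversely the tournament
-- given by an acyclic set of patterns has only short tight paths.
module Submission where

open import Defs
open import Data.Integer using (+_)
open import Data.Nat using (ℕ; NonZero; _≤_; _!)
open import Data.Product using (∃-syntax; _×_)
import Data.Rational as ℚ
open import Data.Bool as Bool using (Bool; true; false; T; if_then_else_)
open import Data.Empty using (⊥-elim)
open import Data.Fin as Fin using (Fin; toℕ)
import Data.Fin.Properties as Finₚ
open import Data.Fin.Subset as Subset using (Subset; inside; outside)
import Data.Fin.Subset.Properties as Subsetₚ
import Data.Integer as ℤ
import Data.Integer.Properties as ℤₚ
open import Data.List as List
  using (List; []; _∷_; length; filter; map; upTo; allFin; cartesianProduct; cartesianProductWith; _++_; take)
import Data.List.Properties as Listₚ
open import Data.List.Membership.Propositional using (_∈_; _∉_; find; lose)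
import Data.List.Membership.Propositional.Properties as Memₚ
open import Data.List.Relation.Binary.Sublist.Propositional as Sublist using (_⊆_; []; _∷_; _∷ʳ_)
import Data.List.Relation.Binary.Sublist.Propositional.Properties as Sublistₚ
import Data.List.Relation.Unary.All as All
import Data.List.Relation.Unary.All.Properties as Allₚ
open import Data.List.Relation.Unary.AllPairs using ([]; _∷_)
open import Data.List.Relation.Unary.Any as Any using (here; there)
import Data.List.Relation.Unary.Any.Properties as Anyₚ
open import Data.List.Relation.Unary.Linked using (Linked; []; [-]; _∷_)
open import Data.List.Relation.Unary.Unique.Propositional using (Unique)
import Data.List.Relation.Unary.Unique.Propositional.Properties as Uniqueₚ
open import Data.Nat
  using (zero; suc; _+_; _*_; _∸_; _^_; _<_; _⊔_; z≤n; s≤s; z<s; s<s; _≟_; _≤?_; _<?_; _%_; _/_)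
open import Data.Nat.Coprimality using (coprime-divisor; gcd≡1⇒coprime)
open import Data.Nat.Divisibility using (_∣_; ∣⇒≤; ∣-refl; m%n≡0⇒n∣m)
open import Data.Nat.DivMod
  using (_mod_; m%n<n; m<n⇒m%n≡m; m%n%n≡m%n; %-distribˡ-+; %-distribˡ-*; [m+kn]%n≡m%n;
         [m+n]%n≡m%n; m*n%n≡0; n%n≡0; m/n*n≤m; m*n/n≡m; /-monoˡ-≤)
open import Data.Nat.GCD using (gcd; gcd-greatest)
import Data.Nat.Properties as ℕₚ
open import Data.Nat.Solver using (module +-*-Solver)
open import Data.Product using (_,_; proj₁; proj₂)
import Data.Rational.Properties as ℚₚ
import Data.Rational.Solver as ℚSolver
import Data.Rational.Unnormalised as ℚᵘ
import Data.Rational.Unnormalised.Properties as ℚᵘₚ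
open import Data.Maybe using (Maybe; just; nothing)
import Data.Maybe.Properties as Maybeₚ
open import Data.Sum using (_⊎_; inj₁; inj₂; [_,_]′)
open import Data.Unit using (⊤; tt)
open import Data.Vec as Vec using (Vec; []; _∷_; lookup; tabulate)
import Data.Vec.Properties as Vecₚ
import Data.Vec.Relation.Unary.All as VecAll
import Data.Vec.Relation.Unary.All.Properties as VecAllₚ
import Data.Vec.Relation.Unary.AllPairs as VecAllPairs
import Data.Vec.Relation.Unary.Unique.Propositional.Properties as VecUniqueₚ
open import Function using (_∘_; id; _⇔_; Injective; mk⇔; Equivalence)
open import Relation.Binary using (DecidableEquality; tri<; tri≈; tri>)
open import Relation.Binary.PropositionalEquality as ≡
  using (_≡_; _≢_; refl; sym; trans; cong; cong₂; subst; subst₂)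
open import Relation.Nullary using (Dec; ¬_; yes; no; does; contradiction)
open import Relation.Nullary.Decidable
  using (_×-dec_; _⊎-dec_; _→-dec_; ¬?; map′; recompute; toWitness; dec-true; dec-false; does-⇔; decidable-stable)
open import Relation.Unary using (Decidable)

-- Counting in finite types

-- The marker has to meet two opposite demands. It must be frequent, so that almost every
-- permutation contains one, and its key needs about 3 log r bits, so that two markers almost never
-- tie. Fixing the ranks of only four entries in a window of length w = 4 + 2k gives it a
-- probability of order 1 / w ^ 4, which is polylogarithmic for k of order log r, while k disjoint
-- comparisons among the other entries stay free and form the key. The places of the four entries
-- are chosen so that two different markers share at most two entries, and such an overlap already
-- decides 2k comparisons. With r much larger than w ^ 5 log r, there are enough disjoint blocks to
-- make the absence of a marker rarer than 1 / r ^ 2.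
--
-- Swaps of entries take the place of independence: every probability is bounded by an explicit map
-- between permutations, so that all estimates are inequalities between natural numbers.

remove : ∀ {A : Set} {y : A} {ys} → y ∈ ys →
  ∃[ zs ] (length ys ≡ suc (length zs) × (∀ {z} → z ∈ ys → z ≢ y → z ∈ zs))
remove {ys = _ ∷ zs} (here refl) = zs , refl , λ where
  (here z≡y)  z≢y → ⊥-elim (z≢y z≡y)
  (there z∈)  _   → z∈
remove {ys = x ∷ _} (there y∈) =
  let (zs , eq , keep) = remove y∈ in x ∷ zs , cong suc eq , λ where
    (here z≡x)  _   → here z≡x
    (there z∈)  z≢y → there (keep z∈ z≢y)

-- The relation takes the place of an injection: a partner is chosen separately for each x and only
-- has to determine it.
length-≤ : ∀ {A B : Set} (R : A → B → Set) {xs ys} → Unique xs →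
  (∀ {x} → x ∈ xs → ∃[ y ] (y ∈ ys × R x y)) →
  (∀ {x x′ y} → R x y → R x′ y → x ≡ x′) →
  length xs ≤ length ys
length-≤ R []        _ _   = z≤n
length-≤ R {x ∷ xs} {ys} (x∉ ∷ u) f inj =
  let (y , y∈ , Rxy) = f (here refl)
      (zs , eq , keep) = remove y∈
      g = λ {x′} (x′∈ : x′ ∈ xs) →
        let (y′ , y′∈ , Rx′y′) = f (there x′∈) in
        y′ , keep y′∈ (λ y′≡y → All.lookup x∉ x′∈ (inj Rxy (subst (R x′) y′≡y Rx′y′))) , Rx′y′
  in subst (suc (length xs) ≤_) (sym eq) (s≤s (length-≤ R {ys = zs} u g inj))

unique-⊆ : ∀ {A : Set} {xs ys : List A} → Unique xs → (∀ {x} → x ∈ xs → x ∈ ys) →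
  length xs ≤ length ys
unique-⊆ u sub = length-≤ _≡_ u (λ x∈ → _ , sub x∈ , refl) (λ { refl refl → refl })

length-cartesianProductWith : ∀ {A B C : Set} (f : A → B → C) xs ys →
  length (cartesianProductWith f xs ys) ≡ length xs * length ys
length-cartesianProductWith f []       ys = refl
length-cartesianProductWith f (x ∷ xs) ys =
  trans (Listₚ.length-++ (map (f x) ys))
        (cong₂ _+_ (Listₚ.length-map (f x) ys) (length-cartesianProductWith f xs ys))

length-filter-¬ : ∀ {A : Set} {P : A → Set} (P? : Decidable P) xs →
  length (filter P? xs) + length (filter (¬? ∘ P?) xs) ≡ length xs
length-filter-¬ P? []       = refl
length-filter-¬ P? (x ∷ xs) with P? x
... | yes _ = cong suc (length-filter-¬ P? xs)
... | no  _ = trans (ℕₚ.+-suc _ _) (cong suc (length-filter-¬ P? xs))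

record Listed (A : Set) : Set where
  field
    elems    : List A
    unique   : Unique elems
    complete : ∀ x → x ∈ elems

  size : ℕ
  size = length elems

  # : {P : A → Set} → Decidable P → ℕ
  # P? = length (filter P? elems)

  ∈-# : ∀ {P : A → Set} (P? : Decidable P) {x} → P x → x ∈ filter P? elems
  ∈-# P? {x} = Memₚ.∈-filter⁺ P? (complete x)

  #-∁ : ∀ {P : A → Set} (P? : Decidable P) → # P? + # (¬? ∘ P?) ≡ size
  #-∁ P? = length-filter-¬ P? elems

  #-mono : ∀ {P Q : A → Set} (P? : Decidable P) (Q? : Decidable Q) →
    (∀ {x} → P x → Q x) → # P? ≤ # Q?
  #-mono P? Q? sub = unique-⊆ (Uniqueₚ.filter⁺ P? unique)
    (λ x∈ → ∈-# Q? (sub (proj₂ (Memₚ.∈-filter⁻ P? {xs = elems} x∈))))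

  #-∪ : ∀ {P Q R : A → Set} (P? : Decidable P) (Q? : Decidable Q) (R? : Decidable R) →
    (∀ {x} → P x → Q x ⊎ R x) → # P? ≤ # Q? + # R?
  #-∪ P? Q? R? sub = subst (# P? ≤_) (Listₚ.length-++ (filter Q? elems))
    (unique-⊆ (Uniqueₚ.filter⁺ P? unique) λ x∈ →
      [ Memₚ.∈-++⁺ˡ ∘ ∈-# Q? , Memₚ.∈-++⁺ʳ (filter Q? elems) ∘ ∈-# R? ]′
        (sub (proj₂ (Memₚ.∈-filter⁻ P? {xs = elems} x∈))))

  #-+ : ∀ {P Q R : A → Set} (P? : Decidable P) (Q? : Decidable Q) (R? : Decidable R) →
    (∀ {x} → P x → R x) → (∀ {x} → Q x → R x) → (∀ {x} → P x → ¬ Q x) → # P? + # Q? ≤ # R?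
  #-+ P? Q? R? P⊆R Q⊆R disjoint = subst (_≤ # R?) (Listₚ.length-++ (filter P? elems))
    (unique-⊆ (Uniqueₚ.++⁺ (Uniqueₚ.filter⁺ P? unique) (Uniqueₚ.filter⁺ Q? unique)
        λ (p , q) → disjoint (proj₂ (Memₚ.∈-filter⁻ P? {xs = elems} p)) (proj₂ (Memₚ.∈-filter⁻ Q? {xs = elems} q)))
      (λ x∈ → [ (λ p → ∈-# R? (P⊆R (proj₂ (Memₚ.∈-filter⁻ P? {xs = elems} p))))
              , (λ q → ∈-# R? (Q⊆R (proj₂ (Memₚ.∈-filter⁻ Q? {xs = elems} q)))) ]′
              (Memₚ.∈-++⁻ (filter P? elems) x∈)))

  #-⋃ : ∀ {P : A → Set} {Q : ℕ → A → Set} (P? : Decidable P) (Q? : ∀ i → Decidable (Q i)) n k →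
    (∀ {x} → P x → ∃[ i ] (i < n × Q i x)) → (∀ {i} → i < n → # (Q? i) ≤ k) → # P? ≤ n * k
  #-⋃ P? Q? zero    k sub bound = unique-⊆ {ys = []} (Uniqueₚ.filter⁺ P? unique)
    (λ x∈ → contradiction (proj₁ (proj₂ (sub (proj₂ (Memₚ.∈-filter⁻ P? {xs = elems} x∈))))) λ ())
  #-⋃ {P} {Q} P? Q? (suc n) k sub bound = ℕₚ.≤-trans
    (#-∪ P? (Q? n) (λ x → ℕₚ.anyUpTo? (λ i → Q? i x) n) split)
    (ℕₚ.+-mono-≤ (bound (ℕₚ.n<1+n n))
      (#-⋃ _ Q? n k id (λ i<n → bound (ℕₚ.m≤n⇒m≤1+n i<n))))
    where
    split : ∀ {x} → P x → Q n x ⊎ ∃[ i ] (i < n × Q i x)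
    split p with sub p
    ... | i , i<1+n , q with ℕₚ.m≤n⇒m<n∨m≡n (ℕₚ.≤-pred i<1+n)
    ...   | inj₁ i<n  = inj₂ (i , i<n , q)
    ...   | inj₂ refl = inj₁ q

  -- A code `c` recovers x from y, so at most `length cs` elements share one y.
  #-image : ∀ {C : Set} {P Q : A → Set} (P? : Decidable P) (Q? : Decidable Q)
    (cs : List C) (f : C → A → A) →
    (∀ {x} → P x → ∃[ c ] ∃[ y ] (c ∈ cs × Q y × f c y ≡ x)) → # P? ≤ length cs * # Q?
  #-image P? Q? cs f sub = subst (# P? ≤_) (length-cartesianProductWith f cs (filter Q? elems))
    (unique-⊆ (Uniqueₚ.filter⁺ P? unique) λ x∈ →
      let (c , y , c∈ , Qy , eq) = sub (proj₂ (Memₚ.∈-filter⁻ P? {xs = elems} x∈))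
      in subst (_∈ _) eq (Memₚ.∈-cartesianProductWith⁺ f c∈ (∈-# Q? Qy)))

  #-inject : ∀ {C : Set} {P : A → Set} (P? : Decidable P) {cs : List C} (f : A → C → A) →
    Unique cs →
    (∀ {x y c d} → P x → P y → c ∈ cs → d ∈ cs → f x c ≡ f y d → x ≡ y × c ≡ d) →
    # P? * length cs ≤ size
  #-inject {C} {P} P? {cs} f u inj = subst (_≤ size) (length-cartesianProductWith _,_ (filter P? elems) cs)
    (length-≤ R (Uniqueₚ.cartesianProduct⁺ (Uniqueₚ.filter⁺ P? unique) u)
      (λ { {x , c} xc∈ →
        let (x∈ , c∈) = Memₚ.∈-cartesianProduct⁻ (filter P? elems) cs xc∈
        in f x c , complete _ , proj₂ (Memₚ.∈-filter⁻ P? {xs = elems} x∈) , c∈ , refl })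
      (λ { (p , c∈ , refl) (q , d∈ , eq) →
        let (x≡y , c≡d) = inj q p d∈ c∈ eq in cong₂ _,_ (sym x≡y) (sym c≡d) }))
    where
    R : A × C → A → Set
    R (x , c) y = P x × c ∈ cs × f x c ≡ y

  -- Each further event O t is met by at least the fraction 1/(K+1) of what avoids the
  -- earlier ones: those that avoid it are at most K-to-one images of those that meet it.
  #-avoid : ∀ {C : Set} {O : ℕ → A → Set} (O? : ∀ t → Decidable (O t))
    (cs : List C) (f : ℕ → C → A → A) (n : ℕ) →
    (∀ {t x} → t < n → ¬ O t x →
      ∃[ c ] ∃[ y ] (c ∈ cs × O t y × f t c y ≡ x × (∀ {s} → s < t → O s y → O s x))) →
    # (λ x → ℕₚ.allUpTo? (λ t → ¬? (O? t x)) n) * suc (length cs) ^ n ≤ length cs ^ n * size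
  #-avoid {C} {O} O? cs f n step = go n ℕₚ.≤-refl
    where
    K = length cs
    Y : ℕ → A → Set
    Y b x = ∀ {t} → t < b → ¬ O t x
    Y? : ∀ b → Decidable (Y b)
    Y? b x = ℕₚ.allUpTo? (λ t → ¬? (O? t x)) b
    next : ∀ {b} → b < n → # (Y? (suc b)) * suc K ≤ K * # (Y? b)
    next {b} b<n = begin
      u * suc K         ≡⟨ ℕₚ.*-suc u K ⟩
      u + u * K         ≤⟨ ℕₚ.+-monoˡ-≤ (u * K) u≤Kv ⟩
      K * v + u * K     ≡⟨ cong (_+_ (K * v)) (ℕₚ.*-comm u K) ⟩
      K * v + K * u     ≡⟨ ℕₚ.*-distribˡ-+ K v u ⟨
      K * (v + u)       ≤⟨ ℕₚ.*-monoʳ-≤ K v+u≤ ⟩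
      K * # (Y? b)      ∎
      where
      open ℕₚ.≤-Reasoning
      V? : Decidable (λ x → Y b x × O b x)
      V? x = Y? b x ×-dec O? b x
      u v : ℕ
      u = # (Y? (suc b))
      v = # V?
      u≤Kv : u ≤ K * v
      u≤Kv = #-image (Y? (suc b)) V? cs (f b) λ {x} ys →
        let (c , y , c∈ , Oy , eq , back) = step b<n (ys (ℕₚ.n<1+n b))
        in c , y , c∈ , ((λ t<b Oty → ys (ℕₚ.m≤n⇒m≤1+n t<b) (back t<b Oty)) , Oy) , eq
      v+u≤ : v + u ≤ # (Y? b)
      v+u≤ = #-+ V? (Y? (suc b)) (Y? b) proj₁ (λ ys t<b → ys (ℕₚ.m≤n⇒m≤1+n t<b))
        (λ (_ , Ob) ys → ys (ℕₚ.n<1+n b) Ob)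
    go : ∀ b → b ≤ n → # (Y? b) * suc K ^ b ≤ K ^ b * size
    go zero    _   = begin
      # (Y? 0) * 1 ≡⟨ ℕₚ.*-identityʳ _ ⟩
      # (Y? 0)     ≤⟨ Listₚ.length-filter (Y? 0) elems ⟩
      size         ≡⟨ ℕₚ.*-identityˡ size ⟨
      1 * size     ∎
      where open ℕₚ.≤-Reasoning
    go (suc b) b<n = begin
      # (Y? (suc b)) * (suc K * suc K ^ b) ≡⟨ ℕₚ.*-assoc (# (Y? (suc b))) (suc K) (suc K ^ b) ⟨
      # (Y? (suc b)) * suc K * suc K ^ b   ≤⟨ ℕₚ.*-monoˡ-≤ (suc K ^ b) (next b<n) ⟩
      K * # (Y? b) * suc K ^ b             ≡⟨ ℕₚ.*-assoc K (# (Y? b)) (suc K ^ b) ⟩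
      K * (# (Y? b) * suc K ^ b)           ≤⟨ ℕₚ.*-monoʳ-≤ K (go b (ℕₚ.<⇒≤ b<n)) ⟩
      K * (K ^ b * size)                   ≡⟨ ℕₚ.*-assoc K (K ^ b) size ⟨
      K * K ^ b * size                     ∎
      where open ℕₚ.≤-Reasoning

-- Arrangements

arrangement-≡ : ∀ {A : Set} {r} {a b : Arrangement A r} → entries a ≡ entries b → a ≡ b
arrangement-≡ {a = mkArrangement _ _} {mkArrangement _ _} refl = refl

lookup-≡ : ∀ {A : Set} {r} {xs ys : Vec A r} → (∀ i → lookup xs i ≡ lookup ys i) → xs ≡ ys
lookup-≡ {xs = xs} {ys} eq =
  trans (sym (Vecₚ.tabulate∘lookup xs)) (trans (Vecₚ.tabulate-cong eq) (Vecₚ.tabulate∘lookup ys))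

entry : ∀ {A : Set} {r} → Arrangement A r → Fin r → A
entry a = lookup (entries a)

entry-≡ : ∀ {A : Set} {r} {a b : Arrangement A r} → (∀ i → entry a i ≡ entry b i) → a ≡ b
entry-≡ eq = arrangement-≡ (lookup-≡ eq)

entry-injective : ∀ {A : Set} {r} (a : Arrangement A r) → Injective _≡_ _≡_ (entry a)
-- Distinctness is irrelevant data, so the equation is recovered from the decidability of equality.
entry-injective (mkArrangement xs d) {i} {j} eq =
  recompute (i Fin.≟ j) (VecUniqueₚ.lookup-injective d i j eq)

arrange : ∀ {A : Set} {r} (f : Fin r → A) → .(Injective _≡_ _≡_ f) → Arrangement A r
arrange f inj = mkArrangement (tabulate f) (VecUniqueₚ.tabulate⁺ inj)

entry-arrange : ∀ {A : Set} {r} (f : Fin r → A) (inj : Injective _≡_ _≡_ f) →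
  ∀ i → entry (arrange f inj) i ≡ f i
entry-arrange f _ = Vecₚ.lookup∘tabulate f

entry-map : ∀ {A B : Set} {r} (f : A → B) (inj : Injective _≡_ _≡_ f) (a : Arrangement A r) →
  ∀ i → entry (mapArrangement f inj a) i ≡ f (entry a i)
entry-map f _ a i = Vecₚ.lookup-map i f (entries a)

infix 4 _≟ᴬ_
_≟ᴬ_ : ∀ {n r} → DecidableEquality (Arrangement (Fin n) r)
a ≟ᴬ b = map′ arrangement-≡ (cong entries) (Vecₚ.≡-dec Fin._≟_ (entries a) (entries b))

-- `punchIn x` renumbers the later entries around x; this is the recursion (r + 1)! = (r + 1) r!.
prepend : ∀ {n r} → Fin (suc n) → Arrangement (Fin n) r → Arrangement (Fin (suc n)) (suc r)
prepend x (mkArrangement xs d) = mkArrangement (x ∷ Vec.map (Fin.punchIn x) xs)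
  (VecAllₚ.map⁺ (VecAll.universal (λ y x≡ → Finₚ.punchInᵢ≢i x y (sym x≡)) xs)
    VecAllPairs.∷ VecUniqueₚ.map⁺ (Finₚ.punchIn-injective x _ _) d)

prepend-injective : ∀ {n r x y} {a b : Arrangement (Fin n) r} →
  prepend x a ≡ prepend y b → x ≡ y × a ≡ b
prepend-injective {a = a} {b} eq with cong (λ c → entry c Fin.zero) eq
... | refl = refl , entry-≡ λ i → Finₚ.punchIn-injective _ _ _
  (trans (sym (Vecₚ.lookup-map i _ (entries a)))
    (trans (cong (λ c → entry c (Fin.suc i)) eq) (Vecₚ.lookup-map i _ (entries b))))

opaque
  arrangements : ∀ n r → List (Arrangement (Fin n) r)
  arrangements n       zero    = mkArrangement [] VecAllPairs.[] ∷ []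
  arrangements zero    (suc r) = []
  arrangements (suc n) (suc r) = cartesianProductWith prepend (allFin (suc n)) (arrangements n r)

  arrangements-unique : ∀ n r → Unique (arrangements n r)
  arrangements-unique n       zero    = All.[] ∷ []
  arrangements-unique zero    (suc r) = []
  arrangements-unique (suc n) (suc r) = Uniqueₚ.cartesianProductWith⁺ prepend prepend-injective
    (Uniqueₚ.allFin⁺ (suc n)) (arrangements-unique n r)

  ∈-arrangements : ∀ {n r} (a : Arrangement (Fin n) r) → a ∈ arrangements n r
  ∈-arrangements {n}     {zero}  (mkArrangement [] _) = here refl
  ∈-arrangements {zero}  {suc r} (mkArrangement (() ∷ _) _)
  ∈-arrangements {suc n} {suc r} a = subst (_∈ arrangements (suc n) (suc r)) (entry-≡ eq)
    (Memₚ.∈-cartesianProductWith⁺ prepend (Memₚ.∈-allFin x) (∈-arrangements rest))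
    where
    x : Fin (suc n)
    x = entry a Fin.zero
    x≢ : ∀ i → x ≢ entry a (Fin.suc i)
    x≢ i eq = contradiction (entry-injective a eq) λ ()
    below : Fin r → Fin n
    below i = Fin.punchOut (x≢ i)
    below-injective : Injective _≡_ _≡_ below
    below-injective {i} {j} eq =
      Finₚ.suc-injective (entry-injective a (Finₚ.punchOut-injective (x≢ i) (x≢ j) eq))
    rest : Arrangement (Fin n) r
    rest = arrange below below-injective
    eq : ∀ i → entry (prepend x rest) i ≡ entry a i
    eq Fin.zero    = refl
    eq (Fin.suc i) = trans (Vecₚ.lookup-map i _ (entries rest))
      (trans (cong (Fin.punchIn x) (entry-arrange below below-injective i)) (Finₚ.punchIn-punchOut (x≢ i)))

  length-arrangements : ∀ r → length (arrangements r r) ≡ r !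
  length-arrangements zero    = refl
  length-arrangements (suc r) = trans
    (length-cartesianProductWith prepend (allFin (suc r)) (arrangements r r))
    (cong₂ _*_ (Listₚ.length-tabulate {n = suc r} id) (length-arrangements r))

listed : ∀ n r → Listed (Arrangement (Fin n) r)
listed n r = record
  { elems    = arrangements n r
  ; unique   = arrangements-unique n r
  ; complete = ∈-arrangements
  }

injective⇒surjective : ∀ {n} {f : Fin n → Fin n} → Injective _≡_ _≡_ f → ∀ y → ∃[ x ] f x ≡ y
injective⇒surjective {suc n} {f} inj y with Finₚ.any? (λ x → f x Fin.≟ y)
... | yes p = p
... | no ∄x = contradiction (Finₚ.injective⇒≤ avoiding-injective) ℕₚ.1+n≰n
  where
  y≢ : ∀ x → y ≢ f x
  y≢ x eq = ∄x (x , sym eq)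
  avoiding : Fin (suc n) → Fin n
  avoiding x = Fin.punchOut (y≢ x)
  avoiding-injective : Injective _≡_ _≡_ avoiding
  avoiding-injective {i} {j} eq = inj (Finₚ.punchOut-injective (y≢ i) (y≢ j) eq)

-- Cores of digraphs

subsequences : ∀ {A : Set} → List A → List (List A)
subsequences []       = [] ∷ []
subsequences (x ∷ xs) = map (x ∷_) (subsequences xs) ++ subsequences xs

-- A search through the subsequences of a complete list thus covers all decidable sets of vertices
-- or of edges.
filter∈subsequences : ∀ {A : Set} {P : A → Set} (P? : Decidable P) xs → filter P? xs ∈ subsequences xs
filter∈subsequences P? []       = here refl
filter∈subsequences P? (x ∷ xs) with P? x
... | yes _ = Memₚ.∈-++⁺ˡ (Memₚ.∈-map⁺ (x ∷_) (filter∈subsequences P? xs))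
... | no  _ = Memₚ.∈-++⁺ʳ _ (filter∈subsequences P? xs)

maximum : ∀ {P : ℕ → Set} → Decidable P → ∀ {k} → P k → ∀ n → (∀ {m} → P m → m ≤ n) → ∃[ m ] IsMaximum P m
maximum {P} P? p zero    bound = 0 , subst P (ℕₚ.n≤0⇒n≡0 (bound p)) p , bound
maximum {P} P? p (suc n) bound with P? (suc n)
... | yes q = suc n , q , bound
... | no ¬q = maximum P? p n λ q →
  ℕₚ.≤-pred (ℕₚ.≤∧≢⇒< (bound q) (λ eq → ¬q (subst P eq q)))

module Graph (G : Digraph) where
  open Digraph G renaming (Vertex to V)

  -- The successors are given as a function, so that a core yields an infinite walk. Any closed walk
  -- gives a core, whether or not its vertices are distinct.
  record Core (S : List V) : Set where
    field
      members   : List V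
      start     : V
      start∈    : start ∈ members
      members⊆  : ∀ {x} → x ∈ members → x ∈ S
      successor : ∀ {x} → x ∈ members → ∃[ y ] (y ∈ members × x ⟶ y)

    walk : ℕ → ∃[ x ] x ∈ members
    walk zero    = start , start∈
    walk (suc i) = let (y , y∈ , _) = successor (proj₂ (walk i)) in y , y∈

    walk-⟶ : ∀ i → proj₁ (walk i) ⟶ proj₁ (walk (suc i))
    walk-⟶ i = proj₂ (proj₂ (successor (proj₂ (walk i))))

    walk∈ : ∀ i → proj₁ (walk i) ∈ S
    walk∈ i = members⊆ (proj₂ (walk i))

  Core-⊆ : ∀ {S S′} → (∀ {x} → x ∈ S → x ∈ S′) → Core S → Core S′
  Core-⊆ sub c = record { Core c ; members⊆ = sub ∘ Core.members⊆ c }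

  cycle⇒core : ∀ {S} v vs → All.All (_∈ S) (v ∷ vs) → Linked _⟶_ ((v ∷ vs) ++ v ∷ []) → Core S
  cycle⇒core v vs ⊆S linked = record
    { members = v ∷ vs ; start = v ; start∈ = here refl
    ; members⊆ = All.lookup ⊆S
    ; successor = λ y∈ → let (z , z∈ , e) = next v vs linked y∈ in z , rotate (Memₚ.∈-++⁻ vs z∈) , e }
    where
    next : ∀ x xs → Linked _⟶_ ((x ∷ xs) ++ v ∷ []) →
      ∀ {y} → y ∈ x ∷ xs → ∃[ z ] (z ∈ xs ++ v ∷ [] × y ⟶ z)
    next x []       (e ∷ _) (here refl) = v , here refl , e
    next x (z ∷ xs) (e ∷ _) (here refl) = z , here refl , e
    next x (z ∷ xs) (_ ∷ l) (there y∈)  =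
      let (w , w∈ , e) = next z xs l y∈ in w , there w∈ , e
    rotate : ∀ {z} → z ∈ vs ⊎ z ∈ v ∷ [] → z ∈ v ∷ vs
    rotate (inj₁ z∈)          = there z∈
    rotate (inj₂ (here refl)) = here refl

  -- The walk visits one vertex more than `A` has places, so it returns somewhere, and the stretch
  -- between the two visits closes up.
  walk⇒core : ∀ {A} (π : Fin (suc (length A)) → V) → (∀ i → π i ∈ A) →
    (∀ i → π (Fin.inject₁ i) ⟶ π (Fin.suc i)) → Core A
  walk⇒core {A} π π∈ consecutive with Finₚ.pigeonhole (ℕₚ.n<1+n (length A)) (λ i → Any.index (π∈ i))
  ... | i , j , i<j , eq = record
    { members = map π between ; start = π i
    ; start∈ = Memₚ.∈-map⁺ π (Memₚ.∈-filter⁺ between? (Memₚ.∈-allFin i) (ℕₚ.≤-refl , i<j))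
    ; members⊆ = λ x∈ → let (t , _ , eq′) = Memₚ.∈-map⁻ π x∈ in subst (_∈ A) (sym eq′) (π∈ t)
    ; successor = λ x∈ → let (t , t∈ , eq′) = Memₚ.∈-map⁻ π x∈
                             (y , y∈ , e) = next (proj₂ (Memₚ.∈-filter⁻ between? {xs = allFin (suc (length A))} t∈))
                         in y , y∈ , subst (_⟶ y) (sym eq′) e }
    where
    between? : Decidable (λ t → toℕ i ≤ toℕ t × toℕ t < toℕ j)
    between? t = (toℕ i ≤? toℕ t) ×-dec (toℕ t <? toℕ j)
    between : List (Fin (suc (length A)))
    between = filter between? (allFin (suc (length A)))
    πi≡πj : π i ≡ π j
    πi≡πj = trans (Anyₚ.lookup-index (π∈ i)) (trans (cong (List.lookup A) eq) (sym (Anyₚ.lookup-index (π∈ j))))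
    next : ∀ {t} → toℕ i ≤ toℕ t × toℕ t < toℕ j → ∃[ y ] (y ∈ map π between × π t ⟶ y)
    next {t} (i≤t , t<j) = byCases (ℕₚ.m≤n⇒m<n∨m≡n t<j)
      where
      t<l : toℕ t < length A
      t<l = ℕₚ.<-≤-trans t<j (ℕₚ.≤-pred (Finₚ.toℕ<n j))
      t′ : Fin (length A)
      t′ = Fin.fromℕ< t<l
      toℕ-t′ : toℕ t′ ≡ toℕ t
      toℕ-t′ = Finₚ.toℕ-fromℕ< t<l
      here-edge : π t ⟶ π (Fin.suc t′)
      here-edge = subst (λ u → π u ⟶ π (Fin.suc t′))
        (Finₚ.toℕ-injective (trans (Finₚ.toℕ-inject₁ t′) toℕ-t′)) (consecutive t′)
      byCases : suc (toℕ t) < toℕ j ⊎ suc (toℕ t) ≡ toℕ j → ∃[ y ] (y ∈ map π between × π t ⟶ y)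
      byCases (inj₁ 1+t<j) = π (Fin.suc t′) , Memₚ.∈-map⁺ π (Memₚ.∈-filter⁺ between? (Memₚ.∈-allFin _)
        ( ℕₚ.≤-trans i≤t (ℕₚ.≤-trans (ℕₚ.≤-reflexive (sym toℕ-t′)) (ℕₚ.n≤1+n _))
        , subst (λ u → suc u < toℕ j) (sym toℕ-t′) 1+t<j)) , here-edge
      byCases (inj₂ 1+t≡j) = π i , Memₚ.∈-map⁺ π (Memₚ.∈-filter⁺ between? (Memₚ.∈-allFin i) (ℕₚ.≤-refl , i<j)) ,
        subst (π t ⟶_) (trans (cong π (Finₚ.toℕ-injective (trans (cong suc toℕ-t′) 1+t≡j))) (sym πi≡πj)) here-edge

  module Decided (_≟ⱽ_ : DecidableEquality V) (_⟶?_ : ∀ x y → Dec (x ⟶ y)) where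
    open import Data.List.Membership.DecPropositional _≟ⱽ_ using (_∈?_)
    open import Data.List.Relation.Unary.Unique.DecPropositional _≟ⱽ_ using (unique?)

    -- Successors are followed until one repeats. The path behind the current vertex is kept in
    -- reverse in `ys`; `close` moves it back vertex by vertex until the repeated one is reached. A
    -- path of distinct members cannot outgrow `members`, which bounds the recursion.
    core⇒cycle : ∀ {S} → Core S → ∃[ v ] ∃[ vs ] (All.All (_∈ S) (v ∷ vs) × IsCycle G v vs)
    core⇒cycle {S} c = extend (length members) start∈ All.[] [] tt (λ ()) ℕₚ.≤-refl
      where
      open Core c
      Leads : List V → V → Set
      Leads []       x = ⊤
      Leads (y ∷ ys) x = y ⟶ x × Leads ys y
      close : ∀ {w acc ys z} → All.All (_∈ members) (w ∷ acc) → All.All (_∈ members) ys →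
        Unique (w ∷ acc) → Unique ys → (∀ {u} → u ∈ w ∷ acc → u ∉ ys) →
        Linked _⟶_ ((w ∷ acc) ++ z ∷ []) → Leads ys w → z ∈ w ∷ ys →
        ∃[ v ] ∃[ vs ] (All.All (_∈ S) (v ∷ vs) × IsCycle G v vs)
      close {w} {acc} ms _ u _ _ l _ (here refl) = w , acc , All.map members⊆ ms , u , l
      close {ys = y ∷ ys} ms (m All.∷ ns) u (y∉ ∷ u′) disjoint l (e , p) (there z∈) =
        close (m All.∷ ms) ns (All.tabulate (λ x∈ y≡x → disjoint x∈ (here (sym y≡x))) ∷ u) u′
          (λ { (here refl) y∈ → All.lookup y∉ y∈ refl ; (there x∈) x∈ys → disjoint x∈ (there x∈ys) })
          (e ∷ l) p z∈
      extend : ∀ n {x ys} → x ∈ members → All.All (_∈ members) ys → Unique ys → Leads ys x → x ∉ ys →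
        length members ≤ length ys + n → ∃[ v ] ∃[ vs ] (All.All (_∈ S) (v ∷ vs) × IsCycle G v vs)
      extend zero {x} {ys} x∈ ms u p x∉ bound = contradiction
        (ℕₚ.≤-trans (unique-⊆ (All.tabulate (λ y∈ x≡y → x∉ (subst (_∈ ys) (sym x≡y) y∈)) ∷ u)
                      (All.lookup (x∈ All.∷ ms)))
                    (subst (length members ≤_) (ℕₚ.+-identityʳ _) bound))
        ℕₚ.1+n≰n
      extend (suc n) {x} {ys} x∈ ms u p x∉ bound with successor x∈
      ... | z , z∈ , e with z ∈? x ∷ ys
      ...   | yes z∈path = close (x∈ All.∷ All.[]) ms (All.[] ∷ []) u (λ { (here refl) → x∉ })
                             (e ∷ [-]) p z∈path
      ...   | no  z∉path = extend n z∈ (x∈ All.∷ ms)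
        (All.tabulate (λ y∈ x≡y → x∉ (subst (_∈ ys) (sym x≡y) y∈)) ∷ u) (e , p) z∉path
        (subst (length members ≤_) (ℕₚ.+-suc _ n) bound)

    -- A vertex without successor in S lies in no core and can be removed; once no such vertex is
    -- left, S is empty or itself a core.
    core? : ∀ S → Dec (Core S)
    core? S = peel (length S) S ℕₚ.≤-refl
      where
      peel : ∀ n S → length S ≤ n → Dec (Core S)
      peel n [] _ = no λ c → contradiction (Core.members⊆ c (Core.start∈ c)) λ ()
      peel (suc n) S@(s ∷ _) ≤n with All.all? (λ x → Any.any? (x ⟶?_) S) S
      ... | yes all = yes (record
        { members = S ; start = s ; start∈ = here refl ; members⊆ = id
        ; successor = λ x∈ → find (All.lookup all x∈) })
      ... | no ¬all with find (Allₚ.¬All⇒Any¬ (λ x → Any.any? (x ⟶?_) S) S ¬all)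
      ...   | x , x∈ , sink = map′ (Core-⊆ (proj₁ ∘ Memₚ.∈-filter⁻ ≢x? {xs = S})) shrink-core
        (peel n (filter ≢x? S) (ℕₚ.≤-pred (ℕₚ.≤-trans
          (Listₚ.filter-notAll ≢x? S (Any.map (λ { refl ¬eq → ¬eq refl }) x∈)) ≤n)))
        where
        ≢x? : Decidable (x ≢_)
        ≢x? y = ¬? (x ≟ⱽ y)
        shrink-core : Core S → Core (filter ≢x? S)
        shrink-core c = record { Core c ; members⊆ = λ y∈ → Memₚ.∈-filter⁺ ≢x? (Core.members⊆ c y∈)
          λ { refl → let (z , z∈ , e) = Core.successor c y∈ in sink (lose (Core.members⊆ c z∈) e) } }

    coreless⇒acyclic : ∀ {S} → ¬ Core S → InducesAcyclic G S
    coreless⇒acyclic ¬c v vs ⊆S (_ , l) = ¬c (cycle⇒core v vs ⊆S l)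

    acyclic⇒coreless : ∀ {S} → InducesAcyclic G S → ¬ Core S
    acyclic⇒coreless acyclic c = let (v , vs , ⊆S , cyc) = core⇒cycle c in acyclic v vs ⊆S cyc

    acyclicNumber : Listed V → ∃[ m ] IsAcyclicNumber G m
    acyclicNumber V-listed = maximum P? {0}
      ([] , [] , coreless⇒acyclic (λ c → contradiction (Core.members⊆ c (Core.start∈ c)) λ ()) , refl)
      size λ { (S , u , _ , refl) → unique-⊆ u (λ {x} _ → complete x) }
      where
      open Listed V-listed
      P : ℕ → Set
      P m = ∃[ S ] (Unique S × InducesAcyclic G S × length S ≡ m)
      Good : ℕ → List V → Set
      Good m S = Unique S × ¬ Core S × length S ≡ m
      Good? : ∀ m → Decidable (Good m)
      Good? m S = unique? S ×-dec (¬? (core? S) ×-dec (length S ≟ m))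
      P? : Decidable P
      P? m = map′
        (λ any → let (S , _ , u , ¬c , eq) = find {P = Good m} any in S , u , coreless⇒acyclic ¬c , eq)
        -- An arbitrary list S is replaced by its members in the order of `elems`, where the search
        -- finds it.
        (λ { (S , u , acyclic , eq) → lose (filter∈subsequences (_∈? S) elems)
          ( Uniqueₚ.filter⁺ (_∈? S) unique
          , (λ c → acyclic⇒coreless acyclic (Core-⊆ (proj₂ ∘ Memₚ.∈-filter⁻ (_∈? S) {xs = elems}) c))
          , trans (ℕₚ.≤-antisym
              (unique-⊆ (Uniqueₚ.filter⁺ (_∈? S) unique) (proj₂ ∘ Memₚ.∈-filter⁻ (_∈? S) {xs = elems}))
              (unique-⊆ u (λ {x} x∈ → Memₚ.∈-filter⁺ (_∈? S) (complete x) x∈))) eq) })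
        (Any.any? (Good? m) (subsequences elems))

map-core : ∀ {V : Set} {_⟶₁_ _⟶₂_ : V → V → Set} → (∀ {x y} → x ⟶₁ y → x ⟶₂ y) → ∀ {S} →
  Graph.Core (record { Vertex = V ; _⟶_ = _⟶₁_ }) S → Graph.Core (record { Vertex = V ; _⟶_ = _⟶₂_ }) S
map-core sub c = record
  { members = members ; start = start ; start∈ = start∈ ; members⊆ = members⊆
  ; successor = λ x∈ → let (y , y∈ , e) = successor x∈ in y , y∈ , sub e }
  where open Graph.Core c

-- The pattern-shift graph

lookup-tail : ∀ {A : Set} {n} (xs : Vec A (suc n)) i → lookup (Vec.tail xs) i ≡ lookup xs (Fin.suc i)
lookup-tail (_ ∷ _) i = refl

lookup-init : ∀ {A : Set} {n} (xs : Vec A (suc n)) i → lookup (Vec.init xs) i ≡ lookup xs (Fin.inject₁ i)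
lookup-init (_ ∷ _ ∷ _)  Fin.zero    = refl
lookup-init (_ ∷ y ∷ ys) (Fin.suc i) = lookup-init (y ∷ ys) i

module Cyclic (m : ℕ) where

  r : ℕ
  r = suc m

  Perm : Set
  Perm = Arrangement (Fin r) r

  open Listed (listed r r) public

  toℕ-mod : ∀ i → toℕ (i mod r) ≡ i % r
  toℕ-mod i = Finₚ.toℕ-fromℕ< (m%n<n i r)

  opaque
    -- Positions count modulo r: a rotation becomes a shift of the argument, and windows may run
    -- past the end.
    at : Perm → ℕ → ℕ
    at a i = toℕ (entry a (i mod r))

    at-toℕ : ∀ a i → at a (toℕ i) ≡ toℕ (entry a i)
    at-toℕ a i = cong (toℕ ∘ entry a)
      (Finₚ.toℕ-injective (trans (toℕ-mod (toℕ i)) (m<n⇒m%n≡m (Finₚ.toℕ<n i))))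

    at-cong : ∀ a i j → i % r ≡ j % r → at a i ≡ at a j
    at-cong a i j eq = cong (toℕ ∘ entry a)
      (Finₚ.toℕ-injective (trans (toℕ-mod i) (trans eq (sym (toℕ-mod j)))))

    at-injective : ∀ a i j → at a i ≡ at a j → i % r ≡ j % r
    at-injective a i j eq = trans (sym (toℕ-mod i))
      (trans (cong toℕ (entry-injective a {i mod r} {j mod r} (Finₚ.toℕ-injective eq))) (toℕ-mod j))

    at<r : ∀ a i → at a i < r
    at<r a i = Finₚ.toℕ<n (entry a (i mod r))

  at-injective-< : ∀ a {i j} → i < r → j < r → at a i ≡ at a j → i ≡ j
  at-injective-< a {i} {j} i<r j<r eq =
    subst₂ _≡_ (m<n⇒m%n≡m i<r) (m<n⇒m%n≡m j<r) (at-injective a i j eq)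

  at-≡ : ∀ {a b} → (∀ {i} → i < r → at a i ≡ at b i) → a ≡ b
  at-≡ {a} {b} eq = entry-≡ λ i → Finₚ.toℕ-injective
    (trans (sym (at-toℕ a i)) (trans (eq (Finₚ.toℕ<n i)) (at-toℕ b i)))

  opaque
    at-surjective : ∀ a {v} → v < r → ∃[ i ] (i < r × at a i ≡ v)
    at-surjective a v<r =
      let (i , eq) = injective⇒surjective (entry-injective a) (Fin.fromℕ< v<r)
      in toℕ i , Finₚ.toℕ<n i , trans (at-toℕ a i) (trans (cong toℕ eq) (Finₚ.toℕ-fromℕ< v<r))

  opaque
    unfolding at

    fromValues : (f : ℕ → ℕ) → (∀ i → f i < r) → (∀ {i j} → i < r → j < r → f i ≡ f j → i ≡ j) → Perm
    fromValues f f<r inj = arrange (λ i → Fin.fromℕ< (f<r (toℕ i))) λ {i} {j} eq →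
      Finₚ.toℕ-injective (inj (Finₚ.toℕ<n i) (Finₚ.toℕ<n j)
        (trans (sym (Finₚ.toℕ-fromℕ< (f<r (toℕ i)))) (trans (cong toℕ eq) (Finₚ.toℕ-fromℕ< (f<r (toℕ j))))))

    at-fromValues : ∀ f f<r (inj : ∀ {i j} → i < r → j < r → f i ≡ f j → i ≡ j) i → at (fromValues f f<r inj) i ≡ f (i % r)
    at-fromValues f f<r inj i = trans
      (cong toℕ (Vecₚ.lookup∘tabulate (λ i → Fin.fromℕ< (f<r (toℕ i))) (i mod r)))
      (trans (Finₚ.toℕ-fromℕ< (f<r (toℕ (i mod r)))) (cong f (toℕ-mod i)))

  opaque
    rearrange : (π : ℕ → ℕ) → (∀ {i j} → i < r → j < r → π i % r ≡ π j % r → i ≡ j) → Perm → Perm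
    rearrange π inj a = fromValues (at a ∘ π) (λ i → at<r a (π i))
      (λ {i} {j} i<r j<r eq → inj i<r j<r (at-injective a (π i) (π j) eq))

    at-rearrange : ∀ π (inj : ∀ {i j} → i < r → j < r → π i % r ≡ π j % r → i ≡ j) a i →
      at (rearrange π inj a) i ≡ at a (π (i % r))
    at-rearrange π inj a = at-fromValues (at a ∘ π) (λ i → at<r a (π i))
      (λ {i} {j} i<r j<r eq → inj i<r j<r (at-injective a (π i) (π j) eq))

  +-cancelʳ-% : ∀ k i j → (i + k) % r ≡ (j + k) % r → i % r ≡ j % r
  +-cancelʳ-% k i j eq = trans (unshift i) (trans (cong (λ n → (n + k * m) % r) eq) (sym (unshift j)))
    where
    -- As m = r - 1, adding k m completes the shift by k to one by k r.
    unshift : ∀ i → i % r ≡ ((i + k) % r + k * m) % r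
    unshift i = sym (trans (%-distribˡ-+ ((i + k) % r) (k * m) r)
      (trans (cong (λ n → (n + k * m % r) % r) (m%n%n≡m%n (i + k) r))
      (trans (sym (%-distribˡ-+ (i + k) (k * m) r))
      (trans (cong (_% r) (trans (ℕₚ.+-assoc i k (k * m)) (cong (_+_ i) (sym (ℕₚ.*-suc k m)))))
        ([m+kn]%n≡m%n i k r)))))

  +-injective-% : ∀ k {i j} → i < r → j < r → (i + k) % r ≡ (j + k) % r → i ≡ j
  +-injective-% k {i} {j} i<r j<r eq =
    subst₂ _≡_ (m<n⇒m%n≡m i<r) (m<n⇒m%n≡m j<r) (+-cancelʳ-% k i j eq)

  opaque
    rotate : ℕ → Perm → Perm
    rotate k = rearrange (_+ k) (+-injective-% k)

    at-rotate : ∀ k a i → at (rotate k a) i ≡ at a (i + k)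
    at-rotate k a i = trans (at-rearrange (_+ k) (+-injective-% k) a i) (at-cong a (i % r + k) (i + k) (begin
      (i % r + k) % r          ≡⟨ %-distribˡ-+ (i % r) k r ⟩
      (i % r % r + k % r) % r  ≡⟨ cong (λ n → (n + k % r) % r) (m%n%n≡m%n i r) ⟩
      (i % r + k % r) % r      ≡⟨ %-distribˡ-+ i k r ⟨
      (i + k) % r              ∎))
      where open ≡.≡-Reasoning

  rotate-rotate : ∀ k l a → rotate k (rotate l a) ≡ rotate (k + l) a
  rotate-rotate k l a = at-≡ λ {i} _ → trans (at-rotate k (rotate l a) i)
    (trans (at-rotate l a (i + k)) (trans (cong (at a) (ℕₚ.+-assoc i k l)) (sym (at-rotate (k + l) a i))))

  rotate-cong : ∀ k l a → k % r ≡ l % r → rotate k a ≡ rotate l a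
  rotate-cong k l a eq = at-≡ λ {i} _ → trans (at-rotate k a i) (trans
    (at-cong a (i + k) (i + l) (trans (%-distribˡ-+ i k r) (trans (cong (λ n → (i % r + n) % r) eq) (sym (%-distribˡ-+ i l r)))))
    (sym (at-rotate l a i)))

  rotate-0 : ∀ a → rotate 0 a ≡ a
  rotate-0 a = at-≡ λ {i} _ → trans (at-rotate 0 a i) (cong (at a) (ℕₚ.+-identityʳ i))

  rotate-r : ∀ a → rotate r a ≡ a
  rotate-r a = trans (rotate-cong r 0 a (n%n≡0 r)) (rotate-0 a)

  tail-at : ∀ a (i : Fin m) → toℕ (lookup (Vec.tail (entries a)) i) ≡ at a (suc (toℕ i))
  tail-at a i = trans (cong toℕ (lookup-tail (entries a) i)) (sym (at-toℕ a (Fin.suc i)))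

  init-at : ∀ a (i : Fin m) → toℕ (lookup (Vec.init (entries a)) i) ≡ at a (toℕ i)
  init-at a i = trans (cong toℕ (lookup-init (entries a) i))
    (trans (sym (at-toℕ a (Fin.inject₁ i))) (cong (at a) (Finₚ.toℕ-inject₁ i)))

  infix 4 _⟶_ _⟶?_
  opaque
    _⟶_ : Perm → Perm → Set
    _⟶_ = Digraph._⟶_ (PSG r)

    to-PSG : ∀ {a b} → a ⟶ b → Digraph._⟶_ (PSG r) a b
    to-PSG e = e

    from-PSG : ∀ {a b} → Digraph._⟶_ (PSG r) a b → a ⟶ b
    from-PSG e = e

    _⟶?_ : ∀ a b → Dec (a ⟶ b)
    a ⟶? b = Finₚ.all? λ i → Finₚ.all? λ j → (i Fin.<? j) →-dec
      map′ (λ (f , g) → mk⇔ f g) (λ e → Equivalence.to e , Equivalence.from e)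
        ( ((lookup (Vec.tail (entries a)) i Fin.<? lookup (Vec.tail (entries a)) j)
            →-dec (lookup (Vec.init (entries b)) i Fin.<? lookup (Vec.init (entries b)) j))
        ×-dec ((lookup (Vec.init (entries b)) i Fin.<? lookup (Vec.init (entries b)) j)
            →-dec (lookup (Vec.tail (entries a)) i Fin.<? lookup (Vec.tail (entries a)) j)))

  edge⁺ : ∀ a b →
    (∀ {i j} → i < m → j < m → at a (suc i) < at a (suc j) → at b i < at b j) →
    (∀ {i j} → i < m → j < m → at b i < at b j → at a (suc i) < at a (suc j)) →
    a ⟶ b
  edge⁺ a b to from = from-PSG {a} {b} λ i j _ → mk⇔
    (λ lt → subst₂ _<_ (sym (init-at b i)) (sym (init-at b j))
      (to (Finₚ.toℕ<n i) (Finₚ.toℕ<n j) (subst₂ _<_ (tail-at a i) (tail-at a j) lt)))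
    (λ lt → subst₂ _<_ (sym (tail-at a i)) (sym (tail-at a j))
      (from (Finₚ.toℕ<n i) (Finₚ.toℕ<n j) (subst₂ _<_ (init-at b i) (init-at b j) lt)))

  module _ a b (e : a ⟶ b) {i j} (i<m : i < m) (j<m : j < m) where
    private
      forward : ∀ {i j} → i < m → j < m → i < j → at a (suc i) < at a (suc j) ⇔ at b i < at b j
      forward {i} {j} i<m j<m i<j =
        subst₂ (λ i j → at a (suc i) < at a (suc j) ⇔ at b i < at b j)
          (Finₚ.toℕ-fromℕ< i<m) (Finₚ.toℕ-fromℕ< j<m)
          (subst₂ _⇔_ (cong₂ _<_ (tail-at a i′) (tail-at a j′)) (cong₂ _<_ (init-at b i′) (init-at b j′))
            (to-PSG {a} {b} e i′ j′ (subst₂ _<_ (sym (Finₚ.toℕ-fromℕ< i<m)) (sym (Finₚ.toℕ-fromℕ< j<m)) i<j)))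
        where
        i′ j′ : Fin m
        i′ = Fin.fromℕ< i<m
        j′ = Fin.fromℕ< j<m

    -- An edge compares only positions i < j; for i > j the comparison follows because entries are
    -- distinct.
    edge⁻ : at a (suc i) < at a (suc j) → at b i < at b j
    edge⁻ lt with ℕₚ.<-cmp i j
    ... | tri< i<j _ _ = Equivalence.to (forward i<m j<m i<j) lt
    ... | tri≈ _ refl _ = contradiction lt (ℕₚ.<-irrefl refl)
    ... | tri> _ i≢j j<i = ℕₚ.≰⇒> λ b≤ → [
        (λ b< → ℕₚ.<-asym lt (Equivalence.from (forward j<m i<m j<i) b<))
      , (λ b≡ → i≢j (sym (at-injective-< b (ℕₚ.m<n⇒m<1+n j<m) (ℕₚ.m<n⇒m<1+n i<m) b≡)))
      ]′ (ℕₚ.m≤n⇒m<n∨m≡n b≤)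

    edge⁻′ : at b i < at b j → at a (suc i) < at a (suc j)
    edge⁻′ lt with ℕₚ.<-cmp i j
    ... | tri< i<j _ _ = Equivalence.from (forward i<m j<m i<j) lt
    ... | tri≈ _ refl _ = contradiction lt (ℕₚ.<-irrefl refl)
    ... | tri> _ i≢j j<i = ℕₚ.≰⇒> λ a≤ → [
        (λ a< → ℕₚ.<-asym lt (Equivalence.to (forward j<m i<m j<i) a<))
      , (λ a≡ → i≢j (ℕₚ.suc-injective (sym (at-injective-< a (s≤s j<m) (s≤s i<m) a≡))))
      ]′ (ℕₚ.m≤n⇒m<n∨m≡n a≤)

  shifts : Digraph
  shifts = record { Vertex = Perm ; _⟶_ = _⟶_ }

  open Graph shifts public
  open Decided _≟ᴬ_ _⟶?_ public

  rotate-⟶ : ∀ k a → rotate k a ⟶ rotate (suc k) a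
  rotate-⟶ k a = edge⁺ (rotate k a) (rotate (suc k) a)
    (λ {i} {j} _ _ → subst₂ _<_ (eq i) (eq j))
    (λ {i} {j} _ _ → subst₂ _<_ (sym (eq i)) (sym (eq j)))
    where
    eq : ∀ i → at (rotate k a) (suc i) ≡ at (rotate (suc k) a) i
    eq i = trans (at-rotate k a (suc i))
      (trans (cong (at a) (sym (ℕₚ.+-suc i k))) (sym (at-rotate (suc k) a i)))

-- The upper bound

module _ (m : ℕ) (1≤m : 1 ≤ m) where
  open Cyclic m

  rotate-inverse : ∀ k a → ∃[ c ] (c < r × rotate c (rotate k a) ≡ a)
  -- k m is -k modulo r, because k m + k = k r.
  rotate-inverse k a = k * m % r , m%n<n (k * m) r ,
    trans (rotate-cong (k * m % r) (k * m) (rotate k a) (m%n%n≡m%n (k * m) r))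
    (trans (rotate-rotate (k * m) k a)
    (trans (rotate-cong (k * m + k) 0 a (trans
        (cong (_% r) (trans (ℕₚ.+-comm (k * m) k) (sym (ℕₚ.*-suc k m))))
        (m*n%n≡0 k r)))
      (rotate-0 a)))

  module _ {S : List Perm} (coreless : ¬ Core S) where
    open import Data.List.Membership.DecPropositional (_≟ᴬ_ {r} {r}) using (_∈?_)

    -- Consecutive rotations are joined by edges, so with the closing edge `back` these rotations
    -- would be a core if all of them lay in S.
    closed-meets : ∀ a lo n → rotate (lo + n) a ⟶ rotate lo a →
      ∃[ i ] (i ≤ n × rotate (lo + i) a ∉ S)
    closed-meets a lo n back with ℕₚ.anyUpTo? (λ i → ¬? (rotate (lo + i) a ∈? S)) (suc n)
    ... | yes (i , s≤s i≤n , ∉S) = i , i≤n , ∉S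
    ... | no  none = contradiction core coreless
      where
      vertex : ℕ → Perm
      vertex i = rotate (lo + i) a
      core : Core S
      core = record
        { members   = map vertex (upTo (suc n))
        ; start     = vertex 0
        ; start∈    = Memₚ.∈-map⁺ vertex (Memₚ.∈-upTo⁺ z<s)
        ; members⊆  = λ x∈ → let (i , i∈ , eq) = Memₚ.∈-map⁻ vertex x∈ in
            subst (_∈ S) (sym eq) (decidable-stable (vertex i ∈? S) λ ∉S →
              none (i , Memₚ.∈-upTo⁻ i∈ , ∉S))
        ; successor = λ x∈ → let (i , i∈ , eq) = Memₚ.∈-map⁻ vertex x∈
                                 (y , y∈ , e) = next (Memₚ.∈-upTo⁻ i∈)
                             in y , y∈ , subst (_⟶ y) (sym eq) e
        }
        where
        next : ∀ {i} → i < suc n → ∃[ y ] (y ∈ map vertex (upTo (suc n)) × vertex i ⟶ y)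
        next {i} (s≤s i≤n) with ℕₚ.m≤n⇒m<n∨m≡n i≤n
        ... | inj₁ i<n  = vertex (suc i) , Memₚ.∈-map⁺ vertex (Memₚ.∈-upTo⁺ (s≤s i<n)) ,
          subst (vertex i ⟶_) (cong (λ k → rotate k a) (sym (ℕₚ.+-suc lo i))) (rotate-⟶ (lo + i) a)
        ... | inj₂ refl = vertex 0 , Memₚ.∈-map⁺ vertex (Memₚ.∈-upTo⁺ z<s) ,
          subst (λ k → vertex i ⟶ rotate k a) (sym (ℕₚ.+-identityʳ lo)) back

    -- For d coprime to r, the first r − 1 entries of the rotation of (d i mod r) that ends in
    -- r − 1 are one less than those of the rotation that ends in 0, so they have the same
    -- pattern: the orbit splits into two closed walks.
    module Affine (d : ℕ) (gcd≡1 : gcd d r ≡ 1) where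

      private
        ordered : ∀ {i j} → i ≤ j → j < r → d * i % r ≡ d * j % r → i ≡ j
        ordered {i} {j} i≤j j<r eq with j ∸ i in j∸i
        ... | zero  = ℕₚ.≤-antisym i≤j (ℕₚ.m∸n≡0⇒m≤n j∸i)
        ... | suc k = contradiction
          (∣⇒≤ (coprime-divisor {r} {d} {suc k} (λ (p , q) → gcd≡1⇒coprime gcd≡1 (q , p))
            (m%n≡0⇒n∣m (d * suc k) r divisible)))
          (ℕₚ.<⇒≱ (ℕₚ.≤-<-trans (subst (_≤ j) j∸i (ℕₚ.m∸n≤m j i)) j<r))
          where
          divisible : d * suc k % r ≡ 0
          divisible = +-cancelʳ-% (d * i) (d * suc k) 0 (trans
            (cong (_% r) (trans (sym (ℕₚ.*-distribˡ-+ d (suc k) i))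
              (cong (_*_ d) (trans (cong (_+ i) (sym j∸i)) (ℕₚ.m∸n+n≡m i≤j))))) (sym eq))

      *-injective-% : ∀ {i j} → i < r → j < r → d * i % r ≡ d * j % r → i ≡ j
      *-injective-% {i} {j} i<r j<r eq with ℕₚ.≤-total i j
      ... | inj₁ i≤j = ordered i≤j j<r eq
      ... | inj₂ j≤i = sym (ordered j≤i i<r (sym eq))

      affine : Perm
      affine = fromValues (λ i → d * i % r) (λ i → m%n<n (d * i) r) *-injective-%

      at-affine : ∀ i → at affine i ≡ d * i % r
      at-affine i = trans
        (at-fromValues (λ i → d * i % r) (λ i → m%n<n (d * i) r) *-injective-% i)
        (trans (%-distribˡ-* d (i % r) r)
          (trans (cong (λ n → d % r * n % r) (m%n%n≡m%n i r)) (sym (%-distribˡ-* d i r))))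

      top : ∃[ i ] (i < r × at affine i ≡ m)
      top = at-surjective affine (ℕₚ.n<1+n m)

      i₀ : ℕ
      i₀ = proj₁ top

      d*i₀ : d * i₀ % r ≡ m
      d*i₀ = trans (sym (at-affine i₀)) (proj₂ (proj₂ top))

      i₀<r : i₀ < r
      i₀<r = proj₁ (proj₂ top)

      1≤i₀ : 1 ≤ i₀
      1≤i₀ with i₀ in eq
      ... | suc _ = s≤s z≤n
      ... | zero  = contradiction (trans (sym d*i₀) (cong (λ i → d * i % r) eq))
        (λ m≡ → ℕₚ.<⇒≢ 1≤m (sym (trans m≡ (cong (_% r) (ℕₚ.*-zeroʳ d)))))

      predecessor : ∀ {i} → i < m → suc (at (rotate (suc i₀) affine) i) ≡ at (rotate 1 affine) i
      predecessor {i} i<m with at (rotate 1 affine) i in eq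
      -- The value 0 occurs only at position 0, which is not among the first r - 1 positions after a
      -- rotation by 1.
      ... | zero  = contradiction
        (at-injective-< affine (s≤s i<m) z<s (trans (sym shifted) (trans eq (sym (trans (at-affine 0) (cong (_% r) (ℕₚ.*-zeroʳ d)))))))
        λ ()
        where
        shifted : at (rotate 1 affine) i ≡ at affine (suc i)
        shifted = trans (at-rotate 1 affine i) (cong (at affine) (ℕₚ.+-comm i 1))
      ... | suc u = cong suc (begin
        at (rotate (suc i₀) affine) i        ≡⟨ at-rotate (suc i₀) affine i ⟩
        at affine (i + suc i₀)               ≡⟨ at-affine (i + suc i₀) ⟩
        d * (i + suc i₀) % r                 ≡⟨ cong (λ n → d * n % r) (ℕₚ.+-assoc i 1 i₀) ⟨
        d * (i + 1 + i₀) % r                 ≡⟨ cong (_% r) (ℕₚ.*-distribˡ-+ d (i + 1) i₀) ⟩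
        (d * (i + 1) + d * i₀) % r           ≡⟨ %-distribˡ-+ (d * (i + 1)) (d * i₀) r ⟩
        (d * (i + 1) % r + d * i₀ % r) % r   ≡⟨ cong₂ (λ x y → (x + y) % r) value d*i₀ ⟩
        (suc u + m) % r                      ≡⟨ cong (_% r) (ℕₚ.+-suc u m) ⟨
        (u + r) % r                          ≡⟨ [m+n]%n≡m%n u r ⟩
        u % r                                ≡⟨ m<n⇒m%n≡m (ℕₚ.<⇒≤ (subst (_< r) eq (at<r (rotate 1 affine) i))) ⟩
        u                                    ∎)
        where
        open ≡.≡-Reasoning
        value : d * (i + 1) % r ≡ suc u
        value = trans (sym (at-affine (i + 1))) (trans (sym (at-rotate 1 affine i)) eq)

      -- The members of the orbit fall into the closed walks 1 , … , i₀ and i₀ + 1 , … , r.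
      meets-first : ∃[ i ] (1 ≤ i × i ≤ i₀ × rotate i affine ∉ S)
      meets-first =
        let (i , i≤ , ∉S) = closed-meets affine 1 (i₀ ∸ 1) back
        in suc i , s≤s z≤n , subst (suc i ≤_) (ℕₚ.m+[n∸m]≡n 1≤i₀) (s≤s i≤) , ∉S
        where
        -- The edge from the rotation by i₀ to that by i₀ + 1 also leads to the rotation by 1, as
        -- `predecessor` gives their first r - 1 entries the same pattern.
        back : rotate (1 + (i₀ ∸ 1)) affine ⟶ rotate 1 affine
        back = subst (λ i → rotate i affine ⟶ rotate 1 affine) (sym (ℕₚ.m+[n∸m]≡n 1≤i₀))
          (edge⁺ (rotate i₀ affine) (rotate 1 affine)
            (λ i<m j<m lt → subst₂ _<_ (predecessor i<m) (predecessor j<m)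
              (s≤s (edge⁻ (rotate i₀ affine) (rotate (suc i₀) affine) (rotate-⟶ i₀ affine) i<m j<m lt)))
            (λ i<m j<m lt → edge⁻′ (rotate i₀ affine) (rotate (suc i₀) affine) (rotate-⟶ i₀ affine) i<m j<m
              (ℕₚ.≤-pred (subst₂ _<_ (sym (predecessor i<m)) (sym (predecessor j<m)) lt))))

      meets-second : ∃[ i ] (i₀ < i × i ≤ r × rotate i affine ∉ S)
      meets-second =
        let (i , i≤ , ∉S) = closed-meets affine (suc i₀) (m ∸ i₀) back
        in suc i₀ + i , ℕₚ.m≤m+n (suc i₀) i , subst (suc i₀ + i ≤_) to-r (ℕₚ.+-monoʳ-≤ (suc i₀) i≤) , ∉S
        where
        to-r : suc i₀ + (m ∸ i₀) ≡ r
        to-r = cong suc (ℕₚ.m+[n∸m]≡n (ℕₚ.≤-pred i₀<r))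
        last-edge : rotate r affine ⟶ rotate 1 affine
        last-edge = subst (rotate r affine ⟶_) (rotate-cong (suc r) 1 affine ([m+n]%n≡m%n 1 r)) (rotate-⟶ r affine)
        back : rotate (suc i₀ + (m ∸ i₀)) affine ⟶ rotate (suc i₀) affine
        back = subst (λ i → rotate i affine ⟶ rotate (suc i₀) affine) (sym to-r)
          (edge⁺ (rotate r affine) (rotate (suc i₀) affine)
            (λ i<m j<m lt → ℕₚ.≤-pred (subst₂ _<_ (sym (predecessor i<m)) (sym (predecessor j<m))
              (edge⁻ (rotate r affine) (rotate 1 affine) last-edge i<m j<m lt)))
            (λ i<m j<m lt → edge⁻′ (rotate r affine) (rotate 1 affine) last-edge i<m j<m
              (subst₂ _<_ (predecessor i<m) (predecessor j<m) (s≤s lt))))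

    IsAffine : ℕ → ℕ → Perm → Set
    IsAffine d j x = ∀ {k} → k < r → at x k ≡ d * (k + j) % r

    -- The slope modulo r is the difference of the entries at positions 1 and 0.
    IsAffine-unique : ∀ d e i j x → d < r → e < r → IsAffine d i x → IsAffine e j x → d ≡ e
    IsAffine-unique d e i j x d<r e<r p q = subst₂ _≡_ (m<n⇒m%n≡m d<r) (m<n⇒m%n≡m e<r)
      (+-cancelʳ-% (d * i) d e (begin
        (d + d * i) % r             ≡⟨ cong (_% r) (ℕₚ.*-suc d i) ⟨
        d * (1 + i) % r             ≡⟨ trans (sym (p (s≤s 1≤m))) (q (s≤s 1≤m)) ⟩
        e * (1 + j) % r             ≡⟨ cong (_% r) (ℕₚ.*-suc e j) ⟩
        (e + e * j) % r             ≡⟨ %-distribˡ-+ e (e * j) r ⟩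
        (e % r + e * j % r) % r     ≡⟨ cong (λ n → (e % r + n) % r) (trans (sym (p z<s)) (q z<s)) ⟨
        (e % r + d * i % r) % r     ≡⟨ %-distribˡ-+ e (d * i) r ⟨
        (e + d * i) % r             ∎))
      where open ≡.≡-Reasoning

    -- The union of the second walks over all d: the i with d i = r - 1 modulo r is i₀, so i < j ≤ r
    -- places j among i₀ + 1, ..., r. Splitting the complement of S by this property keeps the (r -
    -- 1)! orbits and the φ(r) extra vertices from being counted twice.
    InSecond : Perm → Set
    InSecond x = ∃[ d ] (d < r × gcd d r ≡ 1 × ∃[ j ] (j < suc r × IsAffine d j x × ∃[ i ] (i < j × d * i % r ≡ m)))

    InSecond? : Decidable InSecond
    InSecond? x = ℕₚ.anyUpTo? (λ d → (gcd d r ≟ 1) ×-dec ℕₚ.anyUpTo? (λ j →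
      ℕₚ.allUpTo? (λ k → at x k ≟ d * (k + j) % r) r ×-dec ℕₚ.anyUpTo? (λ i → d * i % r ≟ m) j) (suc r)) r

    Missing? : Decidable (_∉ S)
    Missing? x = ¬? (x ∈? S)

    Missing₁? : Decidable (λ x → x ∉ S × ¬ InSecond x)
    Missing₁? x = Missing? x ×-dec ¬? (InSecond? x)

    Missing₂? : Decidable (λ x → x ∉ S × InSecond x)
    Missing₂? x = Missing? x ×-dec InSecond? x

    -- Each d contributes a vertex of its own second walk, from which d can be read off as the
    -- slope.
    totient≤ : totient r ≤ # Missing₂?
    totient≤ = length-≤ R (Uniqueₚ.filter⁺ coprime? (Uniqueₚ.map⁺ ℕₚ.suc-injective (Uniqueₚ.upTo⁺ r)))
      (λ d∈ → let (d∈′ , gcd≡1) = Memₚ.∈-filter⁻ coprime? {xs = map suc (upTo r)} d∈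
                  (d-1 , d-1∈ , eq) = Memₚ.∈-map⁻ suc d∈′
              in related (subst (_≤ r) (sym eq) (Memₚ.∈-upTo⁻ d-1∈)) gcd≡1)
      (λ {d} {e} {x} (d<r , i , p) (e<r , j , q) → IsAffine-unique d e i j x d<r e<r p q)
      where
      coprime? : Decidable (λ d → gcd d r ≡ 1)
      coprime? d = gcd d r ≟ 1
      R : ℕ → Perm → Set
      R d x = d < r × ∃[ j ] IsAffine d j x
      related : ∀ {d} → d ≤ r → gcd d r ≡ 1 → ∃[ x ] (x ∈ filter Missing₂? elems × R d x)
      related {d} d≤r gcd≡1 =
        let (j , i₀<j , j≤r , ∉S) = meets-second
        in rotate j affine , ∈-# Missing₂? (∉S , d , d<r , gcd≡1 , j , s≤s j≤r , is-affine j , i₀ , i₀<j , d*i₀)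
           , d<r , j , is-affine j
        where
        open Affine d gcd≡1
        d<r : d < r
        -- d = r is not coprime to r, as r is at least 2.
        d<r = ℕₚ.≤∧≢⇒< d≤r λ d≡r → ℕₚ.<⇒≱ (s≤s 1≤m)
          (∣⇒≤ (subst (r ∣_) gcd≡1 (gcd-greatest (subst (r ∣_) (sym d≡r) ∣-refl) ∣-refl)))
        is-affine : ∀ j → IsAffine d j (rotate j affine)
        is-affine j {k} _ = trans (at-rotate j affine k) (at-affine (k + j))

    -- The whole orbit is a closed walk and leaves S. If it does so on a second walk, it is the
    -- orbit of some `affine`, whose first walk leaves S as well.
    orbit-meets : ∀ a → ∃[ c ] ∃[ x ] (c ∈ upTo r × (x ∉ S × ¬ InSecond x) × rotate c x ≡ a)
    orbit-meets a with closed-meets a 0 m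
      (subst (rotate m a ⟶_) (trans (rotate-r a) (sym (rotate-0 a))) (rotate-⟶ m a))
    ... | k , _ , ∉S with InSecond? (rotate k a)
    ...   | no ¬second =
      let (c , c<r , eq) = rotate-inverse k a in c , rotate k a , Memₚ.∈-upTo⁺ c<r , (∉S , ¬second) , eq
    ...   | yes (d , d<r , gcd≡1 , j , _ , p , _) =
      let (i , 1≤i , i≤i₀ , ∉S′) = meets-first
          (e , _ , back) = rotate-inverse j affine
          x≡ = trans (sym (rotate-rotate i (e + k) a)) (cong (rotate i)
                 (trans (sym (rotate-rotate e k a)) (trans (cong (rotate e) x₀≡) back)))
          (c , c<r , eq) = rotate-inverse (i + (e + k)) a
      in c , rotate i affine , Memₚ.∈-upTo⁺ c<r , (∉S′ , not-second 1≤i i≤i₀) ,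
         trans (cong (rotate c) (sym x≡)) eq
      where
      open Affine d gcd≡1
      x₀≡ : rotate k a ≡ rotate j affine
      x₀≡ = at-≡ λ {l} l<r → trans (p l<r) (trans (sym (at-affine (l + j))) (sym (at-rotate j affine l)))
      not-second : ∀ {i} → 1 ≤ i → i ≤ i₀ → ¬ InSecond (rotate i affine)
      not-second {i} 1≤i i≤i₀ (e , e<r , _ , j , s≤s j≤r , q , i′ , i′<j , d*i′)
        with IsAffine-unique d e i j (rotate i affine) d<r e<r (λ {k} _ → trans (at-rotate i affine k) (at-affine (k + i))) q
      ... | refl = ℕₚ.<⇒≱ (subst₂ _<_ i′≡i₀ (sym i≡j) i′<j) i≤i₀
        where
        i<r : i < r
        i<r = ℕₚ.≤-<-trans i≤i₀ i₀<r
        i′≡i₀ : i′ ≡ i₀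
        i′≡i₀ = *-injective-% (ℕₚ.<-≤-trans i′<j j≤r) i₀<r (trans d*i′ (sym d*i₀))
        same : d * i % r ≡ d * j % r
        same = trans (sym (at-affine i)) (trans (sym (at-rotate i affine 0)) (q z<s))
        i≡j : i ≡ j
        i≡j with ℕₚ.m≤n⇒m<n∨m≡n j≤r
        ... | inj₁ j<r  = *-injective-% i<r j<r same
        -- j = r names the rotation by 0, which cannot agree with the rotation by i since 1 ≤ i < r.
        ... | inj₂ refl = contradiction
          (*-injective-% i<r z<s (trans same (trans (m*n%n≡0 d r) (sym (cong (_% r) (ℕₚ.*-zeroʳ d))))))
          (λ i≡0 → ℕₚ.<⇒≢ 1≤i (sym i≡0))

    m!≤ : m ! ≤ # Missing₁?
    m!≤ = ℕₚ.*-cancelˡ-≤ r (begin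
      r * m !              ≡⟨ length-arrangements r ⟨
      length elems         ≤⟨ unique-⊆ unique (λ {x} _ → ∈-# all? {x} tt) ⟩
      # all?               ≤⟨ #-image all? Missing₁? (upTo r) rotate (λ {x} _ → orbit-meets x) ⟩
      length (upTo r) * # Missing₁? ≡⟨ cong (_* # Missing₁?) (Listₚ.length-upTo r) ⟩
      r * # Missing₁?      ∎)
      where
      open ℕₚ.≤-Reasoning
      all? : Decidable (λ (_ : Perm) → ⊤)
      all? _ = yes tt

    acyclic-size : Unique S → length S + (m ! + totient r) ≤ r !
    acyclic-size u = begin
      length S + (m ! + totient r)               ≤⟨ ℕₚ.+-mono-≤ (unique-⊆ u (∈-# (_∈? S))) (ℕₚ.+-mono-≤ m!≤ totient≤) ⟩
      # (_∈? S) + (# Missing₁? + # Missing₂?)    ≤⟨ ℕₚ.+-monoʳ-≤ (# (_∈? S)) split ⟩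
      # (_∈? S) + # Missing?                     ≡⟨ #-∁ (_∈? S) ⟩
      size                                       ≡⟨ length-arrangements r ⟩
      r !                                        ∎
      where
      open ℕₚ.≤-Reasoning
      split : # Missing₁? + # Missing₂? ≤ # Missing?
      split = #-+ Missing₁? Missing₂? Missing? proj₁ proj₁ (λ (_ , ¬second) (_ , second) → ¬second second)

-- Swaps of two entries

transpose : ℕ → ℕ → ℕ → ℕ
transpose x y i with i ≟ x | i ≟ y
... | yes _ | _     = y
... | no  _ | yes _ = x
... | no  _ | no  _ = i

transpose-left : ∀ x y → transpose x y x ≡ y
transpose-left x y with x ≟ x
... | yes _  = refl
... | no x≢x = contradiction refl x≢x

transpose-right : ∀ x y → transpose x y y ≡ x
transpose-right x y with y ≟ x | y ≟ y
... | yes y≡x | _      = y≡x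
... | no  _   | yes _  = refl
... | no  _   | no y≢y = contradiction refl y≢y

transpose-other : ∀ {x y i} → i ≢ x → i ≢ y → transpose x y i ≡ i
transpose-other {x} {y} {i} i≢x i≢y with i ≟ x | i ≟ y
... | yes i≡x | _       = contradiction i≡x i≢x
... | no  _   | yes i≡y = contradiction i≡y i≢y
... | no  _   | no  _   = refl

transpose-involutive : ∀ x y i → transpose x y (transpose x y i) ≡ i
transpose-involutive x y i = byCases (i ≟ x) (i ≟ y)
  where
  byCases : Dec (i ≡ x) → Dec (i ≡ y) → transpose x y (transpose x y i) ≡ i
  byCases (yes refl) _          = trans (cong (transpose x y) (transpose-left x y)) (transpose-right x y)
  byCases (no _)     (yes refl) = trans (cong (transpose x y) (transpose-right x y)) (transpose-left x y)
  byCases (no i≢x)   (no i≢y)   = trans (cong (transpose x y) (transpose-other i≢x i≢y)) (transpose-other i≢x i≢y)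

transpose-< : ∀ {n x y i} → x < n → y < n → i < n → transpose x y i < n
transpose-< {x = x} {y} {i} x<n y<n i<n with i ≟ x | i ≟ y
... | yes _ | _     = y<n
... | no  _ | yes _ = x<n
... | no  _ | no  _ = i<n

module Swapping (m : ℕ) where
  open Cyclic m

  private
    transpose-injective-% : ∀ {x y i j} → x < r → y < r → i < r → j < r →
      transpose x y i % r ≡ transpose x y j % r → i ≡ j
    transpose-injective-% {x} {y} {i} {j} x<r y<r i<r j<r eq = trans (sym (transpose-involutive x y i))
      (trans (cong (transpose x y) (subst₂ _≡_ (m<n⇒m%n≡m (transpose-< x<r y<r i<r))
        (m<n⇒m%n≡m (transpose-< x<r y<r j<r)) eq)) (transpose-involutive x y j))

  opaque
    -- The identity unless both positions are less than r.
    swap : ℕ → ℕ → Perm → Perm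
    swap x y a with x <? r | y <? r
    ... | yes x<r | yes y<r = rearrange (transpose x y) (transpose-injective-% x<r y<r) a
    ... | _       | _       = a

    at-swap : ∀ {x y} a {i} → x < r → y < r → i < r → at (swap x y a) i ≡ at a (transpose x y i)
    at-swap {x} {y} a {i} x<r y<r i<r with x <? r | y <? r
    ... | yes p | yes q = trans (at-rearrange (transpose x y) (transpose-injective-% p q) a i)
                            (cong (at a ∘ transpose x y) (m<n⇒m%n≡m i<r))
    ... | no ¬p | _     = contradiction x<r ¬p
    ... | yes _ | no ¬q = contradiction y<r ¬q

  module _ {x y} (x<r : x < r) (y<r : y < r) (a : Perm) where

    at-swap-left : at (swap x y a) x ≡ at a y
    at-swap-left = trans (at-swap a x<r y<r x<r) (cong (at a) (transpose-left x y))

    at-swap-right : at (swap x y a) y ≡ at a x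
    at-swap-right = trans (at-swap a x<r y<r y<r) (cong (at a) (transpose-right x y))

    at-swap-other : ∀ {i} → i < r → i ≢ x → i ≢ y → at (swap x y a) i ≡ at a i
    at-swap-other i<r i≢x i≢y = trans (at-swap a x<r y<r i<r) (cong (at a) (transpose-other i≢x i≢y))

    swap-involutive : swap x y (swap x y a) ≡ a
    swap-involutive = at-≡ λ {i} i<r → trans (at-swap (swap x y a) x<r y<r i<r)
      (trans (at-swap a x<r y<r (transpose-< x<r y<r i<r)) (cong (at a) (transpose-involutive x y i)))

  ascends : Perm → ℕ → ℕ → Bool
  ascends a i j = does (at a i <? at a j)

  ascends-cong : ∀ {a b i j k l} → at a i ≡ at b k → at a j ≡ at b l → ascends a i j ≡ ascends b k l
  ascends-cong p q = cong₂ (λ u v → does (u <? v)) p q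

  ascends-flip : ∀ a {i j} → i < r → j < r → i ≢ j → ascends a i j ≢ ascends a j i
  ascends-flip a {i} {j} i<r j<r i≢j eq with ℕₚ.<-cmp (at a i) (at a j)
  ... | tri< p _ ¬q = contradiction
    (trans (sym (dec-true (at a i <? at a j) p)) (trans eq (dec-false (at a j <? at a i) ¬q))) λ ()
  ... | tri≈ _ e _  = i≢j (at-injective-< a i<r j<r e)
  ... | tri> ¬p _ q = contradiction
    (trans (sym (dec-false (at a i <? at a j) ¬p)) (trans eq (dec-true (at a j <? at a i) q))) λ ()

  module Comparisons (n : ℕ) (x y : ℕ → ℕ)
    (x<r : ∀ {t} → t < n → x t < r) (y<r : ∀ {t} → t < n → y t < r)
    (x≢y : ∀ {s t} → s < n → t < n → x s ≢ y t)
    (x-injective : ∀ {s t} → x s ≡ x t → s ≡ t) (y-injective : ∀ {s t} → y s ≡ y t → s ≡ t)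
    (c : Perm → ℕ → Bool) (c-swap : ∀ {s t} a → s < n → t < n → c (swap (x t) (y t) a) s ≡ c a s) where

    Prescribed? : Decidable (λ a → ∀ {t} → t < n → ¬ (ascends a (x t) (y t) ≢ c a t))
    Prescribed? a = ℕₚ.allUpTo? (λ t → ¬? (¬? (ascends a (x t) (y t) Bool.≟ c a t))) n

    -- The pairs are disjoint, so swapping one pair reverses its comparison and leaves the others
    -- and the prescription alone; every comparison halves the count. The prescription `c` may vary
    -- with the permutation, as long as these swaps preserve it.
    #-prescribed : # Prescribed? * 2 ^ n ≤ size
    #-prescribed = subst (# Prescribed? * 2 ^ n ≤_) (trans (cong (_* size) (ℕₚ.^-zeroˡ n)) (ℕₚ.*-identityˡ size))
      (#-avoid {O = λ t a → ascends a (x t) (y t) ≢ c a t}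
        (λ t a → ¬? (ascends a (x t) (y t) Bool.≟ c a t)) (tt ∷ []) (λ t _ → swap (x t) (y t)) n step)
      where
      step : ∀ {t a} → t < n → ¬ (ascends a (x t) (y t) ≢ c a t) →
        ∃[ u ] ∃[ b ] (u ∈ tt ∷ [] × ascends b (x t) (y t) ≢ c b t × swap (x t) (y t) b ≡ a ×
          (∀ {s} → s < t → ascends b (x s) (y s) ≢ c b s → ascends a (x s) (y s) ≢ c a s))
      step {t} {a} t<n as = tt , b , here refl , changed , swap-involutive (x<r t<n) (y<r t<n) a , earlier
        where
        b : Perm
        b = swap (x t) (y t) a
        changed : ascends b (x t) (y t) ≢ c b t
        changed eq = as λ eq′ → ascends-flip a (x<r t<n) (y<r t<n) (x≢y t<n t<n)
          (trans eq′ (trans (sym (c-swap a t<n t<n)) (trans (sym eq)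
            (ascends-cong {b} {a} (at-swap-left (x<r t<n) (y<r t<n) a) (at-swap-right (x<r t<n) (y<r t<n) a)))))
        earlier : ∀ {s} → s < t → ascends b (x s) (y s) ≢ c b s → ascends a (x s) (y s) ≢ c a s
        earlier {s} s<t ne eq = ne (trans
          (ascends-cong {b} {a}
            (at-swap-other (x<r t<n) (y<r t<n) a (x<r s<n) (λ e → ℕₚ.<⇒≢ s<t (x-injective e)) (x≢y s<n t<n))
            (at-swap-other (x<r t<n) (y<r t<n) a (y<r s<n) (λ e → x≢y t<n s<n (sym e)) (λ e → ℕₚ.<⇒≢ s<t (y-injective e))))
          (trans eq (sym (c-swap a s<n t<n))))
          where
          s<n : s < n
          s<n = ℕₚ.<-trans s<t t<n

-- Markers

code : (ℕ → Bool) → ℕ → ℕ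
code b zero    = 0
code b (suc k) = (if b k then 2 ^ k else 0) + code b k

code-cong : ∀ {b c} k → (∀ {t} → t < k → b t ≡ c t) → code b k ≡ code c k
code-cong zero    eq = refl
code-cong (suc k) eq = cong₂ (λ x y → (if x then 2 ^ k else 0) + y) (eq (ℕₚ.n<1+n k))
  (code-cong k (λ t<k → eq (ℕₚ.m<n⇒m<1+n t<k)))

code< : ∀ b k → code b k < 2 ^ k
code< b zero    = s≤s z≤n
code< b (suc k) with b k
... | true  = ℕₚ.+-monoʳ-< (2 ^ k) (subst (code b k <_) (sym (ℕₚ.+-identityʳ (2 ^ k))) (code< b k))
... | false = ℕₚ.<-≤-trans (code< b k) (ℕₚ.m≤m+n (2 ^ k) _)

code-injective : ∀ {b c} k → code b k ≡ code c k → ∀ {t} → t < k → b t ≡ c t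
code-injective {b} {c} (suc k) eq {t} (s≤s t≤k) with b k in bk | c k in ck
... | true  | false = contradiction (ℕₚ.≤-trans (ℕₚ.m≤m+n (2 ^ k) _) (ℕₚ.≤-reflexive eq)) (ℕₚ.<⇒≱ (code< c k))
... | false | true  = contradiction (ℕₚ.≤-trans (ℕₚ.m≤m+n (2 ^ k) _) (ℕₚ.≤-reflexive (sym eq))) (ℕₚ.<⇒≱ (code< b k))
... | true  | true  with ℕₚ.m≤n⇒m<n∨m≡n t≤k
...   | inj₁ t<k  = code-injective k (ℕₚ.+-cancelˡ-≡ (2 ^ k) _ _ eq) t<k
...   | inj₂ refl = trans bk (sym ck)
code-injective {b} {c} (suc k) eq {t} (s≤s t≤k) | false | false with ℕₚ.m≤n⇒m<n∨m≡n t≤k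
...   | inj₁ t<k  = code-injective k eq t<k
...   | inj₂ refl = trans bk (sym ck)

double-injective : ∀ {s t} → s + s ≡ t + t → s ≡ t
double-injective {s} {t} eq with ℕₚ.<-cmp s t
... | tri< s<t _ _ = contradiction eq (ℕₚ.<⇒≢ (ℕₚ.+-mono-< s<t s<t))
... | tri≈ _ s≡t _ = s≡t
... | tri> _ _ t<s = contradiction (sym eq) (ℕₚ.<⇒≢ (ℕₚ.+-mono-< t<s t<s))

even≢odd : ∀ s t → s + s ≢ suc (t + t)
even≢odd (suc s) zero    eq = contradiction (trans (sym (ℕₚ.+-suc s s)) (ℕₚ.suc-injective eq)) λ ()
even≢odd (suc s) (suc t) eq = even≢odd s t (ℕₚ.suc-injective (ℕₚ.suc-injective
  (trans (cong suc (sym (ℕₚ.+-suc s s))) (trans eq (cong (suc ∘ suc) (ℕₚ.+-suc t t))))))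

-- A marker at i is a window of w = 4 + 2k entries of the form  f g x₁ … x₂ₖ p q
-- with f > p > g > xⱼ > q.  Its key records the comparisons of x₂ⱼ₋₁ with x₂ⱼ.
module Markers (m k : ℕ) where
  open Cyclic m
  open Swapping m

  n w : ℕ
  n = k + k
  w = 4 + n

  record Marker (a : Perm) (i : ℕ) : Set where
    constructor marker
    field
      p<f : at a (i + (2 + n)) < at a (i + 0)
      g<p : at a (i + 1) < at a (i + (2 + n))
      x<g : ∀ {t} → t < n → at a (i + (2 + t)) < at a (i + 1)
      q<x : ∀ {t} → t < n → at a (i + (3 + n)) < at a (i + (2 + t))

  Marker? : ∀ a i → Dec (Marker a i)
  Marker? a i = map′ to from
    ((at a (i + (2 + n)) <? at a (i + 0)) ×-dec (at a (i + 1) <? at a (i + (2 + n)))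
      ×-dec ℕₚ.allUpTo? (λ t → at a (i + (2 + t)) <? at a (i + 1)) n
      ×-dec ℕₚ.allUpTo? (λ t → at a (i + (3 + n)) <? at a (i + (2 + t))) n)
    where
    Conditions : Set
    Conditions = at a (i + (2 + n)) < at a (i + 0) × at a (i + 1) < at a (i + (2 + n))
      × (∀ {t} → t < n → at a (i + (2 + t)) < at a (i + 1))
      × (∀ {t} → t < n → at a (i + (3 + n)) < at a (i + (2 + t)))
    to : Conditions → Marker a i
    to (c₁ , c₂ , c₃ , c₄) = marker c₁ c₂ c₃ c₄
    from : Marker a i → Conditions
    from (marker c₁ c₂ c₃ c₄) = c₁ , c₂ , c₃ , c₄

  key : Perm → ℕ → ℕ
  key a i = code (λ t → ascends a (i + (2 + (t + t))) (i + (3 + (t + t)))) k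

  Embeds : Perm → ℕ → Perm → ℕ → Set
  Embeds a i b j = ∀ {s t} → s < w → t < w → at a (i + s) < at a (i + t) → at b (j + s) < at b (j + t)

  t+t<n : ∀ {t} → t < k → t + t < n
  t+t<n t<k = ℕₚ.+-mono-< t<k t<k

  1+t+t<n : ∀ {t} → t < k → suc (t + t) < n
  1+t+t<n {t} t<k = ℕₚ.≤-trans (ℕₚ.≤-reflexive (cong suc (sym (ℕₚ.+-suc t t)))) (ℕₚ.+-mono-≤ t<k t<k)

  p<w : 2 + n < w
  p<w = ℕₚ.m≤n⇒m≤1+n ℕₚ.≤-refl

  x<w : ∀ {t} → t < n → 2 + t < w
  x<w t<n = s≤s (s≤s (ℕₚ.m≤n⇒m≤1+n (ℕₚ.m≤n⇒m≤1+n t<n)))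

  Marker-embeds : ∀ {a i b j} → Embeds a i b j → Marker a i → Marker b j
  Marker-embeds e (marker c₁ c₂ c₃ c₄) = marker
    (e p<w z<s c₁) (e (s<s z<s) p<w c₂) (λ t<n → e (x<w t<n) (s<s z<s) (c₃ t<n)) (λ t<n → e (ℕₚ.n<1+n _) (x<w t<n) (c₄ t<n))

  key-embeds : ∀ {a i b j} → Embeds a i b j → Embeds b j a i → key a i ≡ key b j
  key-embeds e e′ = code-cong k λ t<k →
    does-⇔ (mk⇔ (e (x<w (t+t<n t<k)) (x<w (1+t+t<n t<k))) (e′ (x<w (t+t<n t<k)) (x<w (1+t+t<n t<k)))) (_ <? _) (_ <? _)

  Agree : Perm → ℕ → Perm → ℕ → Set
  Agree a i b j = ∀ {t} → t < w → at a (i + t) ≡ at b (j + t)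

  agree⇒embeds : ∀ {a i b j} → Agree a i b j → Embeds a i b j
  agree⇒embeds eq s<w t<w = subst₂ _<_ (eq s<w) (eq t<w)

  low : ∀ {a i s} → Marker a i → 1 ≤ s → s ≤ 1 + n → at a (i + s) < at a (i + (2 + n))
  low {s = 1}           c _ _           = Marker.g<p c
  low {s = suc (suc t)} c _ (s≤s t<n) = ℕₚ.<-trans (Marker.x<g c t<n) (Marker.g<p c)

  -- At these distances the f of the second marker lies strictly between the f and the p of the
  -- first, hence is below that p; but that p lies strictly inside the second marker, hence is below
  -- its f.
  separated : ∀ {a i d} → Marker a i → Marker a (i + d) → 1 ≤ d → ¬ d ≤ 1 + n
  separated {a} {i} {d} c c′ 1≤d d≤1+n = ℕₚ.<-asym (low c 1≤d d≤1+n)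
    (subst₂ _<_ (cong (at a) p≡) (cong (at a) (ℕₚ.+-identityʳ (i + d)))
      (ℕₚ.<-trans (low c′ (ℕₚ.m<n⇒0<n∸m (s≤s d≤1+n)) (ℕₚ.≤-trans (ℕₚ.∸-monoʳ-≤ (2 + n) 1≤d) ℕₚ.≤-refl)) (Marker.p<f c′)))
    where
    p≡ : i + d + (2 + n ∸ d) ≡ i + (2 + n)
    p≡ = trans (ℕₚ.+-assoc i d _) (cong (_+_ i) (ℕₚ.m+[n∸m]≡n (ℕₚ.m≤n⇒m≤1+n d≤1+n)))

  -- If two markers overlap, the second begins with the p q or with the q of the first: then
  -- q separates all the x of the first from those of the second.
  overlap-descends : ∀ {a d} → d ≡ 2 + n ⊎ d ≡ 3 + n → Marker a 0 → Marker a d →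
    ∀ {t} → t < n → at a (d + (2 + t)) < at a (2 + t)
  overlap-descends {a} (inj₁ refl) c c′ {t} t<n = ℕₚ.<-trans (Marker.x<g c′ t<n)
    (subst (λ i → at a i < at a (2 + t)) (sym (ℕₚ.+-comm (2 + n) 1)) (Marker.q<x c t<n))
  overlap-descends {a} (inj₂ refl) c c′ {t} t<n = ℕₚ.<-trans
    (ℕₚ.<-trans (ℕₚ.<-trans (Marker.x<g c′ t<n) (Marker.g<p c′)) (Marker.p<f c′))
    (subst (λ i → at a i < at a (2 + t)) (sym (ℕₚ.+-identityʳ (3 + n))) (Marker.q<x c t<n))

  Overlap? : ∀ d → Decidable (λ a → Marker a 0 × Marker a d)
  Overlap? d a = Marker? a 0 ×-dec Marker? a d

  -- An overlap forces all n comparisons of `overlap-descends`, which concern disjoint pairs of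
  -- positions.
  #-overlap : ∀ {d} → d ≡ 2 + n ⊎ d ≡ 3 + n → d + w ≤ r → # (Overlap? d) * 2 ^ n ≤ size
  #-overlap {d} eq d+w≤r = ℕₚ.≤-trans
    (ℕₚ.*-monoˡ-≤ (2 ^ n) (#-mono (Overlap? d) Prescribed? λ {a} (c , c′) t<n ne →
      ne (dec-false (at a _ <? at a _) (ℕₚ.<⇒≯ (overlap-descends eq c c′ t<n)))))
    #-prescribed
    where
    2+n≤d : 2 + n ≤ d
    2+n≤d = [ (λ { refl → ℕₚ.≤-refl }) , (λ { refl → ℕₚ.n≤1+n _ }) ]′ eq
    open Comparisons n (λ t → 2 + t) (λ t → d + (2 + t))
      (λ t<n → ℕₚ.<-≤-trans (x<w t<n) (ℕₚ.≤-trans (ℕₚ.m≤n+m w d) d+w≤r))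
      (λ t<n → ℕₚ.<-≤-trans (ℕₚ.+-monoʳ-< d (x<w t<n)) d+w≤r)
      (λ {s} {t} s<n t<n → ℕₚ.<⇒≢ (ℕₚ.<-≤-trans (s≤s (s≤s s<n)) (ℕₚ.≤-trans 2+n≤d (ℕₚ.m≤m+n d (2 + t)))))
      (λ e → ℕₚ.+-cancelˡ-≡ 2 _ _ e) (λ e → ℕₚ.+-cancelˡ-≡ 2 _ _ (ℕₚ.+-cancelˡ-≡ d _ _ e))
      (λ _ _ → false) (λ _ _ _ → refl)

  Tie? : ∀ p → Decidable (λ a → Marker a 0 × Marker a p × key a p ≡ key a 0)
  Tie? p a = Marker? a 0 ×-dec Marker? a p ×-dec (key a p ≟ key a 0)

  -- The key at 0 prescribes the k comparisons behind the key at p. Since the windows are disjoint,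
  -- swaps inside the second do not alter the prescription.
  #-tie : ∀ {p} → w ≤ p → p + w ≤ r → # (Tie? p) * 2 ^ k ≤ size
  #-tie {p} w≤p p+w≤r = ℕₚ.≤-trans
    (ℕₚ.*-monoˡ-≤ (2 ^ k) (#-mono (Tie? p) Prescribed? λ {a} (_ , _ , eq) t<k ne →
      ne (code-injective {λ t → ascends a (p + (2 + (t + t))) (p + (3 + (t + t)))} {bit a} k eq t<k)))
    #-prescribed
    where
    bit : Perm → ℕ → Bool
    bit a t = ascends a (2 + (t + t)) (3 + (t + t))
    x<r : ∀ {t} → t < k → p + (2 + (t + t)) < r
    x<r t<k = ℕₚ.<-≤-trans (ℕₚ.+-monoʳ-< p (x<w (t+t<n t<k))) p+w≤r
    y<r : ∀ {t} → t < k → p + (3 + (t + t)) < r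
    y<r t<k = ℕₚ.<-≤-trans (ℕₚ.+-monoʳ-< p (x<w (1+t+t<n t<k))) p+w≤r
    before : ∀ {i} j → i < w → i ≢ p + j
    before j i<w = ℕₚ.<⇒≢ (ℕₚ.<-≤-trans i<w (ℕₚ.≤-trans w≤p (ℕₚ.m≤m+n p j)))
    w≤r : w ≤ r
    w≤r = ℕₚ.≤-trans (ℕₚ.m≤n+m w p) p+w≤r
    unaffected : ∀ a {i t} → t < k → i < w → at (swap (p + (2 + (t + t))) (p + (3 + (t + t))) a) i ≡ at a i
    unaffected a {i} {t} t<k i<w = at-swap-other (x<r t<k) (y<r t<k) a (ℕₚ.<-≤-trans i<w w≤r)
      (before (2 + (t + t)) i<w) (before (3 + (t + t)) i<w)
    open Comparisons k (λ t → p + (2 + (t + t))) (λ t → p + (3 + (t + t))) x<r y<r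
      (λ {s} {t} _ _ e → even≢odd s t (ℕₚ.+-cancelˡ-≡ 2 _ _ (ℕₚ.+-cancelˡ-≡ p _ _ e)))
      (λ e → double-injective (ℕₚ.+-cancelˡ-≡ 2 _ _ (ℕₚ.+-cancelˡ-≡ p _ _ e)))
      (λ e → double-injective (ℕₚ.+-cancelˡ-≡ 3 _ _ (ℕₚ.+-cancelˡ-≡ p _ _ e)))
      bit
      (λ {s} {t} a s<k t<k → ascends-cong {swap (p + (2 + (t + t))) (p + (3 + (t + t))) a} {a}
        (unaffected a t<k (x<w (t+t<n s<k))) (unaffected a t<k (x<w (1+t+t<n s<k))))

-- Creating markers by swaps

module _ {_≼_ : ℕ → ℕ → Set} (total : ∀ x y → x ≼ y ⊎ y ≼ x) (≼-trans : ∀ {x y z} → x ≼ y → y ≼ z → x ≼ z) where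

  extremum : ∀ (v : ℕ → ℕ) {D : ℕ → Set} (D? : Decidable D) {w e} → e < w → D e →
    ∃[ c ] (c < w × D c × (∀ {t} → t < w → D t → v t ≼ v c))
  extremum v {D} D? {w} {e} e<w De = go w ℕₚ.≤-refl
    where
    go : ∀ b → b ≤ w → ∃[ c ] (c < w × D c × (∀ {t} → t < b → D t → v t ≼ v c))
    go zero    _   = e , e<w , De , λ ()
    go (suc b) b<w with go b (ℕₚ.<⇒≤ b<w) | D? b
    ... | c , c<w , Dc , best | no ¬Db = c , c<w , Dc , λ t<1+b Dt →
      [ (λ t<b → best t<b Dt) , (λ { refl → contradiction Dt ¬Db }) ]′ (ℕₚ.m≤n⇒m<n∨m≡n (ℕₚ.≤-pred t<1+b))
    ... | c , c<w , Dc , best | yes Db with total (v b) (v c)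
    ...   | inj₁ b≼c = c , c<w , Dc , λ t<1+b Dt →
      [ (λ t<b → best t<b Dt) , (λ { refl → b≼c }) ]′ (ℕₚ.m≤n⇒m<n∨m≡n (ℕₚ.≤-pred t<1+b))
    ...   | inj₂ c≼b = b , b<w , Db , λ t<1+b Dt →
      [ (λ t<b → ≼-trans (best t<b Dt) c≼b) , (λ { refl → [ id , id ]′ (total (v b) (v b)) }) ]′ (ℕₚ.m≤n⇒m<n∨m≡n (ℕₚ.≤-pred t<1+b))

  module Promotion (m w i : ℕ) (i+w≤r : i + w ≤ suc m) where
    open Cyclic m
    open Swapping m

    position< : ∀ {t} → t < w → i + t < r
    position< t<w = ℕₚ.<-≤-trans (ℕₚ.+-monoʳ-< i t<w) i+w≤r

    -- One swap brings the extreme entry among the positions in D to position e, and the offset `c`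
    -- is all that is needed to undo it. Entries at D only change places among themselves
    -- (`within`), so bounds on them from earlier promotions persist.
    record Promoted (a : Perm) (D : ℕ → Set) (e : ℕ) : Set where
      field
        c         : ℕ
        c<w       : c < w
        result    : Perm
        restore   : swap (i + e) (i + c) result ≡ a
        extremal  : ∀ {t} → t < w → D t → at result (i + t) ≼ at result (i + e)
        elsewhere   : ∀ {t} → t < w → ¬ D t → at result (i + t) ≡ at a (i + t)
        within    : ∀ {t} → t < w → D t → ∃[ u ] (u < w × D u × at result (i + t) ≡ at a (i + u))
        untouched : ∀ {j} → j < i → at result j ≡ at a j

    promote : ∀ a {D : ℕ → Set} (D? : Decidable D) {e} → e < w → D e → Promoted a D e
    promote a {D} D? {e} e<w De = record
      { c = c ; c<w = c<w ; result = a′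
      ; restore = swap-involutive (position< e<w) (position< c<w) a
      ; extremal = λ t<w Dt → let (u , u<w , Du , eq) = within t<w Dt in
          subst₂ _≼_ (sym eq) (sym (at-swap-left (position< e<w) (position< c<w) a)) (best u<w Du)
      ; elsewhere = λ t<w ¬Dt → at-swap-other (position< e<w) (position< c<w) a (position< t<w)
          (λ eq → ¬Dt (subst D (sym (ℕₚ.+-cancelˡ-≡ i _ _ eq)) De))
          (λ eq → ¬Dt (subst D (sym (ℕₚ.+-cancelˡ-≡ i _ _ eq)) Dc))
      ; within = within
      ; untouched = λ j<i → at-swap-other (position< e<w) (position< c<w) a
          (ℕₚ.<-≤-trans j<i (ℕₚ.≤-trans (ℕₚ.m≤m+n i w) i+w≤r))
          (ℕₚ.<⇒≢ (ℕₚ.<-≤-trans j<i (ℕₚ.m≤m+n i e))) (ℕₚ.<⇒≢ (ℕₚ.<-≤-trans j<i (ℕₚ.m≤m+n i c)))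
      }
      where
      found : ∃[ c ] (c < w × D c × (∀ {t} → t < w → D t → at a (i + t) ≼ at a (i + c)))
      found = extremum (λ t → at a (i + t)) D? e<w De
      c : ℕ
      c = proj₁ found
      c<w : c < w
      c<w = proj₁ (proj₂ found)
      Dc : D c
      Dc = proj₁ (proj₂ (proj₂ found))
      best : ∀ {t} → t < w → D t → at a (i + t) ≼ at a (i + c)
      best = proj₂ (proj₂ (proj₂ found))
      a′ : Perm
      a′ = swap (i + e) (i + c) a
      within : ∀ {t} → t < w → D t → ∃[ u ] (u < w × D u × at a′ (i + t) ≡ at a (i + u))
      within {t} t<w Dt with t ≟ e | t ≟ c
      ... | yes refl | _        = c , c<w , Dc , at-swap-left (position< e<w) (position< c<w) a
      ... | no _     | yes refl = e , e<w , De , at-swap-right (position< e<w) (position< c<w) a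
      ... | no t≢e   | no t≢c   = t , t<w , Dt , at-swap-other (position< e<w) (position< c<w) a (position< t<w)
        (λ eq → t≢e (ℕₚ.+-cancelˡ-≡ i _ _ eq)) (λ eq → t≢c (ℕₚ.+-cancelˡ-≡ i _ _ eq))

module MarkerFree (m k : ℕ) where
  open Cyclic m
  open Swapping m
  open Markers m k

  Code : Set
  Code = (ℕ × ℕ) × (ℕ × ℕ)

  opaque
    codes : List Code
    codes = cartesianProduct (cartesianProduct (upTo w) (upTo w)) (cartesianProduct (upTo w) (upTo w))

    length-codes : length codes ≡ w * w * (w * w)
    length-codes = trans
      (length-cartesianProductWith _,_ (cartesianProduct (upTo w) (upTo w)) (cartesianProduct (upTo w) (upTo w)))
      (cong₂ _*_ pairs pairs)
      where
      pairs : length (cartesianProduct (upTo w) (upTo w)) ≡ w * w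
      pairs = trans (length-cartesianProductWith _,_ (upTo w) (upTo w))
        (cong₂ _*_ (Listₚ.length-upTo w) (Listₚ.length-upTo w))

    ∈-codes : ∀ {c₁ c₂ c₃ c₄} → c₁ < w → c₂ < w → c₃ < w → c₄ < w → ((c₁ , c₂) , (c₃ , c₄)) ∈ codes
    ∈-codes p₁ p₂ p₃ p₄ = Memₚ.∈-cartesianProduct⁺
      (Memₚ.∈-cartesianProduct⁺ (Memₚ.∈-upTo⁺ p₁) (Memₚ.∈-upTo⁺ p₂))
      (Memₚ.∈-cartesianProduct⁺ (Memₚ.∈-upTo⁺ p₃) (Memₚ.∈-upTo⁺ p₄))

  undo : ℕ → Code → Perm → Perm
  undo i ((c₁ , c₂) , (c₃ , c₄)) =
    swap (i + 0) (i + c₁) ∘ swap (i + (2 + n)) (i + c₂) ∘ swap (i + 1) (i + c₃) ∘ swap (i + (3 + n)) (i + c₄)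

  -- Four promotions in the window put the largest entry at f, the next at p, the next at g and the
  -- smallest of the rest at q. The four offsets recover `a`, hence w ^ 4 codes.
  create-marker : ∀ {i} a → i + w ≤ r →
    ∃[ c ] ∃[ b ] (c ∈ codes × Marker b i × undo i c b ≡ a × (∀ {j} → j < i → at b j ≡ at a j))
  create-marker {i} a i+w≤r =
    ((s₁.c , s₂.c) , (s₃.c , s₄.c)) , y ,
    ∈-codes s₁.c<w s₂.c<w s₃.c<w s₄.c<w ,
    marker (strict (λ ()) p<w z<s p≤f) (strict (λ ()) (s<s z<s) p<w g≤p)
      (λ t<n → strict (λ ()) (x<w t<n) (s<s z<s) (x≤g t<n))
      (λ t<n → strict (q≢x t<n) (ℕₚ.n<1+n _) (x<w t<n) (q≤x t<n)) ,
    trans (cong (swap (i + 0) (i + s₁.c)) (trans (cong (swap (i + (2 + n)) (i + s₂.c))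
      (trans (cong (swap (i + 1) (i + s₃.c)) s₄.restore) s₃.restore)) s₂.restore)) s₁.restore ,
    λ j<i → trans (s₄.untouched j<i) (trans (s₃.untouched j<i) (trans (s₂.untouched j<i) (s₁.untouched j<i)))
    where
    module Largest = Promotion {_≤_} ℕₚ.≤-total ℕₚ.≤-trans m w i i+w≤r
    module Smallest = Promotion {λ x y → y ≤ x} (λ x y → ℕₚ.≤-total y x) (λ y≤x z≤y → ℕₚ.≤-trans z≤y y≤x) m w i i+w≤r
    -- The positions of the window that are still open before each promotion.
    D₁ D₂ D₃ D₄ : ℕ → Set
    D₁ t = ⊤
    D₂ t = t ≢ 0
    D₃ t = t ≢ 0 × t ≢ 2 + n
    D₄ t = t ≢ 0 × t ≢ 2 + n × t ≢ 1
    module s₁ = Largest.Promoted (Largest.promote a {D₁} (λ _ → yes tt) {0} z<s tt)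
    module s₂ = Largest.Promoted (Largest.promote s₁.result {D₂} (λ t → ¬? (t ≟ 0)) {2 + n} p<w λ ())
    module s₃ = Largest.Promoted (Largest.promote s₂.result {D₃} (λ t → ¬? (t ≟ 0) ×-dec ¬? (t ≟ 2 + n)) {1} (s<s z<s)
      ((λ ()) , λ ()))
    module s₄ = Smallest.Promoted (Smallest.promote s₃.result {D₄}
      (λ t → ¬? (t ≟ 0) ×-dec ¬? (t ≟ 2 + n) ×-dec ¬? (t ≟ 1)) {3 + n} (ℕₚ.n<1+n _) ((λ ()) , ℕₚ.1+n≢n , λ ()))
    y : Perm
    y = s₄.result
    strict : ∀ {s t} → s ≢ t → s < w → t < w → at y (i + s) ≤ at y (i + t) → at y (i + s) < at y (i + t)
    strict s≢t s<w t<w le = ℕₚ.≤∧≢⇒< le λ eq →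
      s≢t (ℕₚ.+-cancelˡ-≡ i _ _ (at-injective-< y (Largest.position< s<w) (Largest.position< t<w) eq))
    p₂ : at y (i + (2 + n)) ≡ at s₂.result (i + (2 + n))
    p₂ = trans (s₄.elsewhere p<w (λ (_ , ≢p , _) → ≢p refl)) (s₃.elsewhere p<w (λ (_ , ≢p) → ≢p refl))
    g₃ : at y (i + 1) ≡ at s₃.result (i + 1)
    g₃ = s₄.elsewhere (s<s z<s) (λ (_ , _ , ≢g) → ≢g refl)
    f₁ : at y (i + 0) ≡ at s₁.result (i + 0)
    f₁ = trans (s₄.elsewhere z<s (λ (≢f , _) → ≢f refl)) (trans (s₃.elsewhere z<s (λ (≢f , _) → ≢f refl))
           (s₂.elsewhere z<s (λ ≢f → ≢f refl)))
    p≤f : at y (i + (2 + n)) ≤ at y (i + 0)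
    p≤f = let (u , u<w , _ , eq) = s₂.within p<w (λ ()) in
      subst₂ _≤_ (sym (trans p₂ eq)) (sym f₁) (s₁.extremal u<w tt)
    g≤p : at y (i + 1) ≤ at y (i + (2 + n))
    g≤p = let (u , u<w , (≢f , _) , eq) = s₃.within (s<s z<s) ((λ ()) , λ ()) in
      subst₂ _≤_ (sym (trans g₃ eq)) (sym p₂) (s₂.extremal u<w ≢f)
    x∈D₄ : ∀ {t} → t < n → D₄ (2 + t)
    x∈D₄ t<n = (λ ()) , (λ eq → ℕₚ.<⇒≢ t<n (ℕₚ.+-cancelˡ-≡ 2 _ _ eq)) , λ ()
    x≤g : ∀ {t} → t < n → at y (i + (2 + t)) ≤ at y (i + 1)
    x≤g t<n = let (u , u<w , (≢f , ≢p , _) , eq) = s₄.within (x<w t<n) (x∈D₄ t<n) in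
      subst₂ _≤_ (sym eq) (sym g₃) (s₃.extremal u<w (≢f , ≢p))
    q≤x : ∀ {t} → t < n → at y (i + (3 + n)) ≤ at y (i + (2 + t))
    q≤x t<n = s₄.extremal (x<w t<n) (x∈D₄ t<n)
    q≢x : ∀ {t} → t < n → 3 + n ≢ 2 + t
    q≢x t<n eq = ℕₚ.<⇒≢ (ℕₚ.m<n⇒m<1+n t<n) (sym (ℕₚ.+-cancelˡ-≡ 2 _ _ eq))

  NoMarker? : ∀ B → Decidable (λ a → ∀ {t} → t < B → ¬ Marker a (t * w))
  NoMarker? B a = ℕₚ.allUpTo? (λ t → ¬? (Marker? a (t * w))) B

  -- Markers are sought in B disjoint blocks. Creating one in a block leaves the earlier blocks
  -- unchanged, so each block multiplies the count by at most K / (K + 1) with K = w ^ 4.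
  #-noMarker : ∀ B → B * w ≤ r →
    # (NoMarker? B) * suc (w * w * (w * w)) ^ B ≤ (w * w * (w * w)) ^ B * size
  #-noMarker B Bw≤r = subst (λ K → # (NoMarker? B) * suc K ^ B ≤ K ^ B * size) length-codes
    (#-avoid (λ t a → Marker? a (t * w)) codes (λ t → undo (t * w)) B λ {t} {a} t<B _ →
      let (c , b , c∈ , marked , eq , same) = create-marker {t * w} a (block t<B)
      in c , b , c∈ , marked , eq , λ {s} s<t → Marker-embeds (agree⇒embeds λ u<w → same (before s<t u<w)))
    where
    block : ∀ {t} → t < B → t * w + w ≤ r
    block {t} t<B = ℕₚ.≤-trans (ℕₚ.≤-reflexive (ℕₚ.+-comm (t * w) w)) (ℕₚ.≤-trans (ℕₚ.*-monoˡ-≤ w t<B) Bw≤r)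
    before : ∀ {s t u} → s < t → u < w → s * w + u < t * w
    before {s} {t} {u} s<t u<w = ℕₚ.<-≤-trans (ℕₚ.+-monoʳ-< (s * w) u<w)
      (ℕₚ.≤-trans (ℕₚ.≤-reflexive (ℕₚ.+-comm (s * w) w)) (ℕₚ.*-monoˡ-≤ w s<t))

-- The acyclic set of good permutations

module GoodPermutations (m k : ℕ) where
  open Cyclic m
  open Markers m k
  open MarkerFree m k

  -- A window that starts with a marker may be left only if a marker with a larger key is in sight.
  GoodAt : Perm → ℕ → Set
  GoodAt a p = 1 ≤ p × p + w ≤ r × Marker a p × (Marker a 0 → key a 0 < key a p)

  Good : Perm → Set
  Good a = ∃[ p ] (p < r × GoodAt a p)

  Good? : Decidable Good
  Good? a = ℕₚ.anyUpTo? (λ p → (1 ≤? p) ×-dec (p + w ≤? r) ×-dec Marker? a p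
    ×-dec (Marker? a 0 →-dec (key a 0 <? key a p))) r

  shift-embeds : ∀ {a b p} → a ⟶ b → suc p + w ≤ r → Embeds a (suc p) b p
  shift-embeds {a} {b} {p} e p+w≤r s<w t<w = edge⁻ a b e (inside< s<w) (inside< t<w)
    where
    inside< : ∀ {s} → s < w → p + s < m
    inside< s<w = ℕₚ.<-≤-trans (ℕₚ.+-monoʳ-< p s<w) (ℕₚ.≤-pred p+w≤r)

  shift-embeds′ : ∀ {a b p} → a ⟶ b → suc p + w ≤ r → Embeds b p a (suc p)
  shift-embeds′ {a} {b} {p} e p+w≤r s<w t<w = edge⁻′ a b e (inside< s<w) (inside< t<w)
    where
    inside< : ∀ {s} → s < w → p + s < m
    inside< s<w = ℕₚ.<-≤-trans (ℕₚ.+-monoʳ-< p s<w) (ℕₚ.≤-pred p+w≤r)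

  good : List Perm
  good = filter Good? elems

  good-coreless : ¬ Core good
  good-coreless c =
    let (p , _ , _ , p+w≤r , mk , _) = isGood start∈
        (y , y∈ , mk′ , _) = follow start∈ p+w≤r mk
    in climb (2 ^ k) y∈ mk′ (ℕₚ.m≤n+m (2 ^ k) _)
    where
    open Core c
    isGood : ∀ {x} → x ∈ members → Good x
    isGood x∈ = proj₂ (Memₚ.∈-filter⁻ Good? {xs = elems} (members⊆ x∈))
    -- Every edge moves a marker one place to the front with its key unchanged, so p steps inside
    -- the core bring it to position 0.
    follow : ∀ {p x} → x ∈ members → p + w ≤ r → Marker x p →
      ∃[ y ] (y ∈ members × Marker y 0 × key y 0 ≡ key x p)
    follow {zero}  x∈ _     mk = _ , x∈ , mk , refl
    follow {suc p} {x} x∈ p+w≤r mk =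
      let (x′ , x′∈ , e) = successor x∈
          (y , y∈ , mk′ , eq) = follow x′∈ (ℕₚ.<⇒≤ p+w≤r) (Marker-embeds (shift-embeds e p+w≤r) mk)
      in y , y∈ , mk′ , trans eq (key-embeds (shift-embeds′ e p+w≤r) (shift-embeds e p+w≤r))
    -- The number b bounds the room left below 2 ^ k, and each round raises the key of the front
    -- marker by at least 1.
    climb : ∀ b {x} → x ∈ members → Marker x 0 → ¬ 2 ^ k ≤ key x 0 + b
    climb zero    {x} x∈ mk bound =
      ℕₚ.<⇒≱ (code< _ k) (ℕₚ.≤-trans bound (ℕₚ.≤-reflexive (ℕₚ.+-identityʳ (key x 0))))
    climb (suc b) {x} x∈ mk bound =
      let (p , _ , _ , p+w≤r , mkp , larger) = isGood x∈
          (y , y∈ , mky , eq) = follow x∈ p+w≤r mkp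
      in climb b y∈ mky (ℕₚ.≤-trans bound (ℕₚ.≤-trans (ℕₚ.≤-reflexive (ℕₚ.+-suc (key x 0) b))
           (ℕₚ.+-monoˡ-≤ b (subst (key x 0 <_) (sym eq) (larger mk)))))

  rotate-agree : ∀ d a i → Agree (rotate d a) i a (d + i)
  rotate-agree d a i {t} _ = trans (at-rotate d a (i + t))
    (cong (at a) (trans (ℕₚ.+-comm (i + t) d) (sym (ℕₚ.+-assoc d i t))))

  agree-sym : ∀ {a i b j} → Agree a i b j → Agree b j a i
  agree-sym eq t<w = sym (eq t<w)

  agree⇒key : ∀ {a i b j} → Agree a i b j → key a i ≡ key b j
  agree⇒key eq = key-embeds (agree⇒embeds eq) (agree⇒embeds (agree-sym eq))

  -- Here p runs over the whole circle, windows across the end included; this makes the comparison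
  -- one within the rotation orbit.
  Champion : Perm → Set
  Champion a = Marker a 0 × (∀ {p} → p < r → 1 ≤ p → Marker a p → key a p < key a 0)

  Champion? : Decidable Champion
  Champion? a = Marker? a 0 ×-dec
    ℕₚ.allUpTo? (λ p → (1 ≤? p) →-dec Marker? a p →-dec (key a p <? key a 0)) r

  -- Each of the two front markers occurs in the other permutation too, so each key would exceed the
  -- other.
  champion-unique : ∀ {a d} → Champion a → Champion (rotate d a) → d < r → ¬ 1 ≤ d
  champion-unique {a} {d} (mk , best) (mk′ , best′) d<r 1≤d = ℕₚ.<-asym
    (subst (_< key a 0) (sym (agree⇒key forth)) (best d<r 1≤d (Marker-embeds (agree⇒embeds forth) mk′)))
    (subst (_< key (rotate d a) 0) (sym (agree⇒key back))
      (best′ (s≤s (ℕₚ.∸-monoʳ-≤ {1} {d} r 1≤d)) (ℕₚ.m<n⇒0<n∸m d<r) (Marker-embeds (agree⇒embeds back) mk)))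
    where
    forth : Agree (rotate d a) 0 a d
    forth {t} t<w = trans (rotate-agree d a 0 t<w) (cong (λ i → at a (i + t)) (ℕₚ.+-identityʳ d))
    back : Agree a 0 (rotate d a) (r ∸ d)
    back {t} t<w = sym (trans (rotate-agree d a (r ∸ d) t<w)
      (at-cong a (d + (r ∸ d) + t) t (trans (cong (_% r) (trans (cong (_+ t) (ℕₚ.m+[n∸m]≡n (ℕₚ.<⇒≤ d<r))) (ℕₚ.+-comm r t)))
        ([m+n]%n≡m%n t r))))

  #-champion : # Champion? * r ≤ size
  #-champion = subst (λ l → # Champion? * l ≤ size) (Listₚ.length-upTo r)
    (#-inject Champion? (λ a d → rotate d a) (Uniqueₚ.upTo⁺ r) λ {a} {b} {c} {d} A B c∈ d∈ eq →
      equal A B (Memₚ.∈-upTo⁻ c∈) (Memₚ.∈-upTo⁻ d∈) eq)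
    where
    cancel : ∀ {a b c d} → c ≤ d → d < r → rotate c a ≡ rotate d b → a ≡ rotate (d ∸ c) b
    cancel {a} {b} {c} {d} c≤d d<r eq = at-≡ λ {i} _ → trans (sym (undo-c i))
      (trans (cong (λ x → at x (i + (r ∸ c))) eq) (trans (at-rotate d b _) (trans
        (at-cong b _ (i + (d ∸ c)) (trans (cong (_% r) (arith i)) ([m+n]%n≡m%n (i + (d ∸ c)) r)))
        (sym (at-rotate (d ∸ c) b i)))))
      where
      c≤r : c ≤ r
      c≤r = ℕₚ.<⇒≤ (ℕₚ.≤-<-trans c≤d d<r)
      undo-c : ∀ i → at (rotate c a) (i + (r ∸ c)) ≡ at a i
      undo-c i = trans (at-rotate c a _) (at-cong a _ i (trans
        (cong (_% r) (trans (ℕₚ.+-assoc i (r ∸ c) c) (cong (_+_ i) (ℕₚ.m∸n+n≡m c≤r)))) ([m+n]%n≡m%n i r)))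
      arith : ∀ i → i + (r ∸ c) + d ≡ i + (d ∸ c) + r
      arith i = begin
        i + (r ∸ c) + d                 ≡⟨ cong (_+_ (i + (r ∸ c))) (ℕₚ.m∸n+n≡m c≤d) ⟨
        i + (r ∸ c) + (d ∸ c + c)       ≡⟨ solve 4 (λ i x y c → i :+ x :+ (y :+ c) := i :+ y :+ (x :+ c)) refl i (r ∸ c) (d ∸ c) c ⟩
        i + (d ∸ c) + (r ∸ c + c)       ≡⟨ cong (_+_ (i + (d ∸ c))) (ℕₚ.m∸n+n≡m c≤r) ⟩
        i + (d ∸ c) + r                 ∎
        where
        open ≡.≡-Reasoning
        open +-*-Solver
    ordered : ∀ {a b c d} → Champion a → Champion b → c ≤ d → d < r → rotate c a ≡ rotate d b → a ≡ b × c ≡ d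
    ordered {a} {b} {c} {d} A B c≤d d<r eq with ℕₚ.m≤n⇒m<n∨m≡n c≤d
    ... | inj₂ refl = trans (cancel c≤d d<r eq) (trans (cong (λ e → rotate e b) (ℕₚ.n∸n≡0 c)) (rotate-0 b)) , refl
    ... | inj₁ c<d  = contradiction (ℕₚ.m<n⇒0<n∸m c<d)
      (champion-unique {b} {d ∸ c} B (subst Champion (cancel c≤d d<r eq) A) (ℕₚ.≤-<-trans (ℕₚ.m∸n≤m d c) d<r))
    equal : ∀ {a b c d} → Champion a → Champion b → c < r → d < r → rotate c a ≡ rotate d b → a ≡ b × c ≡ d
    equal {c = c} {d} A B c<r d<r eq with ℕₚ.≤-total c d
    ... | inj₁ c≤d = ordered A B c≤d d<r eq
    ... | inj₂ d≤c = let (b≡a , d≡c) = ordered B A d≤c c<r (sym eq) in sym b≡a , sym d≡c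

  Wrap? : ∀ d → Decidable (λ a → Marker a 0 × Marker a (r ∸ d))
  Wrap? d a = Marker? a 0 ×-dec Marker? a (r ∸ d)

  -- The rotation by r - d takes the marker at r - d to 0 and the one at 0 to d.
  #-wrap : ∀ d → d ≤ r → # (Wrap? d) ≤ # (Overlap? d)
  #-wrap d d≤r = subst (# (Wrap? d) ≤_) (ℕₚ.*-identityˡ _)
    (#-image (Wrap? d) (Overlap? d) (tt ∷ []) (λ _ → rotate d) λ {a} (mk , mk′) →
      tt , rotate (r ∸ d) a , here refl ,
      (Marker-embeds (agree⇒embeds λ {t} t<w → sym (trans (rotate-agree (r ∸ d) a 0 t<w)
          (cong (λ i → at a (i + t)) (ℕₚ.+-identityʳ (r ∸ d))))) mk′
      , Marker-embeds (agree⇒embeds λ {t} t<w → sym (trans (rotate-agree (r ∸ d) a d t<w)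
          (trans (cong (λ i → at a (i + t)) (ℕₚ.m∸n+n≡m d≤r))
            (at-cong a (r + t) t (trans (cong (_% r) (ℕₚ.+-comm r t)) ([m+n]%n≡m%n t r)))))) mk) ,
      trans (rotate-rotate d (r ∸ d) a) (trans (cong (λ e → rotate e a) (ℕₚ.m+[n∸m]≡n d≤r)) (rotate-r a)))

  AnyTie? : Decidable (λ a → ∃[ p ] (p < r × w ≤ p × p + w ≤ r × Marker a 0 × Marker a p × key a p ≡ key a 0))
  AnyTie? a = ℕₚ.anyUpTo? (λ p → (w ≤? p) ×-dec (p + w ≤? r) ×-dec Tie? p a) r

  -- Suppose there is a marker at 0. A marker that fits into the list has no larger key, since the
  -- permutation is bad, and an equal key is a tie or an overlap. A marker that runs past the end
  -- overlaps the one at 0 across the end. If none of this happens, the marker at 0 has the unique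
  -- largest key.
  bad-cases : ∀ {B a} → B * w ≤ r → w ≤ r → ¬ Good a →
    (∀ {t} → t < B → ¬ Marker a (t * w)) ⊎
    (((Marker a 0 × Marker a (2 + n)) ⊎ (Marker a 0 × Marker a (3 + n))) ⊎
     ((Marker a 0 × Marker a (r ∸ (2 + n))) ⊎ (Marker a 0 × Marker a (r ∸ (3 + n))))) ⊎
    (∃[ p ] (p < r × w ≤ p × p + w ≤ r × Marker a 0 × Marker a p × key a p ≡ key a 0)) ⊎
    Champion a
  bad-cases {B} {a} Bw≤r w≤r bad with Marker? a 0
  ... | no ¬mk = inj₁ λ t<B mk′ → absent _ t<B mk′
    where
    -- Without a marker at 0 the demand for a larger key is void, so any marker in a later block
    -- would make the permutation good.
    absent : ∀ t → t < B → ¬ Marker a (t * w)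
    absent zero    _   mk′ = ¬mk mk′
    absent (suc t) t<B mk′ =
      let fits = ℕₚ.≤-trans (ℕₚ.≤-reflexive (ℕₚ.+-comm (suc t * w) w)) (ℕₚ.≤-trans (ℕₚ.*-monoˡ-≤ w t<B) Bw≤r)
      in bad (suc t * w , ℕₚ.<-≤-trans (ℕₚ.m<m+n (suc t * w) z<s) fits , s≤s z≤n , fits , mk′ , λ mk → contradiction mk ¬mk)
  ... | yes mk with Overlap? (2 + n) a | Overlap? (3 + n) a | Wrap? (2 + n) a | Wrap? (3 + n) a | AnyTie? a
  ...   | yes o | _     | _     | _     | _     = inj₂ (inj₁ (inj₁ (inj₁ o)))
  ...   | no _  | yes o | _     | _     | _     = inj₂ (inj₁ (inj₁ (inj₂ o)))
  ...   | no _  | no _  | yes o | _     | _     = inj₂ (inj₁ (inj₂ (inj₁ o)))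
  ...   | no _  | no _  | no _  | yes o | _     = inj₂ (inj₁ (inj₂ (inj₂ o)))
  ...   | no _  | no _  | no _  | no _  | yes t = inj₂ (inj₂ (inj₁ t))
  ...   | no o₂ | no o₃ | no v₂ | no v₃ | no ¬t = inj₂ (inj₂ (inj₂ (mk , best)))
    where
    -- With the short distances excluded by `separated` and the two overlaps by assumption, the next
    -- distance is 4 + n = w.
    far : ∀ {d} → 1 ≤ d → (∀ {e} → e ≡ 2 + n ⊎ e ≡ 3 + n → d ≢ e) → ¬ d ≤ 1 + n → w ≤ d
    far {d} 1≤d d≢ d≰ = ℕₚ.≤∧≢⇒< (ℕₚ.≤∧≢⇒< (ℕₚ.≰⇒> d≰) (λ e → d≢ (inj₁ refl) (sym e))) (λ e → d≢ (inj₂ refl) (sym e))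
    best : ∀ {p} → p < r → 1 ≤ p → Marker a p → key a p < key a 0
    best {p} p<r 1≤p mkp with p + w ≤? r
    ... | yes fits = ℕₚ.≤∧≢⇒< (ℕₚ.≮⇒≥ λ larger → bad (p , p<r , 1≤p , fits , mkp , λ _ → larger))
      λ tie → ¬t (p , p<r , far 1≤p (λ { (inj₁ refl) refl → o₂ (mk , mkp) ; (inj₂ refl) refl → o₃ (mk , mkp) })
        (separated mk mkp 1≤p) , fits , mk , mkp , tie)
    -- Around the circle the marker at 0 follows this one at distance r - p < w, which `far`
    -- forbids.
    ... | no ¬fits = contradiction
      (far (ℕₚ.m<n⇒0<n∸m p<r)
        (λ { (inj₁ refl) e → v₂ (mk , subst (Marker a) (sym (restore e)) mkp)
           ; (inj₂ refl) e → v₃ (mk , subst (Marker a) (sym (restore e)) mkp) })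
        (separated mkp (Marker-embeds (agree⇒embeds wrapped) mk) (ℕₚ.m<n⇒0<n∸m p<r)))
      (λ w≤ → ¬fits (ℕₚ.≤-trans (ℕₚ.+-monoʳ-≤ p w≤) (ℕₚ.≤-reflexive (ℕₚ.m+[n∸m]≡n (ℕₚ.<⇒≤ p<r)))))
      where
      restore : ∀ {d} → r ∸ p ≡ d → r ∸ d ≡ p
      restore refl = ℕₚ.m∸[m∸n]≡n (ℕₚ.<⇒≤ p<r)
      wrapped : Agree a 0 a (p + (r ∸ p))
      wrapped {t} _ = sym (trans (cong (λ i → at a (i + t)) (ℕₚ.m+[n∸m]≡n (ℕₚ.<⇒≤ p<r)))
        (at-cong a (r + t) t (trans (cong (_% r) (ℕₚ.+-comm r t)) ([m+n]%n≡m%n t r))))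

-- The union bound times r ^ 2: champions make up at most the fraction 1 / r, and each of the six
-- exceptional cases at most 1 / r ^ 2.
sum-of-cases : ∀ r s g b x₀ x₁ x₂ x₃ x₄ x₅ x₆ → g + b ≡ s → b ≤ x₀ + (x₁ + x₂ + (x₃ + x₄) + (x₅ + x₆)) →
  r * r * x₀ ≤ s → r * r * x₁ ≤ s → r * r * x₂ ≤ s → r * r * x₃ ≤ s → r * r * x₄ ≤ s → r * r * x₅ ≤ s → x₆ * r ≤ s →
  r * r * s ≤ r * r * g + (r * s + 6 * s)
sum-of-cases r s g b x₀ x₁ x₂ x₃ x₄ x₅ x₆ refl b≤ h₀ h₁ h₂ h₃ h₄ h₅ h₆ = begin
  r * r * (g + b)                       ≡⟨ ℕₚ.*-distribˡ-+ (r * r) g b ⟩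
  r * r * g + r * r * b                 ≤⟨ ℕₚ.+-monoʳ-≤ (r * r * g) (ℕₚ.*-monoʳ-≤ (r * r) b≤) ⟩
  r * r * g + r * r * (x₀ + (x₁ + x₂ + (x₃ + x₄) + (x₅ + x₆)))
    ≡⟨ cong (_+_ (r * r * g)) (solve 8 (λ r a b c d e f g →
         r :* r :* (a :+ (b :+ c :+ (d :+ e) :+ (f :+ g))) :=
         r :* (g :* r) :+ (r :* r :* a :+ (r :* r :* b :+ (r :* r :* c :+ (r :* r :* d :+ (r :* r :* e :+ r :* r :* f))))))
         refl r x₀ x₁ x₂ x₃ x₄ x₅ x₆) ⟩
  r * r * g + (r * (x₆ * r) + (r * r * x₀ + (r * r * x₁ + (r * r * x₂ + (r * r * x₃ + (r * r * x₄ + r * r * x₅))))))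
    ≤⟨ ℕₚ.+-monoʳ-≤ (r * r * g) (ℕₚ.+-mono-≤ (ℕₚ.*-monoʳ-≤ r h₆)
         (ℕₚ.+-mono-≤ h₀ (ℕₚ.+-mono-≤ h₁ (ℕₚ.+-mono-≤ h₂ (ℕₚ.+-mono-≤ h₃ (ℕₚ.+-mono-≤ h₄ h₅)))))) ⟩
  r * r * g + (r * s + (s + (s + (s + (s + (s + s))))))
    ≡⟨ cong (λ t → r * r * g + (r * s + t)) (solve 1 (λ s → s :+ (s :+ (s :+ (s :+ (s :+ s)))) := con 6 :* s) refl s) ⟩
  r * r * g + (r * s + 6 * s)           ∎
  where
  open ℕₚ.≤-Reasoning
  open +-*-Solver

module LargeAcyclic (m k B : ℕ) where
  open Cyclic m
  open Markers m k
  open MarkerFree m k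
  open GoodPermutations m k

  K : ℕ
  K = w * w * (w * w)

  module _ (Bw≤r : B * w ≤ r) (w+w≤r : w + w ≤ r) (r³≤ : r * r * r ≤ 2 ^ k) (r²≤ : r * r * K ^ B ≤ suc K ^ B) where
    private
      w≤r : w ≤ r
      w≤r = ℕₚ.≤-trans (ℕₚ.m≤m+n w w) w+w≤r

      scale : ∀ {x d} → r * r ≤ d → x * d ≤ size → r * r * x ≤ size
      scale {x} r²≤d xd≤ = ℕₚ.≤-trans (ℕₚ.≤-reflexive (ℕₚ.*-comm (r * r) x)) (ℕₚ.≤-trans (ℕₚ.*-monoʳ-≤ x r²≤d) xd≤)

      r²≤2ⁿ : r * r ≤ 2 ^ n
      r²≤2ⁿ = ℕₚ.≤-trans (ℕₚ.m≤m*n (r * r) r) (ℕₚ.≤-trans r³≤ (ℕₚ.^-monoʳ-≤ 2 (ℕₚ.m≤m+n k k)))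

      fits : ∀ {d} → d ≡ 2 + n ⊎ d ≡ 3 + n → d + w ≤ r
      fits (inj₁ refl) = ℕₚ.≤-trans (ℕₚ.+-monoˡ-≤ w (ℕₚ.m≤n+m (2 + n) 2)) w+w≤r
      fits (inj₂ refl) = ℕₚ.≤-trans (ℕₚ.+-monoˡ-≤ w (ℕₚ.m≤n+m (3 + n) 1)) w+w≤r

      overlap≤ : ∀ {d} → d ≡ 2 + n ⊎ d ≡ 3 + n → r * r * # (Overlap? d) ≤ size
      overlap≤ eq = scale r²≤2ⁿ (#-overlap eq (fits eq))

      wrap≤ : ∀ {d} → d ≡ 2 + n ⊎ d ≡ 3 + n → r * r * # (Wrap? d) ≤ size
      wrap≤ {d} eq = ℕₚ.≤-trans (ℕₚ.*-monoʳ-≤ (r * r) (#-wrap d (ℕₚ.≤-trans (ℕₚ.m≤m+n d w) (fits eq)))) (overlap≤ eq)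

      noMarker≤ : r * r * # (NoMarker? B) ≤ size
      noMarker≤ = ℕₚ.*-cancelˡ-≤ (K ^ B) {{ℕₚ.m^n≢0 K B}} (begin
        K ^ B * (r * r * x)      ≡⟨ solve 3 (λ p q x → p :* (q :* x) := x :* (q :* p)) refl (K ^ B) (r * r) x ⟩
        x * (r * r * K ^ B)      ≤⟨ ℕₚ.*-monoʳ-≤ x r²≤ ⟩
        x * suc K ^ B            ≤⟨ #-noMarker B Bw≤r ⟩
        K ^ B * size             ∎)
        where
        open ℕₚ.≤-Reasoning
        open +-*-Solver
        x : ℕ
        x = # (NoMarker? B)

      instance
        2^k≢0 : NonZero (2 ^ k)
        2^k≢0 = ℕₚ.m^n≢0 2 k

      -- The r possible positions of the second marker use up one of the three factors in r ^ 3 ≤ 2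
      -- ^ k.
      tie≤ : r * r * # AnyTie? ≤ size
      tie≤ = begin
        r * r * # AnyTie?     ≤⟨ ℕₚ.*-monoʳ-≤ (r * r)
                                   (#-⋃ AnyTie? TieAt? r (size / 2 ^ k) (λ (p , p<r , tie) → p , p<r , tie) (λ _ → bound)) ⟩
        r * r * (r * (size / 2 ^ k)) ≡⟨ ℕₚ.*-assoc (r * r) r _ ⟨
        r * r * r * (size / 2 ^ k) ≤⟨ ℕₚ.*-monoˡ-≤ (size / 2 ^ k) r³≤ ⟩
        2 ^ k * (size / 2 ^ k) ≡⟨ ℕₚ.*-comm (2 ^ k) _ ⟩
        size / 2 ^ k * 2 ^ k  ≤⟨ m/n*n≤m size (2 ^ k) ⟩
        size                  ∎
        where
        open ℕₚ.≤-Reasoning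
        TieAt : ℕ → Perm → Set
        TieAt p a = w ≤ p × p + w ≤ r × Marker a 0 × Marker a p × key a p ≡ key a 0
        TieAt? : ∀ p → Decidable (TieAt p)
        TieAt? p a = (w ≤? p) ×-dec (p + w ≤? r) ×-dec Tie? p a
        bound : ∀ {p} → # (TieAt? p) ≤ size / 2 ^ k
        bound {p} = byCases (w ≤? p) (p + w ≤? r)
          where
          none : (∀ {a} → ¬ TieAt p a) → # (TieAt? p) ≤ size / 2 ^ k
          none ¬tie = ℕₚ.≤-trans (#-image (TieAt? p) (TieAt? p) [] (λ (_ : ⊤) a → a) (λ tie → contradiction tie ¬tie)) z≤n
          byCases : Dec (w ≤ p) → Dec (p + w ≤ r) → # (TieAt? p) ≤ size / 2 ^ k
          byCases (yes w≤p) (yes p+w≤r) = ℕₚ.≤-trans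
            (#-mono (TieAt? p) (Tie? p) (λ (_ , _ , tie) → tie))
            (subst (_≤ size / 2 ^ k) (m*n/n≡m (# (Tie? p)) (2 ^ k)) (/-monoˡ-≤ (2 ^ k) (#-tie w≤p p+w≤r)))
          byCases (no w≰p) _          = none λ (w≤p , _) → w≰p w≤p
          byCases (yes _)  (no p+w≰r) = none λ (_ , p+w≤r , _) → p+w≰r p+w≤r

      bad≤ : # (¬? ∘ Good?) ≤ # (NoMarker? B) + (# (Overlap? (2 + n)) + # (Overlap? (3 + n))
             + (# (Wrap? (2 + n)) + # (Wrap? (3 + n))) + (# AnyTie? + # Champion?))
      bad≤ = ℕₚ.≤-trans (#-∪ (¬? ∘ Good?) (NoMarker? B) rest? (bad-cases Bw≤r w≤r)) (ℕₚ.+-monoʳ-≤ (# (NoMarker? B))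
        (ℕₚ.≤-trans (#-∪ rest? near? (λ a → AnyTie? a ⊎-dec Champion? a) id) (ℕₚ.+-mono-≤
          (ℕₚ.≤-trans (#-∪ near? overlap? wrap? id) (ℕₚ.+-mono-≤
            (#-∪ overlap? (Overlap? (2 + n)) (Overlap? (3 + n)) id)
            (#-∪ wrap? (Wrap? (2 + n)) (Wrap? (3 + n)) id)))
          (#-∪ (λ a → AnyTie? a ⊎-dec Champion? a) AnyTie? Champion? id))))
        where
        overlap? = λ a → Overlap? (2 + n) a ⊎-dec Overlap? (3 + n) a
        wrap? = λ a → Wrap? (2 + n) a ⊎-dec Wrap? (3 + n) a
        near? = λ a → overlap? a ⊎-dec wrap? a
        rest? = λ a → near? a ⊎-dec (AnyTie? a ⊎-dec Champion? a)

    good-size : r * r * r ! ≤ r * r * length good + (r * r ! + 6 * r !)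
    good-size = subst (λ s → r * r * s ≤ r * r * length good + (r * s + 6 * s)) (length-arrangements r)
      (sum-of-cases r size (length good) (# (¬? ∘ Good?)) (# (NoMarker? B)) (# (Overlap? (2 + n))) (# (Overlap? (3 + n)))
        (# (Wrap? (2 + n))) (# (Wrap? (3 + n))) (# AnyTie?) (# Champion?) (#-∁ Good?) bad≤
        noMarker≤ (overlap≤ (inj₁ refl)) (overlap≤ (inj₂ refl)) (wrap≤ (inj₁ refl)) (wrap≤ (inj₂ refl)) tie≤ #-champion)

-- Choice of the parameters

log₂ : ∀ r → 1 ≤ r → ∃[ l ] (r ≤ 2 ^ l × 2 ^ l ≤ 2 * r)
log₂ 1             _ = 0 , ℕₚ.≤-refl , s≤s z≤n
log₂ (suc r@(suc _)) _ with log₂ r (s≤s z≤n)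
... | l , r≤ , ≤2r with suc r ≤? 2 ^ l
...   | yes 1+r≤ = l , 1+r≤ , ℕₚ.≤-trans ≤2r (ℕₚ.*-monoʳ-≤ 2 (ℕₚ.n≤1+n r))
...   | no  1+r≰ = suc l , ℕₚ.≤-trans (ℕₚ.+-monoˡ-≤ r (s≤s z≤n))
                   (ℕₚ.≤-trans (ℕₚ.≤-reflexive (cong (_+_ r) (sym (ℕₚ.+-identityʳ r))))
                     (ℕₚ.*-monoʳ-≤ 2 r≤))
                 , ℕₚ.*-monoʳ-≤ 2 (ℕₚ.≤-trans (ℕₚ.≤-pred (ℕₚ.≰⇒> 1+r≰)) (ℕₚ.n≤1+n r))

-- Bernoulli's inequality 1 + i / K ≤ (1 + 1 / K) ^ i without denominators.
bernoulli : ∀ K i → K ^ i * (K + i) ≤ K * suc K ^ i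
bernoulli K zero    = ℕₚ.≤-reflexive (solve 1 (λ K → con 1 :* (K :+ con 0) := K :* con 1) refl K)
  where open +-*-Solver
bernoulli K (suc i) = begin
  K * K ^ i * (K + suc i)               ≤⟨ ℕₚ.m≤m+n _ (K ^ i * i) ⟩
  K * K ^ i * (K + suc i) + K ^ i * i
    ≡⟨ solve 3 (λ K p i → K :* p :* (K :+ (con 1 :+ i)) :+ p :* i := (con 1 :+ K) :* (p :* (K :+ i))) refl K (K ^ i) i ⟩
  suc K * (K ^ i * (K + i))             ≤⟨ ℕₚ.*-monoʳ-≤ (suc K) (bernoulli K i) ⟩
  suc K * (K * suc K ^ i)               ≡⟨ solve 2 (λ K p → (con 1 :+ K) :* (K :* p) := K :* ((con 1 :+ K) :* p)) refl K (suc K ^ i) ⟩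
  K * (suc K * suc K ^ i)               ∎
  where
  open ℕₚ.≤-Reasoning
  open +-*-Solver

2*K^K≤ : ∀ K .{{_ : NonZero K}} → 2 * K ^ K ≤ suc K ^ K
2*K^K≤ K = ℕₚ.*-cancelˡ-≤ K (ℕₚ.≤-trans
  (ℕₚ.≤-reflexive (solve 2 (λ K p → K :* (con 2 :* p) := p :* (K :+ K)) refl K (K ^ K))) (bernoulli K K))
  where open +-*-Solver

^-distribʳ-* : ∀ i x y → (x * y) ^ i ≡ x ^ i * y ^ i
^-distribʳ-* zero    x y = refl
^-distribʳ-* (suc i) x y = trans (cong (x * y *_) (^-distribʳ-* i x y))
  (solve 4 (λ x y p q → x :* y :* (p :* q) := x :* p :* (y :* q)) refl x y (x ^ i) (y ^ i))
  where open +-*-Solver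

-- The ratio (l + 1) / l decreases in l, so it suffices to check one p.
sixth-power-step : ∀ p l .{{_ : NonZero p}} → p ≤ l → suc p ^ 6 ≤ p ^ 6 * 2 → suc l ^ 6 ≤ 2 * l ^ 6
sixth-power-step p l p≤l small = ℕₚ.*-cancelˡ-≤ (p ^ 6) {{ℕₚ.m^n≢0 p 6}} (begin
  p ^ 6 * suc l ^ 6       ≡⟨ ^-distribʳ-* 6 p (suc l) ⟨
  (p * suc l) ^ 6         ≤⟨ ℕₚ.^-monoˡ-≤ 6 (ℕₚ.≤-trans (ℕₚ.≤-reflexive (ℕₚ.*-suc p l)) (ℕₚ.+-monoˡ-≤ (p * l) p≤l)) ⟩
  (suc p * l) ^ 6         ≡⟨ ^-distribʳ-* 6 (suc p) l ⟩
  suc p ^ 6 * l ^ 6       ≤⟨ ℕₚ.*-monoˡ-≤ (l ^ 6) small ⟩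
  p ^ 6 * 2 * l ^ 6       ≡⟨ ℕₚ.*-assoc (p ^ 6) 2 (l ^ 6) ⟩
  p ^ 6 * (2 * l ^ 6)     ∎)
  where open ℕₚ.≤-Reasoning

exponential-bound : ∀ c l e → 64 ≤ l → c * l ^ 6 ≤ 2 ^ e → ∀ j → c * (j + l) ^ 6 ≤ 2 ^ (j + e)
exponential-bound c l e 64≤l base zero    = base
exponential-bound c l e 64≤l base (suc j) = begin
  c * suc (j + l) ^ 6          ≤⟨ ℕₚ.*-monoʳ-≤ c (sixth-power-step 64 (j + l) (ℕₚ.≤-trans 64≤l (ℕₚ.m≤n+m l j))
                                   (toWitness {a? = 65 ^ 6 ≤? 64 ^ 6 * 2} _)) ⟩
  c * (2 * (j + l) ^ 6)        ≡⟨ solve 2 (λ c x → c :* (con 2 :* x) := con 2 :* (c :* x)) refl c ((j + l) ^ 6) ⟩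
  2 * (c * (j + l) ^ 6)        ≤⟨ ℕₚ.*-monoʳ-≤ 2 (exponential-bound c l e 64≤l base j) ⟩
  2 * 2 ^ (j + e)              ∎
  where
  open ℕₚ.≤-Reasoning
  open +-*-Solver

module _ (m : ℕ) where
  open Cyclic m

  large-acyclic : 2 ^ 64 ≤ r →
    ∃[ S ] (Unique S × ¬ Core S × r * r * r ! ≤ r * r * length S + (r * r ! + 6 * r !))
  large-acyclic 2^64≤r with log₂ r (s≤s z≤n)
  ... | l , r≤2^l , 2^l≤2r = good , Uniqueₚ.filter⁺ Good? unique , good-coreless , good-size Bw≤r w+w≤r r³≤ r²≤
    where
    k B : ℕ
    -- Then 2 ^ k is at least r ^ 3, and w = 4 + 6 l.
    k = l + l + l
    open Markers m k
    -- With K = w ^ 4, a group of K blocks avoids markers with probability at most (K / (K + 1)) ^ K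
    -- ≤ 1 / 2, and 2 l groups bring this down to 1 / r ^ 2.
    B = w * w * (w * w) * (l + l)
    open GoodPermutations m k
    open LargeAcyclic m k B
    open +-*-Solver
    64≤l : 64 ≤ l
    64≤l = ℕₚ.≮⇒≥ λ l<64 → ℕₚ.<⇒≱ (ℕₚ.^-monoʳ-< 2 (s≤s (s≤s z≤n)) l<64) (ℕₚ.≤-trans 2^64≤r r≤2^l)
    -- This makes room for B w = 2 l w ^ 5 with w ≤ 7 l. The exponent in the base case l = 64 is 63
    -- because `log₂` only gives r ≥ 2 ^ l / 2.
    l^6≤ : 2 * 7 ^ 5 * l ^ 6 ≤ r
    l^6≤ = ℕₚ.*-cancelˡ-≤ 2 (begin
      2 * (2 * 7 ^ 5 * l ^ 6)               ≡⟨ cong (λ x → 2 * (2 * 7 ^ 5 * x ^ 6)) (ℕₚ.m∸n+n≡m 64≤l) ⟨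
      2 * (2 * 7 ^ 5 * (l ∸ 64 + 64) ^ 6)   ≤⟨ ℕₚ.*-monoʳ-≤ 2 (exponential-bound (2 * 7 ^ 5) 64 63 ℕₚ.≤-refl
                                                 (toWitness {a? = 2 * 7 ^ 5 * 64 ^ 6 ≤? 2 ^ 63} _) (l ∸ 64)) ⟩
      2 * 2 ^ (l ∸ 64 + 63)                 ≡⟨ cong (2 ^_) (ℕₚ.+-suc (l ∸ 64) 63) ⟨
      2 ^ (l ∸ 64 + 64)                     ≡⟨ cong (2 ^_) (ℕₚ.m∸n+n≡m 64≤l) ⟩
      2 ^ l                                 ≤⟨ 2^l≤2r ⟩
      2 * r                                 ∎)
      where open ℕₚ.≤-Reasoning
    w≤7l : w ≤ 7 * l
    w≤7l = ℕₚ.≤-trans (ℕₚ.+-monoˡ-≤ n (ℕₚ.≤-trans (ℕₚ.m≤m+n 4 60) 64≤l))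
      (ℕₚ.≤-reflexive (solve 1 (λ l → l :+ (l :+ l :+ l :+ (l :+ l :+ l)) := con 7 :* l) refl l))
    fits : ∀ a → w ≤ a * l → 2 * a ^ 5 * l ^ 6 ≤ r → B * w ≤ r
    fits a w≤al small = begin
      w * w * (w * w) * (l + l) * w     ≡⟨ solve 2 (λ w l → w :* w :* (w :* w) :* (l :+ l) :* w := w :^ 5 :* (con 2 :* l)) refl w l ⟩
      w ^ 5 * (2 * l)                   ≤⟨ ℕₚ.*-monoˡ-≤ (2 * l) (ℕₚ.^-monoˡ-≤ 5 w≤al) ⟩
      (a * l) ^ 5 * (2 * l)             ≡⟨ solve 2 (λ a l → (a :* l) :^ 5 :* (con 2 :* l) := con 2 :* a :^ 5 :* l :^ 6) refl a l ⟩
      2 * a ^ 5 * l ^ 6                 ≤⟨ small ⟩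
      r                                 ∎
      where open ℕₚ.≤-Reasoning
    Bw≤r : B * w ≤ r
    Bw≤r = fits 7 w≤7l l^6≤
    w+w≤r : w + w ≤ r
    w+w≤r = ℕₚ.≤-trans (ℕₚ.≤-reflexive (cong (_+_ w) (sym (ℕₚ.+-identityʳ w))))
      (ℕₚ.≤-trans (ℕₚ.*-monoˡ-≤ w (ℕₚ.≤-trans (ℕₚ.≤-trans (ℕₚ.m≤m+n 2 62) (ℕₚ.≤-trans 64≤l (ℕₚ.m≤m+n l l)))
        (ℕₚ.m≤n*m (l + l) (w * w * (w * w))))) Bw≤r)
    r³≤ : r * r * r ≤ 2 ^ k
    r³≤ = ℕₚ.≤-trans (ℕₚ.*-mono-≤ (ℕₚ.*-mono-≤ r≤2^l r≤2^l) r≤2^l) (ℕₚ.≤-reflexive (sym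
      (trans (ℕₚ.^-distribˡ-+-* 2 (l + l) l) (cong (_* 2 ^ l) (ℕₚ.^-distribˡ-+-* 2 l l)))))
    r²≤ : r * r * K ^ B ≤ suc K ^ B
    r²≤ = begin
      r * r * K ^ (K * (l + l))          ≤⟨ ℕₚ.*-monoˡ-≤ (K ^ B) (ℕₚ.*-mono-≤ r≤2^l r≤2^l) ⟩
      2 ^ l * 2 ^ l * K ^ (K * (l + l))  ≡⟨ cong₂ _*_ (sym (ℕₚ.^-distribˡ-+-* 2 l l)) (sym (ℕₚ.^-*-assoc K K (l + l))) ⟩
      2 ^ (l + l) * (K ^ K) ^ (l + l)    ≡⟨ ^-distribʳ-* (l + l) 2 (K ^ K) ⟨
      (2 * K ^ K) ^ (l + l)              ≤⟨ ℕₚ.^-monoˡ-≤ (l + l) (2*K^K≤ K) ⟩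
      (suc K ^ K) ^ (l + l)              ≡⟨ ℕₚ.^-*-assoc (suc K) K (l + l) ⟩
      suc K ^ (K * (l + l))              ∎
      where open ℕₚ.≤-Reasoning

-- Ramsey's theorem

-- Sets are represented by sublists, which keep the order of the list; patterns are later read
-- against this order.
Homogeneous : ∀ {A : Set} → ℕ → (List A → Bool) → List A → Set
Homogeneous r χ ys = ∃[ c ] (∀ {zs} → zs ⊆ ys → length zs ≡ r → χ zs ≡ c)

module _ {A : Set} where

  -- Each element comes with the colour of the (r + 1)-sets that it heads.
  HeadColoured : ℕ → (List A → Bool) → List (A × Bool) → Set
  HeadColoured r χ []             = ⊤
  HeadColoured r χ ((x , c) ∷ ps) =
    (∀ {zs} → zs ⊆ map proj₁ ps → length zs ≡ r → χ (x ∷ zs) ≡ c) × HeadColoured r χ ps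

  head-coloured⇒homogeneous : ∀ {r χ c} {ps : List (A × Bool)} → HeadColoured r χ ps →
    ∀ {qs} → qs ⊆ ps → All.All (λ p → proj₂ p ≡ c) qs →
    ∀ {zs} → zs ⊆ map proj₁ qs → length zs ≡ suc r → χ zs ≡ c
  head-coloured⇒homogeneous (_ , h) (_ ∷ʳ qs⊆) cs zs⊆ len = head-coloured⇒homogeneous h qs⊆ cs zs⊆ len
  head-coloured⇒homogeneous (_ , h) (refl ∷ qs⊆) (_ All.∷ cs) (_ ∷ʳ zs⊆) len =
    head-coloured⇒homogeneous h qs⊆ cs zs⊆ len
  head-coloured⇒homogeneous (colour , _) (refl ∷ qs⊆) (refl All.∷ _) (refl ∷ zs⊆) len =
    colour (Sublist.⊆-trans zs⊆ (Sublistₚ.map⁺ proj₁ qs⊆)) (ℕₚ.suc-injective len)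
  head-coloured⇒homogeneous _ [] _ [] ()

-- Heads are chosen one after another, each time passing to a sublist on which the r-sets below the
-- head have one colour. Of 2m heads, m carry the same colour, and these are homogeneous for (r +
-- 1)-sets.
ramsey : ∀ r m → ∃[ N ] (∀ {A : Set} (χ : List A → Bool) xs → N ≤ length xs →
  ∃[ ys ] (ys ⊆ xs × m ≤ length ys × Homogeneous r χ ys))
ramsey zero    m = m , λ χ xs m≤ → xs , Sublist.⊆-refl , m≤ , χ [] , λ { {[]} _ _ → refl }
ramsey (suc r) m = proj₁ (head-coloured (m + m)) , λ χ xs N≤ →
  let (ps , ps⊆ , 2m≤ , h) = proj₂ (head-coloured (m + m)) χ xs N≤
      (c , qs , qs⊆ , cs , m≤) = majority ps 2m≤
  in map proj₁ qs , Sublist.⊆-trans (Sublistₚ.map⁺ proj₁ qs⊆) ps⊆ ,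
     ℕₚ.≤-trans m≤ (ℕₚ.≤-reflexive (sym (Listₚ.length-map proj₁ qs))) ,
     c , λ zs⊆ len → head-coloured⇒homogeneous h qs⊆ cs zs⊆ len
  where
  red? : ∀ {A : Set} → Decidable (λ (p : A × Bool) → proj₂ p ≡ true)
  red? p = proj₂ p Bool.≟ true
  majority : ∀ {A : Set} (ps : List (A × Bool)) → m + m ≤ length ps →
    ∃[ c ] (∃[ qs ] (qs ⊆ ps × All.All (λ p → proj₂ p ≡ c) qs × m ≤ length qs))
  majority ps 2m≤ with m ≤? length (filter red? ps)
  ... | yes m≤ = true , filter red? ps , Sublistₚ.filter-⊆ red? ps , Allₚ.all-filter red? ps , m≤
  ... | no  m≰ = false , filter (¬? ∘ red?) ps , Sublistₚ.filter-⊆ (¬? ∘ red?) ps ,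
    All.map (λ {p} ≢true → not-true ≢true) (Allₚ.all-filter (¬? ∘ red?) ps) ,
    ℕₚ.≮⇒≥ λ few → ℕₚ.<⇒≱ (ℕₚ.+-mono-< (ℕₚ.≰⇒> m≰) few)
      (ℕₚ.≤-trans 2m≤ (ℕₚ.≤-reflexive (sym (length-filter-¬ red? ps))))
    where
    not-true : ∀ {b} → b ≢ true → b ≡ false
    not-true {false} _     = refl
    not-true {true}  ≢true = contradiction refl ≢true
  head-coloured : ∀ l → ∃[ N ] (∀ {A : Set} (χ : List A → Bool) xs → N ≤ length xs →
    ∃[ ps ] (map proj₁ ps ⊆ xs × l ≤ length ps × HeadColoured r χ ps))
  head-coloured zero    = 0 , λ χ xs _ → [] , Sublist.minimum xs , z≤n , tt
  head-coloured (suc l) =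
    let (N , step) = head-coloured l ; (N′ , hom) = ramsey r N in suc N′ , λ where
      χ (x ∷ xs) (s≤s N′≤) →
        let (ys , ys⊆ , N≤ , c , colour) = hom (χ ∘ (x ∷_)) xs N′≤
            (ps , ps⊆ , l≤ , h) = step χ ys N≤
        in (x , c) ∷ ps , refl ∷ Sublist.⊆-trans ps⊆ ys⊆ , s≤s l≤ ,
           (λ zs⊆ → colour (Sublist.⊆-trans zs⊆ ps⊆)) , h

-- The colourings are treated one by one, as sublists of a homogeneous list remain homogeneous.
ramsey-family : ∀ {I : Set} (is : List I) r m → ∃[ N ] (∀ {A : Set} (χ : I → List A → Bool) xs → N ≤ length xs →
  ∃[ ys ] (ys ⊆ xs × m ≤ length ys × (∀ {i} → i ∈ is → Homogeneous r (χ i) ys)))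
ramsey-family []       r m = m , λ χ xs m≤ → xs , Sublist.⊆-refl , m≤ , λ ()
ramsey-family (i ∷ is) r m =
  let (N , family) = ramsey-family is r m ; (N′ , single) = ramsey r N in N′ , λ χ xs N′≤ →
    let (ys , ys⊆ , N≤ , c , colour) = single (χ i) xs N′≤
        (zs , zs⊆ , m≤ , colours) = family χ ys N≤
    in zs , Sublist.⊆-trans zs⊆ ys⊆ , m≤ , λ where
      (here refl) → c , λ ws⊆ → colour (Sublist.⊆-trans ws⊆ zs⊆)
      (there i∈)  → colours i∈

-- Tournaments given by patterns

T-does⁺ : ∀ {P : Set} (P? : Dec P) → P → T (does P?)
T-does⁺ P? p = subst T (sym (dec-true P? p)) tt

T-does⁻ : ∀ {P : Set} (P? : Dec P) → T (does P?) → P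
T-does⁻ (yes p) _ = p

value : ∀ {n r} → Arrangement (Fin n) r → Fin r → ℕ
value a i = toℕ (entry a i)

value-injective : ∀ {n r} (a : Arrangement (Fin n) r) → Injective _≡_ _≡_ (value a)
value-injective a eq = entry-injective a (Finₚ.toℕ-injective eq)

SameOrder : ∀ {r} → (Fin r → ℕ) → (Fin r → ℕ) → Set
SameOrder f g = ∀ i j → f i < f j → g i < g j

same-order-sym : ∀ {r} {f g : Fin r → ℕ} → Injective _≡_ _≡_ f → SameOrder f g → SameOrder g f
same-order-sym {f = f} inj same i j lt with ℕₚ.<-cmp (f i) (f j)
... | tri< f< _ _ = f<
... | tri≈ _ f≡ _ with inj f≡
...   | refl = contradiction lt (ℕₚ.<-irrefl refl)
same-order-sym inj same i j lt | tri> _ _ f> = contradiction lt (ℕₚ.<⇒≯ (same j i f>))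

-- Induction on the value in π: the entry v + 1 lies above the entry v, whose counterpart in σ is at
-- least v.
same-order-≤ : ∀ {r} (π σ : Arrangement (Fin r) r) → SameOrder (value π) (value σ) → ∀ j → value π j ≤ value σ j
same-order-≤ {r} π σ same j = go (value π j) j refl
  where
  go : ∀ v j → value π j ≡ v → v ≤ value σ j
  go zero    j _  = z≤n
  go (suc v) j eq =
    let v<r = ℕₚ.<-trans (ℕₚ.n<1+n v) (subst (_< r) eq (Finₚ.toℕ<n (entry π j)))
        (i , eqᵢ) = injective⇒surjective (entry-injective π) (Fin.fromℕ< v<r)
        πi≡v = trans (cong toℕ eqᵢ) (Finₚ.toℕ-fromℕ< v<r)
    in ℕₚ.≤-<-trans (go v i πi≡v) (same i j (subst₂ _<_ (sym πi≡v) (sym eq) (ℕₚ.n<1+n v)))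

same-order⇒≡ : ∀ {r} (π σ : Arrangement (Fin r) r) → SameOrder (value π) (value σ) → π ≡ σ
same-order⇒≡ π σ same = entry-≡ λ i → Finₚ.toℕ-injective (ℕₚ.≤-antisym
  (same-order-≤ π σ same i) (same-order-≤ σ π (same-order-sym (value-injective π) same) i))

enumerate : ∀ {n} (S : Subset n) → Fin Subset.∣ S ∣ → Fin n
enumerate (inside  ∷ S) Fin.zero    = Fin.zero
enumerate (inside  ∷ S) (Fin.suc i) = Fin.suc (enumerate S i)
enumerate (outside ∷ S) i           = Fin.suc (enumerate S i)

enumerate-mono : ∀ {n} (S : Subset n) {i j} → i Fin.< j → enumerate S i Fin.< enumerate S j
enumerate-mono (inside  ∷ S) {Fin.zero}  {Fin.suc j} _         = z<s
enumerate-mono (inside  ∷ S) {Fin.suc i} {Fin.suc j} (s≤s i<j) = s≤s (enumerate-mono S i<j)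
enumerate-mono (outside ∷ S) i<j                               = s≤s (enumerate-mono S i<j)

enumerate-injective : ∀ {n} (S : Subset n) → Injective _≡_ _≡_ (enumerate S)
enumerate-injective S {i} {j} eq with Finₚ.<-cmp i j
... | tri< i<j _ _ = contradiction (cong toℕ eq) (ℕₚ.<⇒≢ (enumerate-mono S i<j))
... | tri≈ _ i≡j _ = i≡j
... | tri> _ _ j<i = contradiction (cong toℕ (sym eq)) (ℕₚ.<⇒≢ (enumerate-mono S j<i))

enumerate-∈ : ∀ {n} (S : Subset n) i → enumerate S i Subset.∈ S
enumerate-∈ (inside  ∷ S) Fin.zero    = Vec.here
enumerate-∈ (inside  ∷ S) (Fin.suc i) = Vec.there (enumerate-∈ S i)
enumerate-∈ (outside ∷ S) i           = Vec.there (enumerate-∈ S i)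

index : ∀ {n} (S : Subset n) {x} → x Subset.∈ S → ∃[ i ] enumerate S i ≡ x
index (inside  ∷ S) Vec.here       = Fin.zero , refl
index (inside  ∷ S) (Vec.there x∈) = let (i , eq) = index S x∈ in Fin.suc i , cong Fin.suc eq
index (outside ∷ S) (Vec.there x∈) = let (i , eq) = index S x∈ in i , cong Fin.suc eq

module PatternTournament (m : ℕ) (A : List (Arrangement (Fin (suc m)) (suc m))) (uniqueA : Unique A) where
  open Cyclic m

  HasPattern : ∀ {n} → Arrangement (Fin n) r → Perm → Set
  HasPattern a π = SameOrder (value a) (value π)

  hasPattern? : ∀ {n} (a : Arrangement (Fin n) r) → Decidable (HasPattern a)
  hasPattern? a π = Finₚ.all? λ i → Finₚ.all? λ j → (value a i <? value a j) →-dec (value π i <? value π j)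

  edge? : ∀ {n} (a : Arrangement (Fin n) r) → Dec (Any.Any (HasPattern a) A)
  edge? a = Any.any? (hasPattern? a) A

  tournament : ∀ n → Hyperdigraph r n
  tournament n a = does (edge? a)

  -- The increasing enumeration of S carries permutations to orderings of S one to one, and exactly
  -- those in `A` to edges.
  isTournament : ∀ n → IsTournament (length A) (tournament n)
  isTournament n S ∣S∣≡r =
    map order A , Uniqueₚ.map⁺ order-injective uniqueA , (λ a → mk⇔ (to a) (from a)) , Listₚ.length-map order A
    where
    e : Fin r → Fin n
    e i = enumerate S (Fin.cast (sym ∣S∣≡r) i)
    e-mono : ∀ {i j} → i Fin.< j → e i Fin.< e j
    e-mono {i} {j} i<j = enumerate-mono S
      (subst₂ _<_ (sym (Finₚ.toℕ-cast (sym ∣S∣≡r) i)) (sym (Finₚ.toℕ-cast (sym ∣S∣≡r) j)) i<j)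
    e-injective : Injective _≡_ _≡_ e
    e-injective {i} {j} eq = Finₚ.toℕ-injective (trans (sym (Finₚ.toℕ-cast (sym ∣S∣≡r) i))
      (trans (cong toℕ (enumerate-injective S eq)) (Finₚ.toℕ-cast (sym ∣S∣≡r) j)))
    e-onto : ∀ {x} → x Subset.∈ S → ∃[ i ] e i ≡ x
    e-onto x∈ = let (i , eq) = index S x∈ in Fin.cast ∣S∣≡r i ,
      trans (cong (enumerate S) (Finₚ.toℕ-injective (trans (Finₚ.toℕ-cast (sym ∣S∣≡r) _) (Finₚ.toℕ-cast ∣S∣≡r i)))) eq
    order : Perm → Arrangement (Fin n) r
    order = mapArrangement e e-injective
    order-value : ∀ π i → value (order π) i ≡ toℕ (e (entry π i))
    order-value π i = cong toℕ (entry-map e e-injective π i)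
    order-injective : ∀ {π σ} → order π ≡ order σ → π ≡ σ
    order-injective {π} {σ} eq = entry-≡ λ i → e-injective
      (trans (sym (entry-map e e-injective π i)) (trans (cong (λ a → entry a i) eq) (entry-map e e-injective σ i)))
    value-order : ∀ π → SameOrder (value π) (value (order π))
    value-order π i j lt = subst₂ _<_ (sym (order-value π i)) (sym (order-value π j)) (e-mono lt)
    to : ∀ a → a ∈ map order A → IsOrderingOf a S × IsEdge (tournament n) a
    to a a∈ with Memₚ.∈-map⁻ order a∈
    ... | π , π∈ , refl =
      VecAllₚ.lookup⁻ (λ i → subst (Subset._∈ S) (sym (entry-map e e-injective π i)) (enumerate-∈ S _)) ,
      T-does⁺ (edge? a) (lose π∈ (same-order-sym (value-injective π) (value-order π)))
    from : ∀ a → IsOrderingOf a S × IsEdge (tournament n) a → a ∈ map order A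
    from a (ordering , edge) = subst (_∈ map order A) order-σ (Memₚ.∈-map⁺ order (subst (_∈ A) π≡σ π∈))
      where
      member : ∀ i → ∃[ j ] e j ≡ entry a i
      member i = e-onto (VecAllₚ.lookup⁺ ordering i)
      σ : Perm
      σ = arrange (proj₁ ∘ member) λ {i} {j} eq →
        entry-injective a (trans (sym (proj₂ (member i))) (trans (cong e eq) (proj₂ (member j))))
      entry-σ : ∀ i → entry σ i ≡ proj₁ (member i)
      entry-σ = Vecₚ.lookup∘tabulate (proj₁ ∘ member)
      order-σ : order σ ≡ a
      order-σ = entry-≡ λ i → trans (entry-map e e-injective σ i) (trans (cong e (entry-σ i)) (proj₂ (member i)))
      found : ∃[ π ] (π ∈ A × HasPattern a π)
      found = find (T-does⁻ (edge? a) edge)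
      π : Perm
      π = proj₁ found
      π∈ : π ∈ A
      π∈ = proj₁ (proj₂ found)
      π≡σ : π ≡ σ
      π≡σ = sym (same-order⇒≡ σ π λ i j lt → proj₂ (proj₂ found) i j
        (subst (λ b → value b i < value b j) order-σ (value-order σ i j lt)))

  -- A longer path has `length A` + 1 windows; their patterns form a walk inside `A`, which must
  -- return.
  no-long-path : ¬ Core A → ∀ {n s} → tournament n Contains tightPath r s → s < r + length A
  no-long-path coreless {n} {s} (f , inj , edges) = ℕₚ.≰⇒> λ long → coreless (core long)
    where
    module _ (long : r + length A ≤ s) where
      position< : ∀ (i : Fin (suc (length A))) (j : Fin r) → toℕ i + toℕ j < s
      position< i j = ℕₚ.<-≤-trans
        (ℕₚ.≤-trans (ℕₚ.≤-reflexive (sym (ℕₚ.+-suc (toℕ i) (toℕ j)))) (ℕₚ.+-mono-≤ (ℕₚ.≤-pred (Finₚ.toℕ<n i)) (Finₚ.toℕ<n j)))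
        (ℕₚ.≤-trans (ℕₚ.≤-reflexive (ℕₚ.+-comm (length A) r)) long)
      place : Fin (suc (length A)) → Fin r → Fin s
      place i j = Fin.fromℕ< (position< i j)
      toℕ-place : ∀ i j → toℕ (place i j) ≡ toℕ i + toℕ j
      toℕ-place i j = Finₚ.toℕ-fromℕ< (position< i j)
      window : Fin (suc (length A)) → Arrangement (Fin s) r
      window i = arrange (place i) λ {j} {k} eq → Finₚ.toℕ-injective (ℕₚ.+-cancelˡ-≡ (toℕ i) _ _
        (trans (sym (toℕ-place i j)) (trans (cong toℕ eq) (toℕ-place i k))))
      entry-window : ∀ i j → entry (window i) j ≡ place i j
      entry-window i = Vecₚ.lookup∘tabulate (place i)
      window-edge : ∀ i → IsEdge (tightPath r s) (window i)
      window-edge i = T-does⁺ (Finₚ.any? {n = s} _) (place i Fin.zero , λ j →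
        trans (cong toℕ (entry-window i j)) (trans (toℕ-place i j)
          (cong (_+ toℕ j) (sym (trans (toℕ-place i Fin.zero) (ℕₚ.+-identityʳ (toℕ i)))))))
      found : ∀ i → ∃[ π ] (π ∈ A × HasPattern (mapArrangement f inj (window i)) π)
      found i = find (T-does⁻ (edge? (mapArrangement f inj (window i))) (edges (window i) (window-edge i)))
      π : Fin (suc (length A)) → Perm
      π i = proj₁ (found i)
      π∈ : ∀ i → π i ∈ A
      π∈ i = proj₁ (proj₂ (found i))
      image : Fin (suc (length A)) → Fin r → ℕ
      image i j = toℕ (f (place i j))
      image-order : ∀ i → SameOrder (image i) (value (π i))
      image-order i j k lt = proj₂ (proj₂ (found i)) j k
        (subst₂ _<_ (sym (image≡ j)) (sym (image≡ k)) lt)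
        where
        image≡ : ∀ j → value (mapArrangement f inj (window i)) j ≡ image i j
        image≡ j = cong toℕ (trans (entry-map f inj (window i) j) (cong f (entry-window i j)))
      image-injective : ∀ i → Injective _≡_ _≡_ (image i)
      image-injective i {j} {k} eq = Finₚ.toℕ-injective (ℕₚ.+-cancelˡ-≡ (toℕ i) _ _
        (trans (sym (toℕ-place i j)) (trans (cong toℕ (inj (Finₚ.toℕ-injective eq))) (toℕ-place i k))))
      consecutive : ∀ (i : Fin (length A)) → π (Fin.inject₁ i) ⟶ π (Fin.suc i)
      consecutive i = edge⁺ (π i₀) (π i₁)
        (λ {j} {k} j<m k<m lt → order₁ j<m k<m (subst₂ _<_ (shift j<m) (shift k<m)
          (same-order-sym (image-injective i₀) (image-order i₀) (Fin.fromℕ< (s≤s j<m)) (Fin.fromℕ< (s≤s k<m))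
            (subst₂ _<_ (at-value (π i₀) {suc j} (s≤s j<m)) (at-value (π i₀) {suc k} (s≤s k<m)) lt))))
        (λ {j} {k} j<m k<m lt → order₀ j<m k<m (subst₂ _<_ (sym (shift j<m)) (sym (shift k<m))
          (same-order-sym (image-injective i₁) (image-order i₁)
            (Fin.fromℕ< (ℕₚ.m<n⇒m<1+n j<m)) (Fin.fromℕ< (ℕₚ.m<n⇒m<1+n k<m))
            (subst₂ _<_ (at-value (π i₁) {j} (ℕₚ.m<n⇒m<1+n j<m)) (at-value (π i₁) {k} (ℕₚ.m<n⇒m<1+n k<m)) lt))))
        where
        i₀ i₁ : Fin (suc (length A))
        i₀ = Fin.inject₁ i
        i₁ = Fin.suc i
        at-value : ∀ b {j} (j<r : j < r) → at b j ≡ value b (Fin.fromℕ< j<r)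
        at-value b j<r = trans (cong (at b) (sym (Finₚ.toℕ-fromℕ< j<r))) (at-toℕ b (Fin.fromℕ< j<r))
        -- Place j + 1 of one window and place j of the next are the same vertex of the path.
        shift : ∀ {j} (j<m : j < m) → image i₀ (Fin.fromℕ< (s≤s j<m)) ≡ image i₁ (Fin.fromℕ< (ℕₚ.m<n⇒m<1+n j<m))
        shift {j} j<m = cong (toℕ ∘ f) (Finₚ.toℕ-injective (trans (toℕ-place i₀ _) (trans
          (trans (cong₂ _+_ (Finₚ.toℕ-inject₁ i) (Finₚ.toℕ-fromℕ< (s≤s j<m))) (ℕₚ.+-suc (toℕ i) j))
          (sym (trans (toℕ-place i₁ _) (cong (_+_ (suc (toℕ i))) (Finₚ.toℕ-fromℕ< (ℕₚ.m<n⇒m<1+n j<m))))))))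
        order₁ : ∀ {j k} (j<m : j < m) (k<m : k < m) →
          image i₁ (Fin.fromℕ< (ℕₚ.m<n⇒m<1+n j<m)) < image i₁ (Fin.fromℕ< (ℕₚ.m<n⇒m<1+n k<m)) → at (π i₁) j < at (π i₁) k
        order₁ j<m k<m lt = subst₂ _<_ (sym (at-value (π i₁) (ℕₚ.m<n⇒m<1+n j<m))) (sym (at-value (π i₁) (ℕₚ.m<n⇒m<1+n k<m)))
          (image-order i₁ _ _ lt)
        order₀ : ∀ {j k} (j<m : j < m) (k<m : k < m) →
          image i₀ (Fin.fromℕ< (s≤s j<m)) < image i₀ (Fin.fromℕ< (s≤s k<m)) → at (π i₀) (suc j) < at (π i₀) (suc k)
        order₀ j<m k<m lt = subst₂ _<_ (sym (at-value (π i₀) (s≤s j<m))) (sym (at-value (π i₀) (s≤s k<m))) (image-order i₀ _ _ lt)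
      core : Core A
      core = walk⇒core π π∈ consecutive

-- Existence of the path number

T? : ∀ b → Dec (T b)
T? true  = yes tt
T? false = no λ ()

hasSize? : ∀ {A : Set} (L : Listed A) {P : A → Set} → Decidable P → ∀ k → Dec (P HasSize k)
hasSize? L {P} P? k = map′
  (λ eq → filter P? elems , Uniqueₚ.filter⁺ P? unique ,
    (λ x → mk⇔ (λ x∈ → proj₂ (Memₚ.∈-filter⁻ P? {xs = elems} x∈)) (∈-# P?)) , eq)
  (λ (xs , u , char , eq) → trans (ℕₚ.≤-antisym
    (unique-⊆ (Uniqueₚ.filter⁺ P? unique) (λ {x} x∈ → Equivalence.from (char x) (proj₂ (Memₚ.∈-filter⁻ P? {xs = elems} x∈))))
    (unique-⊆ u (λ {x} x∈ → ∈-# P? (Equivalence.to (char x) x∈)))) eq)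
  (# P? ≟ k)
  where open Listed L

isTournament? : ∀ {r n} k → Decidable (IsTournament {r} {n} k)
isTournament? {r} {n} k G = map′
  (λ none S eq → decidable-stable (sized? S) λ ¬sized → none (S , eq , ¬sized))
  (λ all (S , eq , ¬sized) → ¬sized (all S eq))
  (¬? (Subsetₚ.anySubset? λ S → (Subset.∣ S ∣ ≟ r) ×-dec ¬? (sized? S)))
  where
  sized? : ∀ S → Dec ((λ a → IsOrderingOf a S × IsEdge G a) HasSize k)
  sized? S = hasSize? (listed n r) (λ a → VecAll.all? (Subsetₚ._∈? S) (entries a) ×-dec T? (G a)) k

contains? : ∀ {r m n} (G : Hyperdigraph r n) (H : Hyperdigraph r m) → Dec (G Contains H)
contains? {r} {m} {n} G H = map′ to from (Any.any? embeds? (arrangements n m))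
  where
  Embeds : Arrangement (Fin n) m → Set
  Embeds p = ∀ a → IsEdge H a → IsEdge G (mapArrangement (entry p) (entry-injective p) a)
  embeds? : Decidable Embeds
  embeds? p = map′ (λ all a → All.lookup all (∈-arrangements a)) (λ all → All.tabulate (λ {a} _ → all a))
    (All.all? (λ a → T? (H a) →-dec T? (G (mapArrangement (entry p) (entry-injective p) a))) (arrangements m r))
  to : Any.Any Embeds (arrangements n m) → G Contains H
  to any = let (p , _ , e) = find any in entry p , entry-injective p , e
  from : G Contains H → Any.Any Embeds (arrangements n m)
  from (f , inj , e) = lose (∈-arrangements (arrange f inj)) λ a edge →
    subst (IsEdge G) (entry-≡ λ i → trans (entry-map f inj a i)
      (sym (trans (entry-map (entry (arrange f inj)) (entry-injective (arrange f inj)) a i) (entry-arrange f inj (entry a i)))))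
      (e a edge)

module _ {r n : ℕ} where
  open import Data.List.Membership.DecPropositional (_≟ᴬ_ {n} {r}) using (_∈?_)

  fromEdges : List (Arrangement (Fin n) r) → Hyperdigraph r n
  fromEdges es a = does (a ∈? es)

  edges : Hyperdigraph r n → List (Arrangement (Fin n) r)
  edges G = filter (T? ∘ G) (arrangements n r)

  edges⁺ : ∀ G {a} → IsEdge G a → IsEdge (fromEdges (edges G)) a
  edges⁺ G {a} e = T-does⁺ (a ∈? edges G) (Memₚ.∈-filter⁺ (T? ∘ G) (∈-arrangements a) e)

  edges⁻ : ∀ G {a} → IsEdge (fromEdges (edges G)) a → IsEdge G a
  edges⁻ G {a} e = proj₂ (Memₚ.∈-filter⁻ (T? ∘ G) {xs = arrangements n r} (T-does⁻ (a ∈? edges G) e))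

  ForcesPath : ℕ → ℕ → Set
  ForcesPath k s = ∀ (G : Hyperdigraph r n) → IsTournament k G → G Contains tightPath r s

  -- Digraphs are functions, but both properties in question depend only on which arrangements are
  -- edges, so the finitely many edge lists represent them all.
  forcesPath? : ∀ k → Decidable (ForcesPath k)
  forcesPath? k s = map′ to from (All.all? forced? (subsequences (arrangements n r)))
    where
    Forced : List (Arrangement (Fin n) r) → Set
    Forced es = IsTournament k (fromEdges es) → fromEdges es Contains tightPath r s
    forced? : Decidable Forced
    forced? es = isTournament? k (fromEdges es) →-dec contains? (fromEdges es) (tightPath r s)
    to : All.All Forced (subsequences (arrangements n r)) → ForcesPath k s
    to all G isT =
      let (f , inj , e) = All.lookup all (filter∈subsequences (T? ∘ G) (arrangements n r)) λ S eq →
            let (xs , u , char , len) = isT S eq in xs , u ,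
              (λ a → mk⇔ (λ x∈ → let (o , x) = Equivalence.to (char a) x∈ in o , edges⁺ G x)
                         (λ (o , x) → Equivalence.from (char a) (o , edges⁻ G x))) , len
      in f , inj , λ a x → edges⁻ G (e a x)
    from : ForcesPath k s → All.All Forced (subsequences (arrangements n r))
    from forces = All.tabulate λ {es} _ → forces (fromEdges es)

  -- The tournament G bounds the maximum: a forced path with s vertices embeds into its n vertices.
  pathNumber : ∀ {k M} (G : Hyperdigraph r n) → IsTournament k G → ForcesPath k M →
    ∃[ s ] (IsPathNumber n r k s × M ≤ s)
  pathNumber {k} {M} G isT forces =
    let (s , isMax) = maximum (forcesPath? k) {M} forces n λ {s} p →
          let (f , inj , _) = p G isT in Finₚ.injective⇒≤ {f = f} inj
    in s , isMax , proj₂ isMax forces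

-- Realising walks

supremum : ∀ {D : ℕ → Set} (D? : Decidable D) (f : ℕ → ℕ) b →
  ∃[ s ] ((∀ {j} → j < b → D j → f j ≤ s) × (s ≡ 0 ⊎ ∃[ j ] (j < b × D j × s ≡ f j)))
supremum D? f zero    = 0 , (λ ()) , inj₁ refl
supremum {D} D? f (suc b) with supremum D? f b | D? b
... | s , above , attained | no ¬Db = s ,
  (λ j≤b Dj → [ (λ j<b → above j<b Dj) , (λ { refl → contradiction Dj ¬Db }) ]′ (ℕₚ.m≤n⇒m<n∨m≡n (ℕₚ.≤-pred j≤b))) ,
  [ inj₁ , (λ (j , j<b , rest) → inj₂ (j , ℕₚ.m<n⇒m<1+n j<b , rest)) ]′ attained
... | s , above , attained | yes Db with ℕₚ.≤-total s (f b)
...   | inj₁ s≤fb = f b ,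
  (λ j≤b Dj → [ (λ j<b → ℕₚ.≤-trans (above j<b Dj) s≤fb) , (λ { refl → ℕₚ.≤-refl }) ]′ (ℕₚ.m≤n⇒m<n∨m≡n (ℕₚ.≤-pred j≤b))) ,
  inj₂ (b , ℕₚ.n<1+n b , Db , refl)
...   | inj₂ fb≤s = s ,
  (λ j≤b Dj → [ (λ j<b → above j<b Dj) , (λ { refl → fb≤s }) ]′ (ℕₚ.m≤n⇒m<n∨m≡n (ℕₚ.≤-pred j≤b))) ,
  [ inj₁ , (λ (j , j<b , rest) → inj₂ (j , ℕₚ.m<n⇒m<1+n j<b , rest)) ]′ attained

module Realising (m : ℕ) where
  open Cyclic m

  -- The map z to 2 + 2 z leaves 1 and an odd number after each image free, so one more number can
  -- be inserted anywhere.
  range : ℕ → ℕ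
  range zero    = r
  range (suc l) = 2 + (range l + range l)

  r≤range : ∀ l → r ≤ range l
  r≤range zero    = ℕₚ.≤-refl
  r≤range (suc l) = ℕₚ.≤-trans (r≤range l) (ℕₚ.≤-trans (ℕₚ.m≤m+n (range l) (range l)) (ℕₚ.m≤n+m _ 2))

  -- The l windows use l + m = l + r - 1 numbers. The condition `head` carries the induction: the
  -- first r - 1 numbers of the walk from W 1 on are ordered as an edge from W 0 requires, even if l
  -- = 0.
  record Realisation (W : ℕ → Perm) (l : ℕ) : Set where
    field
      z        : ℕ → ℕ
      z<       : ∀ {i} → i < l + m → z i < range l
      z-injective : ∀ {i j} → i < l + m → j < l + m → z i ≡ z j → i ≡ j
      head     : ∀ {i j} → i < m → j < m → at (W 0) i < at (W 0) j → z i < z j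
      windows  : ∀ {t i j} → t < l → i < r → j < r → at (W t) i < at (W t) j → z (t + i) < z (t + j)

  private
    double+2-mono : ∀ {x y} → x < y → 3 + (x + x) < 2 + (y + y)
    double+2-mono {x} x<y = s≤s (s≤s (ℕₚ.≤-trans (ℕₚ.≤-reflexive (cong suc (sym (ℕₚ.+-suc x x)))) (ℕₚ.+-mono-≤ x<y x<y)))

  -- The first number is placed between doubled copies of the others.
  realise : ∀ l W → (∀ i → W i ⟶ W (suc i)) → Realisation W l
  realise zero W _ = record
    { z = at (W 0)
    ; z< = λ {i} _ → at<r (W 0) i
    ; z-injective = λ i<m j<m → at-injective-< (W 0) (ℕₚ.m<n⇒m<1+n i<m) (ℕₚ.m<n⇒m<1+n j<m)
    ; head = λ _ _ → id
    ; windows = λ () }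
  realise (suc l) W walk = record
    { z = z ; z< = z< ; z-injective = z-injective
    ; head = λ i<m j<m → first (ℕₚ.m<n⇒m<1+n i<m) (ℕₚ.m<n⇒m<1+n j<m)
    ; windows = windows }
    where
    module Z = Realisation (realise l (W ∘ suc) (walk ∘ suc))
    D : ℕ → Set
    D j = at (W 0) (suc j) < at (W 0) 0
    doubled : ℕ → ℕ
    doubled j = 2 + (Z.z j + Z.z j)
    sup : ∃[ s ] ((∀ {j} → j < m → D j → doubled j ≤ s) × (s ≡ 0 ⊎ ∃[ j ] (j < m × D j × s ≡ doubled j)))
    sup = supremum (λ j → at (W 0) (suc j) <? at (W 0) 0) doubled m
    z : ℕ → ℕ
    -- One more than the largest copy that must stay below, hence odd and different from all copies;
    -- with nothing below it is 1, under every copy.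
    z zero    = suc (proj₁ sup)
    z (suc i) = doubled i
    shift : ∀ {i j} → i < m → j < m → at (W 0) (suc i) < at (W 0) (suc j) → Z.z i < Z.z j
    shift i<m j<m lt = Z.head i<m j<m (edge⁻ (W 0) (W 1) (walk 0) i<m j<m lt)
    above : ∀ {j} → j < m → at (W 0) 0 < at (W 0) (suc j) → z 0 < z (suc j)
    above j<m lt with proj₂ (proj₂ sup)
    ... | inj₁ s≡0 = subst (λ s → suc s < z (suc _)) (sym s≡0) (s≤s z<s)
    ... | inj₂ (i , i<m , Di , s≡) = subst (λ s → suc s < z (suc _)) (sym s≡) (double+2-mono (shift i<m j<m (ℕₚ.<-trans Di lt)))
    first : ∀ {i j} → i < r → j < r → at (W 0) i < at (W 0) j → z i < z j
    first {zero}  {zero}  _ _ lt = contradiction lt (ℕₚ.<-irrefl refl)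
    first {zero}  {suc j} _ (s≤s j<m) lt = above j<m lt
    first {suc i} {zero}  (s≤s i<m) _ lt = s≤s (proj₁ (proj₂ sup) i<m lt)
    first {suc i} {suc j} (s≤s i<m) (s≤s j<m) lt = ℕₚ.<-trans (ℕₚ.n<1+n _) (double+2-mono (shift i<m j<m lt))
    windows : ∀ {t i j} → t < suc l → i < r → j < r → at (W t) i < at (W t) j → z (t + i) < z (t + j)
    windows {zero}  _         i<r j<r lt = first i<r j<r lt
    windows {suc t} (s≤s t<l) i<r j<r lt = ℕₚ.<-trans (ℕₚ.n<1+n _) (double+2-mono (Z.windows t<l i<r j<r lt))
    z< : ∀ {i} → i < suc l + m → z i < range (suc l)
    z< {suc i} (s≤s i<) = ℕₚ.<-trans (ℕₚ.n<1+n _) (double+2-mono (Z.z< i<))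
    z< {zero} _ with proj₂ (proj₂ sup)
    ... | inj₁ s≡0 = subst (λ s → suc s < range (suc l)) (sym s≡0) (s≤s z<s)
    ... | inj₂ (i , i<m , _ , s≡) = subst (λ s → suc s < range (suc l)) (sym s≡)
      (double+2-mono (Z.z< (ℕₚ.<-≤-trans i<m (ℕₚ.m≤n+m m l))))
    odd : ∀ j → z 0 ≢ z (suc j)
    odd j eq with proj₂ (proj₂ sup)
    ... | inj₁ s≡0 = contradiction (trans (cong suc (sym s≡0)) eq) λ ()
    ... | inj₂ (i , _ , _ , s≡) = even≢odd (Z.z j) (Z.z i) (sym (ℕₚ.suc-injective (ℕₚ.suc-injective (trans (cong suc (sym s≡)) eq))))
    z-injective : ∀ {i j} → i < suc l + m → j < suc l + m → z i ≡ z j → i ≡ j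
    z-injective {zero}  {zero}  _ _ _ = refl
    z-injective {zero}  {suc j} _ _ eq = contradiction eq (odd j)
    z-injective {suc i} {zero}  _ _ eq = contradiction (sym eq) (odd i)
    z-injective {suc i} {suc j} (s≤s i<) (s≤s j<) eq =
      cong suc (Z.z-injective i< j< (double-injective (ℕₚ.suc-injective (ℕₚ.suc-injective eq))))

-- Sublists given by increasing indices

nth : ∀ {A : Set} → List A → ℕ → Maybe A
nth []       _       = nothing
nth (x ∷ xs) zero    = just x
nth (x ∷ xs) (suc i) = nth xs i

nth-tabulate : ∀ {A : Set} {n} (f : Fin n → A) i → nth (List.tabulate f) (toℕ i) ≡ just (f i)
nth-tabulate f Fin.zero    = refl
nth-tabulate f (Fin.suc i) = nth-tabulate (f ∘ Fin.suc) i

tabulate-⊆ : ∀ {A : Set} (ys : List A) {k} (g : Fin k → Fin (length ys)) →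
  (∀ {i j} → i Fin.< j → g i Fin.< g j) → List.tabulate (List.lookup ys ∘ g) ⊆ ys
tabulate-⊆ ys       {zero}  g mono = Sublist.minimum ys
tabulate-⊆ []       {suc k} g mono = contradiction (g Fin.zero) λ ()
tabulate-⊆ (y ∷ ys) {suc k} g mono with g Fin.zero in g0
... | Fin.zero = refl ∷ subst (_⊆ ys) (Listₚ.tabulate-cong λ i → cong (List.lookup (y ∷ ys)) (sym (proj₂ (later i))))
    (tabulate-⊆ ys (proj₁ ∘ later) λ {i} {j} i<j → ℕₚ.≤-pred
      (subst₂ Fin._<_ (proj₂ (later i)) (proj₂ (later j)) (mono (s≤s i<j))))
  where
  later : ∀ i → ∃[ h ] g (Fin.suc i) ≡ Fin.suc h
  later i with g (Fin.suc i) in gᵢ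
  ... | Fin.suc h = h , refl
  ... | Fin.zero  = contradiction (subst₂ Fin._<_ g0 gᵢ (mono {Fin.zero} {Fin.suc i} z<s)) λ ()
... | Fin.suc h₀ = y ∷ʳ subst (_⊆ ys) (trans (Listₚ.tabulate-cong λ i → cong (List.lookup (y ∷ ys)) (sym (proj₂ (all i))))
      (cong₂ _∷_ (cong (List.lookup (y ∷ ys)) g0) refl))
    (tabulate-⊆ ys (proj₁ ∘ all) λ {i} {j} i<j → ℕₚ.≤-pred
      (subst₂ Fin._<_ (proj₂ (all i)) (proj₂ (all j)) (mono i<j)))
  where
  all : ∀ i → ∃[ h ] g i ≡ Fin.suc h
  all Fin.zero    = h₀ , g0
  all (Fin.suc i) with g (Fin.suc i) in gᵢ
  ... | Fin.suc h = h , refl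
  ... | Fin.zero  = contradiction (subst₂ Fin._<_ g0 gᵢ (mono {Fin.zero} {Fin.suc i} z<s)) λ ()

unique-sublist : ∀ {A : Set} {xs ys : List A} → xs ⊆ ys → Unique ys → Unique xs
unique-sublist []           []       = []
unique-sublist (_ ∷ʳ sub)   (_ ∷ u)  = unique-sublist sub u
unique-sublist (refl ∷ sub) (y∉ ∷ u) = Sublistₚ.All-resp-⊆ sub y∉ ∷ unique-sublist sub u

lookup-unique : ∀ {A : Set} {xs : List A} → Unique xs → Injective _≡_ _≡_ (List.lookup xs)
lookup-unique (_ ∷ _)  {Fin.zero}  {Fin.zero}  _  = refl
lookup-unique (x∉ ∷ _) {Fin.zero}  {Fin.suc j} eq = contradiction eq (All.lookup x∉ (Memₚ.∈-lookup j))
lookup-unique (x∉ ∷ _) {Fin.suc i} {Fin.zero}  eq = contradiction (sym eq) (All.lookup x∉ (Memₚ.∈-lookup i))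
lookup-unique (_ ∷ u)  {Fin.suc i} {Fin.suc j} eq = cong Fin.suc (lookup-unique u eq)

-- The threshold

module Threshold (m : ℕ) where
  open Cyclic m
  open Realising m

  module _ {n : ℕ} (G : Hyperdigraph r n) where

    Places : Perm → List (Fin n) → Arrangement (Fin n) r → Set
    Places π zs a = ∀ j → nth zs (toℕ (entry π j)) ≡ just (entry a j)

    EdgePlacing : Perm → List (Fin n) → Arrangement (Fin n) r → Set
    EdgePlacing π zs a = IsEdge G a × Places π zs a

    edgePlacing? : ∀ π zs → Decidable (EdgePlacing π zs)
    edgePlacing? π zs a = T? (G a) ×-dec Finₚ.all? λ j → Maybeₚ.≡-dec Fin._≟_ (nth zs (toℕ (entry π j))) (just (entry a j))

    placing? : ∀ π zs → Dec (Any.Any (EdgePlacing π zs) (arrangements n r))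
    placing? π zs = Any.any? (edgePlacing? π zs) (arrangements n r)

    -- One colouring for each pattern: whether the ordering of the list by π is an edge. Searching
    -- for that ordering defines the colour for lists of every length.
    colour : Perm → List (Fin n) → Bool
    colour π zs = does (placing? π zs)

    colour⁺ : ∀ π zs a → Places π zs a → IsEdge G a → colour π zs ≡ true
    colour⁺ π zs a places e = dec-true (placing? π zs) (lose (∈-arrangements a) (e , places))

    colour⁻ : ∀ π zs a → Places π zs a → colour π zs ≡ true → IsEdge G a
    colour⁻ π zs a places eq =
      let (b , _ , e , places′) = find (T-does⁻ (placing? π zs) (subst T (sym eq) tt))
      in subst (IsEdge G) (entry-≡ λ j → Maybeₚ.just-injective (trans (sym (places′ j)) (places j))) e

    module _ {ys : List (Fin n)} {π : Perm} (hom : Homogeneous r (colour π) ys)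
      {e : Fin r → Fin (length ys)} (order : SameOrder (value π) (toℕ ∘ e))
      {a : Arrangement (Fin n) r} (a≡ : ∀ j → entry a j ≡ List.lookup ys (e j)) where

      private
        inverse : ∀ t → ∃[ j ] entry π j ≡ t
        inverse = injective⇒surjective (entry-injective π)

        -- Undoing π lists the same places of `ys` in increasing order.
        sorted : Fin r → Fin (length ys)
        sorted t = e (proj₁ (inverse t))

        zs : List (Fin n)
        zs = List.tabulate (List.lookup ys ∘ sorted)

        zs⊆ : zs ⊆ ys
        zs⊆ = tabulate-⊆ ys sorted λ {s} {t} s<t → order _ _
          (subst₂ Fin._<_ (sym (proj₂ (inverse s))) (sym (proj₂ (inverse t))) s<t)

        places : Places π zs a
        places j = trans (nth-tabulate (List.lookup ys ∘ sorted) (entry π j))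
          (cong just (trans (cong (List.lookup ys ∘ e) (entry-injective π (proj₂ (inverse (entry π j))))) (sym (a≡ j))))

        colour≡ : colour π zs ≡ proj₁ hom
        colour≡ = proj₂ hom zs⊆ (Listₚ.length-tabulate (List.lookup ys ∘ sorted))

      edge⇒colour : IsEdge G a → proj₁ hom ≡ true
      edge⇒colour edge = trans (sym colour≡) (colour⁺ π zs a places edge)

      colour⇒edge : proj₁ hom ≡ true → IsEdge G a
      colour⇒edge eq = colour⁻ π zs a places (trans colour≡ eq)

  image-subset : ∀ {n k} → (Fin k → Fin n) → Subset n
  image-subset f = tabulate λ v → does (Finₚ.any? λ t → f t Fin.≟ v)

  module _ {n k} (f : Fin k → Fin n) where

    ∈-image⁺ : ∀ t → f t Subset.∈ image-subset f
    ∈-image⁺ t = Vecₚ.lookup⇒[]= (f t) _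
      (trans (Vecₚ.lookup∘tabulate _ (f t)) (dec-true (Finₚ.any? λ t′ → f t′ Fin.≟ f t) (t , refl)))

    ∈-image⁻ : ∀ {v} → v Subset.∈ image-subset f → ∃[ t ] f t ≡ v
    ∈-image⁻ {v} v∈ = T-does⁻ (Finₚ.any? λ t → f t Fin.≟ v)
      (subst T (sym (trans (sym (Vecₚ.lookup∘tabulate (λ v → does (Finₚ.any? λ t → f t Fin.≟ v)) v)) (Vecₚ.[]=⇒lookup v∈))) tt)

    ∣image∣ : Injective _≡_ _≡_ f → Subset.∣ image-subset f ∣ ≡ k
    ∣image∣ inj = ℕₚ.≤-antisym
      (Finₚ.injective⇒≤ {f = λ i → proj₁ (preimage i)} λ {i} {j} eq → enumerate-injective (image-subset f)
        (trans (sym (proj₂ (preimage i))) (trans (cong f eq) (proj₂ (preimage j)))))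
      (Finₚ.injective⇒≤ {f = λ t → proj₁ (position t)} λ {s} {t} eq → inj
        (trans (sym (proj₂ (position s))) (trans (cong (enumerate (image-subset f)) eq) (proj₂ (position t)))))
      where
      preimage : ∀ i → ∃[ t ] f t ≡ enumerate (image-subset f) i
      preimage i = ∈-image⁻ (enumerate-∈ (image-subset f) i)
      position : ∀ t → ∃[ i ] enumerate (image-subset f) i ≡ f t
      position t = index (image-subset f) (∈-image⁺ t)

  -- On a list homogeneous for all patterns, those with colour `true` number at least k. Numbers
  -- that realise a walk in their core serve as places in this list.
  grows : ∀ {k} → k ≤ r ! → (∀ A → Unique A → k ≤ length A → Core A) → PathsGrow r k
  grows {k} k≤r! hasCore M =
    proj₁ family , λ n N≤n → pathNumber (tournament n) (subst (λ l → IsTournament l (tournament n)) length-some (isTournament n))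
      (forces (subst (proj₁ family ≤_) (sym (Listₚ.length-tabulate {n = n} id)) N≤n))
    where
    family : ∃[ N ] (∀ {A : Set} (χ : Perm → List A → Bool) xs → N ≤ length xs →
      ∃[ ys ] (ys ⊆ xs × range M ≤ length ys × (∀ {π} → π ∈ elems → Homogeneous r (χ π) ys)))
    family = ramsey-family elems r (range M)
    -- Any k permutations define an (r, k)-tournament, by which `pathNumber` bounds the maximum.
    some : List Perm
    some = take k elems
    length-some : length some ≡ k
    length-some = trans (Listₚ.length-take k elems) (ℕₚ.m≤n⇒m⊓n≡m (subst (k ≤_) (sym (length-arrangements r)) k≤r!))
    open PatternTournament m some (Uniqueₚ.take⁺ k unique)
    forces : ∀ {n} → proj₁ family ≤ length (allFin n) → ForcesPath {r} {n} k M
    forces {n} N≤ G isT =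
      let (ys , ys⊆ , long , homs) = proj₂ family (colour G) (allFin n) N≤
      in path G isT ys (unique-sublist ys⊆ (Uniqueₚ.allFin⁺ n)) long (λ π → homs (complete π))
      where
      path : ∀ G → IsTournament k G → ∀ ys → Unique ys → range M ≤ length ys →
        (∀ π → Homogeneous r (colour G π) ys) → G Contains tightPath r M
      path G isT ys u long hom = f , f-injective , λ a → path-edge a ∘ T-does⁻ (Finₚ.any? {n = M} _)
        where
        present? : Decidable (λ π → proj₁ (hom π) ≡ true)
        present? π = proj₁ (hom π) Bool.≟ true
        A : List Perm
        A = filter present? elems
        initial : Fin r → Fin (length ys)
        initial = λ t → Fin.inject≤ t (ℕₚ.≤-trans (r≤range M) long)
        initial-mono : ∀ {s t : Fin r} → s Fin.< t → initial s Fin.< initial t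
        initial-mono {s} {t} = subst₂ _<_ (sym (Finₚ.toℕ-inject≤ s _)) (sym (Finₚ.toℕ-inject≤ t _))
        g : Fin r → Fin n
        g = List.lookup ys ∘ initial
        g-injective : Injective _≡_ _≡_ g
        g-injective eq = Finₚ.inject≤-injective _ _ _ _ (lookup-unique u eq)
        -- The first r elements of `ys` carry exactly k edges; these have different patterns, and
        -- homogeneity gives each pattern the colour `true`.
        k≤A : k ≤ length A
        k≤A with isT (image-subset g) (∣image∣ g g-injective)
        ... | xs , unique-xs , char , refl = length-≤ (λ a π → ∀ j → entry a j ≡ g (entry π j)) unique-xs related
          (λ p q → entry-≡ λ j → trans (p j) (sym (q j)))
          where
          related : ∀ {a} → a ∈ xs → ∃[ π ] (π ∈ A × (∀ j → entry a j ≡ g (entry π j)))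
          related {a} a∈ = π , Memₚ.∈-filter⁺ present? (complete π)
              (edge⇒colour G {ys} {π} (hom π) {initial ∘ entry π} (λ i j → initial-mono) {a} a≡ (proj₂ ordering)) , a≡
            where
            ordering : IsOrderingOf a (image-subset g) × IsEdge G a
            ordering = Equivalence.to (char a) a∈
            member : ∀ j → ∃[ t ] g t ≡ entry a j
            member j = ∈-image⁻ g (VecAllₚ.lookup⁺ (proj₁ ordering) j)
            π : Perm
            π = arrange (proj₁ ∘ member) λ {i} {j} eq → entry-injective a
              (trans (sym (proj₂ (member i))) (trans (cong g eq) (proj₂ (member j))))
            a≡ : ∀ j → entry a j ≡ g (entry π j)
            a≡ j = sym (trans (cong g (Vecₚ.lookup∘tabulate (proj₁ ∘ member) j)) (proj₂ (member j)))
        core : Core A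
        core = hasCore A (Uniqueₚ.filter⁺ present? unique) k≤A
        W : ℕ → Perm
        W i = proj₁ (Core.walk core i)
        open Realisation (realise M W (Core.walk-⟶ core))
        in-range : ∀ {i} → i < M → i < M + m
        in-range i<M = ℕₚ.<-≤-trans i<M (ℕₚ.m≤m+n M m)
        place< : ∀ (i : Fin M) → z (toℕ i) < length ys
        place< i = ℕₚ.<-≤-trans (z< (in-range (Finₚ.toℕ<n i))) long
        place : Fin M → Fin (length ys)
        place i = Fin.fromℕ< (place< i)
        toℕ-place : ∀ i → toℕ (place i) ≡ z (toℕ i)
        toℕ-place i = Finₚ.toℕ-fromℕ< (place< i)
        f : Fin M → Fin n
        f = List.lookup ys ∘ place
        f-injective : Injective _≡_ _≡_ f
        f-injective {i} {j} eq = Finₚ.toℕ-injective (z-injective (in-range (Finₚ.toℕ<n i)) (in-range (Finₚ.toℕ<n j))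
          (trans (sym (toℕ-place i)) (trans (cong toℕ (lookup-unique u eq)) (toℕ-place j))))
        path-edge : ∀ (a : Arrangement (Fin M) r) → ∃[ i ] (∀ j → toℕ (entry a j) ≡ toℕ {M} i + toℕ j) →
          IsEdge G (mapArrangement f f-injective a)
        path-edge a (i , a≡) = colour⇒edge G {ys} {W (toℕ i)} (hom (W (toℕ i))) {place ∘ entry a} order
          {mapArrangement f f-injective a} (entry-map f f-injective a)
          (proj₂ (Memₚ.∈-filter⁻ present? {xs = elems} (Core.walk∈ core (toℕ i))))
          where
          order : SameOrder (value (W (toℕ i))) (toℕ ∘ place ∘ entry a)
          order s t lt = subst₂ _<_ (sym (position s)) (sym (position t))
            (windows (Finₚ.toℕ<n i) (Finₚ.toℕ<n s) (Finₚ.toℕ<n t)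
              (subst₂ _<_ (sym (at-toℕ (W (toℕ i)) s)) (sym (at-toℕ (W (toℕ i)) t)) lt))
            where
            position : ∀ j → toℕ (place (entry a j)) ≡ z (toℕ i + toℕ j)
            position j = trans (toℕ-place (entry a j)) (cong z (a≡ j))

  -- The tournaments of k patterns from `A` have only paths with fewer than r + k vertices, whatever
  -- n is.
  bounded : ∀ {k} A → Unique A → ¬ Core A → k ≤ length A → ¬ PathsGrow r k
  bounded {k} A uniqueA coreless k≤ grow =
    let (N , large) = grow (r + length some)
        (s , (forces , _) , long) = large N ℕₚ.≤-refl
    in ℕₚ.<⇒≱ (no-long-path some-coreless (forces (tournament N)
         (subst (λ l → IsTournament l (tournament N)) length-some (isTournament N)))) long
    where
    some : List Perm
    some = take k A
    length-some : length some ≡ k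
    length-some = trans (Listₚ.length-take k A) (ℕₚ.m≤n⇒m⊓n≡m k≤)
    some-coreless : ¬ Core some
    some-coreless c = coreless (Core-⊆ (λ x∈ → subst (_ ∈_) (Listₚ.take++drop≡id k A) (Memₚ.∈-++⁺ˡ x∈)) c)
    open PatternTournament m some (Uniqueₚ.take⁺ k uniqueA)

-- Rational and real estimates

fromℕ-+ : ∀ i j → fromℕ (i + j) ≡ fromℕ i ℚ.+ fromℕ j
fromℕ-+ zero    j = sym (ℚₚ.+-identityˡ (fromℕ j))
fromℕ-+ (suc i) j = trans (fromℕ-suc (i + j)) (trans (cong (ℚ._+_ ℚ.1ℚ) (fromℕ-+ i j))
  (trans (sym (ℚₚ.+-assoc ℚ.1ℚ (fromℕ i) (fromℕ j))) (cong (ℚ._+ fromℕ j) (sym (fromℕ-suc i)))))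

fromℕ-* : ∀ i j → fromℕ (i * j) ≡ fromℕ i ℚ.* fromℕ j
fromℕ-* zero    j = sym (ℚₚ.*-zeroˡ (fromℕ j))
fromℕ-* (suc i) j = trans (fromℕ-+ j (i * j)) (trans (cong (ℚ._+_ (fromℕ j)) (fromℕ-* i j))
  (trans (solve 2 (λ x y → y :+ x :* y := (con ℚ.1ℚ :+ x) :* y) refl (fromℕ i) (fromℕ j))
    (cong (ℚ._* fromℕ j) (sym (fromℕ-suc i)))))
  where open ℚSolver.+-*-Solver

0<fromℕ : ∀ n .{{_ : NonZero n}} → ℚ.0ℚ ℚ.< fromℕ n
0<fromℕ (suc n) = ℚₚ.<-≤-trans 0<1 (fromℕ-mono {1} {suc n} (s≤s z≤n))

/-*-cancel : ∀ i n .{{_ : NonZero n}} → (i ℚ./ n) ℚ.* fromℕ n ≡ i ℚ./ 1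
/-*-cancel i (suc n) = ℚₚ.toℚᵘ-injective
  (ℚᵘₚ.≃-trans (ℚₚ.toℚᵘ-homo-* (i ℚ./ suc n) (fromℕ (suc n)))
  (ℚᵘₚ.≃-trans (ℚᵘₚ.*-cong (ℚₚ.toℚᵘ-fromℚᵘ (ℚᵘ.mkℚᵘ i n)) (ℚₚ.toℚᵘ-fromℚᵘ (ℚᵘ.mkℚᵘ (+ suc n) 0)))
  (ℚᵘₚ.≃-trans (ℚᵘ.*≡* (trans (ℤₚ.*-identityʳ _) (cong (i ℤ.*_) (sym (ℤₚ.*-identityʳ (+ suc n))))))
    (ℚᵘₚ.≃-sym (ℚₚ.toℚᵘ-fromℚᵘ (ℚᵘ.mkℚᵘ i 0))))))

/1-pred : ∀ n → (+ n ℤ.- + 1) ℚ./ 1 ≡ fromℕ n ℚ.- ℚ.1ℚ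
/1-pred n = ℚₚ.toℚᵘ-injective
  (ℚᵘₚ.≃-trans (ℚₚ.toℚᵘ-fromℚᵘ (ℚᵘ.mkℚᵘ (+ n ℤ.- + 1) 0))
  (ℚᵘₚ.≃-sym (ℚᵘₚ.≃-trans (ℚₚ.toℚᵘ-homo-+ (fromℕ n) (ℚ.- ℚ.1ℚ))
  (ℚᵘₚ.≃-trans (ℚᵘₚ.+-congˡ (ℚᵘ.- ℚᵘ.1ℚᵘ) (ℚₚ.toℚᵘ-fromℚᵘ (ℚᵘ.mkℚᵘ (+ n) 0)))
    (ℚᵘ.*≡* (cong (ℤ._* + 1) (cong (ℤ._+ ℤ.- + 1) (ℤₚ.*-identityʳ (+ n)))))))))

÷!-*-cancel : ∀ i n → (i ÷! n) ℚ.* fromℕ (n !) ≡ i ℚ./ 1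
÷!-*-cancel i n = /-*-cancel i (n !) {{n ℕₚ.!≢0}}

*-cancelʳ : ∀ {x y p} → ℚ.0ℚ ℚ.< p → x ℚ.* p ℚ.≤ y ℚ.* p → x ℚ.≤ y
*-cancelʳ {p = p} 0<p = ℚₚ.*-cancelʳ-≤-pos p {{ℚ.positive 0<p}}

-- The integrand 1 / t is at most 1 from 1 on. For a = 1 and b approximating ln r this gives ln ln r
-- ≤ ln r term by term.
riemannSum≤ : ∀ n {a b} → ℚ.1ℚ ℚ.≤ a → a ℚ.≤ b → riemannSum n a b ℚ.≤ b ℚ.- a
riemannSum≤ zero {a} {b} 1≤a a≤b = ℚₚ.≤-trans
  (*-monoˡ (p≤q⇒0≤q-p a≤b) (inv-antimono 0<1 (ℚₚ.≤-trans 1≤a a≤b)))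
  (ℚₚ.≤-reflexive (ℚₚ.*-identityʳ (b ℚ.- a)))
riemannSum≤ (suc n) {a} {b} 1≤a a≤b = ℚₚ.≤-trans
  (ℚₚ.+-mono-≤ (riemannSum≤ n 1≤a a≤m) (riemannSum≤ n (ℚₚ.≤-trans 1≤a a≤m) m≤b))
  (ℚₚ.≤-reflexive (solve 3 (λ a m b → m :- a :+ (b :- m) := b :- a) refl a (midpoint a b) b))
  where
  open ℚSolver.+-*-Solver
  a≤m : a ℚ.≤ midpoint a b
  a≤m = ≤-midpoint ℚₚ.≤-refl a≤b
  m≤b : midpoint a b ℚ.≤ b
  m≤b = ≤-gap (0≤p*q 0≤½ (p≤q⇒0≤q-p a≤b))
    (solve 2 (λ a b → b := con ℚ.½ :* (a :+ b) :+ con ℚ.½ :* (b :- a)) refl a b)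

-- The quotient ln r / ln ln r is at least 1, so an error of c / r² suffices.
lower-estimate : ∀ R F A c u x Y → ℚ.0ℚ ℚ.< R → ℚ.0ℚ ℚ.< F → ℚ.0ℚ ℚ.≤ c → u ℚ.* R ≡ ℚ.1ℚ → x ℚ.* F ≡ A →
  ℚ.1ℚ ℚ.≤ R ℚ.* R ℚ.* Y → R ℚ.* R ℚ.* F ℚ.≤ R ℚ.* R ℚ.* A ℚ.+ (R ℚ.* F ℚ.+ c ℚ.* F) →
  ℚ.1ℚ ℚ.- u ℚ.- c ℚ.* Y ℚ.≤ x
lower-estimate R F A c u x Y 0<R 0<F 0≤c uR xF 1≤RRY main = *-cancelʳ (0<p*q (0<p*q 0<R 0<R) 0<F) (begin
  (ℚ.1ℚ ℚ.- u ℚ.- c ℚ.* Y) ℚ.* (R ℚ.* R ℚ.* F)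
    ≡⟨ solve 5 (λ u c Y R F → (con ℚ.1ℚ :- u :- c :* Y) :* (R :* R :* F)
         := R :* R :* F :- (u :* R) :* R :* F :- (R :* R :* Y) :* (c :* F)) refl u c Y R F ⟩
  R ℚ.* R ℚ.* F ℚ.- (u ℚ.* R) ℚ.* R ℚ.* F ℚ.- (R ℚ.* R ℚ.* Y) ℚ.* (c ℚ.* F)
    ≤⟨ ℚₚ.+-mono-≤ (ℚₚ.+-mono-≤ main (ℚₚ.≤-reflexive (cong (λ v → ℚ.- (v ℚ.* R ℚ.* F)) uR)))
         (ℚₚ.neg-antimono-≤ (*-monoʳ (0≤p*q 0≤c (ℚₚ.<⇒≤ 0<F)) 1≤RRY)) ⟩
  R ℚ.* R ℚ.* A ℚ.+ (R ℚ.* F ℚ.+ c ℚ.* F) ℚ.- ℚ.1ℚ ℚ.* R ℚ.* F ℚ.- ℚ.1ℚ ℚ.* (c ℚ.* F)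
    ≡⟨ solve 4 (λ R F A c → R :* R :* A :+ (R :* F :+ c :* F) :- con ℚ.1ℚ :* R :* F :- con ℚ.1ℚ :* (c :* F)
         := A :* (R :* R)) refl R F A c ⟩
  A ℚ.* (R ℚ.* R)
    ≡⟨ cong (ℚ._* (R ℚ.* R)) xF ⟨
  x ℚ.* F ℚ.* (R ℚ.* R)
    ≡⟨ solve 3 (λ x F R → x :* F :* (R :* R) := x :* (R :* R :* F)) refl x F R ⟩
  x ℚ.* (R ℚ.* R ℚ.* F) ∎)
  where
  open ℚₚ.≤-Reasoning
  open ℚSolver.+-*-Solver

opaque
  -- The square of the least r that `large-acyclic` treats: for smaller r the error C₀ / r ^ 2
  -- exceeds 1 and the lower bound is trivial. From 2 ^ 64 on, 6 would be enough.
  C₀ : ℕ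
  C₀ = 2 ^ 64 * 2 ^ 64

  6≤C₀ : 6 ≤ C₀
  6≤C₀ = toWitness {a? = 6 ≤? 2 ^ 64 * 2 ^ 64} _

  square≤C₀ : ∀ {r} → r < 2 ^ 64 → r * r ≤ C₀
  square≤C₀ r< = ℕₚ.*-mono-≤ (ℕₚ.<⇒≤ r<) (ℕₚ.<⇒≤ r<)

-- The bounds for a fixed r

module Bounds (m : ℕ) (3≤r : 3 ≤ suc m) where
  open Cyclic m

  private
    1≤m : 1 ≤ m
    1≤m = ℕₚ.≤-trans (s≤s z≤n) (ℕₚ.≤-pred 3≤r)

    edge? : ∀ a b → Dec (Digraph._⟶_ (PSG r) a b)
    edge? a b = map′ (to-PSG {a} {b}) (from-PSG {a} {b}) (a ⟶? b)

    module G = Graph (PSG r)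
    module D = G.Decided _≟ᴬ_ edge?

    coreless⇐ : ∀ {S} → InducesAcyclic (PSG r) S → ¬ Core S
    coreless⇐ acyclic c = D.acyclic⇒coreless acyclic (map-core (λ {a} {b} → to-PSG {a} {b}) c)

    coreless⇒ : ∀ {S} → ¬ Core S → InducesAcyclic (PSG r) S
    coreless⇒ ¬c = D.coreless⇒acyclic λ c → ¬c (map-core (λ {a} {b} → from-PSG {a} {b}) c)

    number : ∃[ a ] IsAcyclicNumber (PSG r) a
    number = D.acyclicNumber (listed r r)

  a : ℕ
  a = proj₁ number

  isAcyclicNumber : IsAcyclicNumber (PSG r) a
  isAcyclicNumber = proj₂ number

  private
    witness : ∃[ S ] (Unique S × ¬ Core S × length S ≡ a)
    witness = let (S , u , acyclic , len) = proj₁ isAcyclicNumber in S , u , coreless⇐ acyclic , len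

    coreless≤a : ∀ {S} → Unique S → ¬ Core S → length S ≤ a
    coreless≤a {S} u ¬c = proj₂ isAcyclicNumber (S , u , coreless⇒ ¬c , refl)

    upper : a + (m ! + totient r) ≤ r !
    upper = let (S , u , ¬c , len) = witness in
      subst (λ l → l + (m ! + totient r) ≤ r !) len (acyclic-size m 1≤m ¬c u)

    lower : r * r * r ! ≤ r * r * a + (r * r ! + C₀ * r !)
    lower = byCases (2 ^ 64 ≤? r)
      where
      byCases : Dec (2 ^ 64 ≤ r) → r * r * r ! ≤ r * r * a + (r * r ! + C₀ * r !)
      byCases (no  ≰r) = ℕₚ.≤-trans (ℕₚ.*-monoˡ-≤ (r !) (square≤C₀ (ℕₚ.≰⇒> ≰r)))
        (ℕₚ.≤-trans (ℕₚ.m≤n+m (C₀ * r !) (r * r !)) (ℕₚ.m≤n+m _ (r * r * a)))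
      byCases (yes ≤r) = let (S , u , ¬c , large) = large-acyclic m ≤r in
        ℕₚ.≤-trans large (ℕₚ.+-mono-≤ (ℕₚ.*-monoʳ-≤ (r * r) (coreless≤a u ¬c))
          (ℕₚ.+-monoʳ-≤ (r * r !) (ℕₚ.*-monoˡ-≤ (r !) 6≤C₀)))

  isThreshold : IsThreshold r (suc a)
  isThreshold = (1+a≤r! , grows 1+a≤r! hasCore) , λ {k} (_ , grow) → ℕₚ.≰⇒> λ k≤a →
    let (S , u , ¬c , len) = witness in bounded S u ¬c (subst (k ≤_) (sym len) k≤a) grow
    where
    open Threshold m
    1+a≤r! : suc a ≤ r !
    1+a≤r! = ℕₚ.≤-trans (ℕₚ.≤-trans (ℕₚ.≤-reflexive (ℕₚ.+-comm 1 a))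
      (ℕₚ.+-monoʳ-≤ a (ℕₚ.≤-trans (ℕₚ.1≤n! m) (ℕₚ.m≤m+n (m !) (totient r))))) upper
    hasCore : ∀ A → Unique A → suc a ≤ length A → Core A
    hasCore A u a<A = decidable-stable (core? A) λ ¬c → ℕₚ.<⇒≱ a<A (coreless≤a u ¬c)

  R F x u : ℚ.ℚ
  R = fromℕ r
  F = fromℕ (r !)
  x = + a ÷! r
  u = + 1 ℚ./ r

  private
    0<R : ℚ.0ℚ ℚ.< R
    0<R = 0<fromℕ r
    0<F : ℚ.0ℚ ℚ.< F
    0<F = 0<fromℕ (r !) {{r ℕₚ.!≢0}}
    u*R : u ℚ.* R ≡ ℚ.1ℚ
    u*R = /-*-cancel (+ 1) r
    x*F : x ℚ.* F ≡ fromℕ a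
    x*F = ÷!-*-cancel (+ a) r
    u*F : u ℚ.* F ≡ fromℕ (m !)
    u*F = trans (cong (ℚ._*_ u) (fromℕ-* r (m !))) (trans (sym (ℚₚ.*-assoc u R (fromℕ (m !))))
      (trans (cong (ℚ._* fromℕ (m !)) u*R) (ℚₚ.*-identityˡ (fromℕ (m !)))))
    upperℚ : fromℕ a ℚ.+ (fromℕ (m !) ℚ.+ fromℕ (totient r)) ℚ.≤ F
    upperℚ = subst (ℚ._≤ F) (trans (fromℕ-+ a _) (cong (ℚ._+_ (fromℕ a)) (fromℕ-+ (m !) (totient r)))) (fromℕ-mono upper)

  acyclic-upper : x ℚ.≤ acyclicUpperBound r
  acyclic-upper = *-cancelʳ 0<F (ℚₚ.≤-trans (ℚₚ.≤-reflexive x*F)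
    (≤-gap (p≤q⇒0≤q-p upperℚ) (trans
      (solve 3 (λ u y F → (con ℚ.1ℚ :- u :- y) :* F := F :- u :* F :- y :* F) refl u (+ totient r ÷! r) F)
      (trans (cong₂ (λ v w → F ℚ.- v ℚ.- w) u*F (÷!-*-cancel (+ totient r) r))
        (solve 4 (λ a k φ F → F :- k :- φ := a :+ (F :- (a :+ (k :+ φ)))) refl (fromℕ a) (fromℕ (m !)) (fromℕ (totient r)) F)))))
    where open ℚSolver.+-*-Solver

  threshold-upper : fromℕ (suc a) ℚ.≤ thresholdUpperBound r
  threshold-upper = ≤-gap (p≤q⇒0≤q-p upperℚ) (trans
    (solve 3 (λ u y F → (con ℚ.1ℚ :- u :- y) :* F := F :- u :* F :- y :* F) refl u ((+ totient r ℤ.- + 1) ÷! r) F)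
    (trans (cong₂ (λ v w → F ℚ.- v ℚ.- w) u*F (trans (÷!-*-cancel (+ totient r ℤ.- + 1) r) (/1-pred (totient r))))
    (trans (solve 4 (λ a k φ F → F :- k :- (φ :- con ℚ.1ℚ) := con ℚ.1ℚ :+ a :+ (F :- (a :+ (k :+ φ)))) refl
              (fromℕ a) (fromℕ (m !)) (fromℕ (totient r)) F)
      (cong (ℚ._+ (F ℚ.- (fromℕ a ℚ.+ (fromℕ (m !) ℚ.+ fromℕ (totient r))))) (sym (fromℕ-suc a))))))
    where open ℚSolver.+-*-Solver

  c : ℚ.ℚ
  c = fromℕ C₀

  -- The estimate holds for the approximations themselves, once those of ln r are at least 1 and
  -- those of ln ln r are positive.
  eventually : ∃[ N ] (∀ {n} → N ≤ n → seq (lowerBound r (fromℚ c) 3≤r) n ℚ.≤ x)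
  eventually = start₁ ⊔ start₂ , λ {n} N≤n → lower-estimate R F (fromℕ a) c u x
    (l n ℚ.* inv (R ℚ.* R ℚ.* ll n)) 0<R 0<F (fromℕ-mono (z≤n {C₀})) u*R x*F
    (1≤RRY n (large (ℕₚ.m⊔n≤o⇒m≤o start₁ start₂ N≤n)) (positive (ℕₚ.m⊔n≤o⇒n≤o start₁ start₂ N≤n))) lowerℚ
    where
    open _<ᴿ_ (1<lnℕ 3≤r) renaming (gap to gap₁; 0<gap to 0<gap₁; start to start₁; gap-≤ to gap-≤₁)
    open _<ᴿ_ (0<lnlnℕ 3≤r) renaming (gap to gap₂; 0<gap to 0<gap₂; start to start₂; gap-≤ to gap-≤₂)
    l ll : ℕ → ℚ.ℚ
    l  = seq (lnℕ 3≤r)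
    ll = seq (lnlnℕ 3≤r)
    large : ∀ {n} → start₁ ≤ n → ℚ.1ℚ ℚ.≤ l n
    large ≤n = ℚₚ.≤-trans (≤-gap (ℚₚ.<⇒≤ 0<gap₁) refl) (gap-≤₁ ≤n)
    positive : ∀ {n} → start₂ ≤ n → ℚ.0ℚ ℚ.< ll n
    positive {n} ≤n = ℚₚ.<-≤-trans 0<gap₂ (subst (ℚ._≤ ll n) (ℚₚ.+-identityˡ gap₂) (gap-≤₂ ≤n))
    1≤RRY : ∀ n → ℚ.1ℚ ℚ.≤ l n → ℚ.0ℚ ℚ.< ll n → ℚ.1ℚ ℚ.≤ R ℚ.* R ℚ.* (l n ℚ.* inv (R ℚ.* R ℚ.* ll n))
    1≤RRY n 1≤l 0<ll = begin
      ℚ.1ℚ                                       ≡⟨ p*inv-p≡1 0<RRll ⟨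
      R ℚ.* R ℚ.* ll n ℚ.* i                     ≡⟨ ℚₚ.*-assoc (R ℚ.* R) (ll n) i ⟩
      R ℚ.* R ℚ.* (ll n ℚ.* i)                   ≤⟨ *-monoˡ (ℚₚ.<⇒≤ 0<RR) (*-monoʳ (ℚₚ.<⇒≤ (0<inv 0<RRll)) ll≤l) ⟩
      R ℚ.* R ℚ.* (l n ℚ.* i)                    ∎
      where
      open ℚₚ.≤-Reasoning
      i : ℚ.ℚ
      i = inv (R ℚ.* R ℚ.* ll n)
      0<RR : ℚ.0ℚ ℚ.< R ℚ.* R
      0<RR = 0<p*q 0<R 0<R
      0<RRll : ℚ.0ℚ ℚ.< R ℚ.* R ℚ.* ll n
      0<RRll = 0<p*q 0<RR 0<ll
      ll≤l : ll n ℚ.≤ l n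
      ll≤l = ℚₚ.≤-trans (riemannSum≤ n ℚₚ.≤-refl 1≤l) (≤-gap 0≤1
        (ℚSolver.+-*-Solver.solve 1 (λ y → y := y :- con ℚ.1ℚ :+ con ℚ.1ℚ) refl (l n)))
        where open ℚSolver.+-*-Solver using (_:=_; _:-_; _:+_; con)
    lowerℚ : R ℚ.* R ℚ.* F ℚ.≤ R ℚ.* R ℚ.* fromℕ a ℚ.+ (R ℚ.* F ℚ.+ c ℚ.* F)
    lowerℚ = subst₂ ℚ._≤_ (product r (r !))
      (trans (fromℕ-+ (r * r * a) _) (cong₂ ℚ._+_ (product r a)
        (trans (fromℕ-+ (r * r !) (C₀ * r !)) (cong₂ ℚ._+_ (fromℕ-* r (r !)) (fromℕ-* C₀ (r !))))))
      (fromℕ-mono lower)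
      where
      product : ∀ p q → fromℕ (p * p * q) ≡ fromℕ p ℚ.* fromℕ p ℚ.* fromℕ q
      product p q = trans (fromℕ-* (p * p) q) (cong (ℚ._* fromℕ q) (fromℕ-* p p))

  acyclic-lower : lowerBound r (fromℚ c) 3≤r ≤ᴿ fromℚ x
  acyclic-lower 0<ε = let (N , below) = eventually in
    N , λ N≤n → ℚₚ.≤-trans (below N≤n) (≤-gap (ℚₚ.<⇒≤ 0<ε) refl)

  threshold-lower : lowerBound r (fromℚ c) 3≤r *ᴿ ℕ→ℝ (r !) ≤ᴿ ℕ→ℝ (suc a)
  threshold-lower 0<ε = let (N , below) = eventually in
    N , λ N≤n → ℚₚ.≤-trans (*-monoʳ (ℚₚ.<⇒≤ 0<F) (below N≤n)) (ℚₚ.≤-trans (ℚₚ.≤-reflexive x*F)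
      (ℚₚ.≤-trans (fromℕ-mono (ℕₚ.n≤1+n a)) (≤-gap (ℚₚ.<⇒≤ 0<ε) refl)))

corollary13 : ∃[ C ] (0ᴿ <ᴿ C ×
    (∀ r .{{_ : NonZero r}} (3≤r : 3 ≤ r) →
    (∃[ a ] (IsAcyclicNumber (PSG r) a
    × lowerBound r C 3≤r ≤ᴿ fromℚ (+ a ÷! r)
    × + a ÷! r ℚ.≤ acyclicUpperBound r))
    × (∃[ t ] (IsThreshold r t
    × lowerBound r C 3≤r *ᴿ ℕ→ℝ (r !) ≤ᴿ ℕ→ℝ t
    × fromℕ t ℚ.≤ thresholdUpperBound r))))
corollary13 = fromℚ (fromℕ C₀) ,
  mk<ᴿ 0<1 0 (λ _ → subst (ℚ._≤ fromℕ C₀) (sym (ℚₚ.+-identityˡ ℚ.1ℚ)) (fromℕ-mono (ℕₚ.≤-trans (s≤s z≤n) 6≤C₀))) ,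
  λ { (suc m) 3≤r → let open Bounds m 3≤r in
    (a , isAcyclicNumber , acyclic-lower , acyclic-upper) ,
    (suc a , isThreshold , threshold-lower , threshold-upper) }
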